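{- For any $u<w$ in $W$ with $u\in c_0$, $w\in c_1$ and $|L(u)|=|R(u)|=1$, we have $\mu(u,w)=0$.
   Context: $W$ is the affine Weyl group of type $\widetilde A_2$: the Coxeter group on $S=\{r,s,t\}$ with $(rs)^3=(st)^3=(rt)^3=1$, with length $l$ and Bruhat order $\le$. For $u<w$, $\mu(u,w)$ is the coefficient of $q^{(l(w)-l(u)-1)/2}$ in the Kazhdan–Lusztig polynomial $P_{u,w}$. $c_1$ is the set of elements $w\neq e$ having a unique reduced expression (the two-sided cell of $\mathbf a$-value 1), and $c_0=W\setminus(\{e\}\cup c_1)$ (the two-sided cell of $\mathbf a$-value 3). $L(u)=\{\sigma\in S:\sigma u<u\}$, $R(u)=\{\sigma\in S:u\sigma<u\}$. -}

module Defs where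

-- Affine Weyl group W of type Ã₂ on S = {r , s , t}, realised faithfully as the
-- affine symmetric group: an element is determined by its "window"
-- (f 1 , f 2 , f 3) where f : ℤ → ℤ is a bijection with f (i + 3) = f i + 3.
-- Generators: r = s₀ (swaps 3k and 3k+1), s = s₁ (3k+1 ↔ 3k+2),
-- t = s₂ (3k+2 ↔ 3k+3).  Elements of W are represented by words in S;
-- two words denote the same element iff they have the same window.

open import Data.Nat using (ℕ; zero; suc; _+_; _∸_; _<_; _<ᵇ_; _/_; _%_)
open import Data.Integer as ℤ using (ℤ; +_; -[1+_])
open import Data.Fin using (Fin; zero; suc)
open import Data.Bool using (Bool; true; false; if_then_else_; not; _∧_)
open import Data.List using (List; []; _∷_; _++_; map; foldl; foldr; length; filterᵇ; concatMap)
open import Data.Bool.ListAction using (any)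
open import Data.List.Relation.Binary.Sublist.Propositional using (_⊆_)
open import Data.Product using (_×_; _,_; ∃; ∃-syntax)
open import Data.Product.Properties using (≡-dec)
open import Relation.Binary.PropositionalEquality using (_≡_)
open import Relation.Nullary using (¬_; does)

Gen : Set
Gen = Fin 3

r s t : Gen
r = zero
s = suc zero
t = suc (suc zero)

Word : Set
Word = List Gen

Win : Set
Win = ℤ × ℤ × ℤ

idW : Win
idW = (+ 1 , + 2 , + 3)

-- right multiplication of an affine permutation by a generator
act : Win → Gen → Win
act (a , b , c) zero             = (c ℤ.- + 3 , b , a ℤ.+ + 3)
act (a , b , c) (suc zero)       = (b , a , c)
act (a , b , c) (suc (suc zero)) = (a , c , b)

eval : Word → Win
eval = foldl act idW

eqWin : Win → Win → Bool
eqWin x y = does (≡-dec ℤ._≟_ (≡-dec ℤ._≟_ ℤ._≟_) x y)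

sameB : Word → Word → Bool
sameB u w = eqWin (eval u) (eval w)

gens : List Gen
gens = r ∷ s ∷ t ∷ []

words : ℕ → List Word
words zero    = [] ∷ []
words (suc k) = concatMap (λ g → map (g ∷_) (words k)) gens

lenSearch : Word → ℕ → ℕ → ℕ
lenSearch w k zero       = k
lenSearch w k (suc fuel) =
  if any (λ b → sameB b w) (words k) then k else lenSearch w (suc k) fuel

len : Word → ℕ
len w = lenSearch w 0 (length w)

Reduced : Word → Set
Reduced a = len a ≡ length a

redWord : Word → Word
redWord w = pick (filterᵇ (λ b → sameB b w) (words (len w)))
  where
  pick : List Word → Word
  pick []      = w
  pick (b ∷ _) = b

_≤B_ : Word → Word → Set
u ≤B w = ∃[ a ] (Reduced a × eval a ≡ eval w × ∃[ b ] (b ⊆ a × eval b ≡ eval u))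

_<B_ : Word → Word → Set
u <B w = u ≤B w × ¬ (eval u ≡ eval w)

-- Polynomials in ℤ[q] as coefficient lists (constant term first)

Poly : Set
Poly = List ℤ

_⊕_ : Poly → Poly → Poly
[]       ⊕ q        = q
p        ⊕ []       = p
(a ∷ p)  ⊕ (b ∷ q)  = (a ℤ.+ b) ∷ (p ⊕ q)

scale : ℤ → Poly → Poly
scale c = map (c ℤ.*_)

neg : Poly → Poly
neg = scale (ℤ.- + 1)

shift : ℕ → Poly → Poly
shift zero    p = p
shift (suc k) p = + 0 ∷ shift k p

coeff : Poly → ℕ → ℤ
coeff []      _       = + 0
coeff (a ∷ _) zero    = a
coeff (_ ∷ p) (suc k) = coeff p k

-- μ read off from P_{z,v}: coefficient of q^{(l(v)-l(z)-1)/2},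
-- taken to be 0 when l(v) - l(z) is even (no such integral power)
muOf : Poly → ℕ → ℕ → ℤ
muOf p lz lv = if (((lv ∸ lz) % 2) Data.Nat.≡ᵇ 1)
               then coeff p ((lv ∸ lz ∸ 1) / 2) else + 0

-- Kazhdan–Lusztig polynomials via the recursion of Kazhdan–Lusztig (2.2.c):
-- for w = σ v with σ v > v (l(w) = l(v)+1), c = 1 if σx < x, else 0,
--   P_{x,w} = q^{1-c} P_{σx,v} + q^c P_{x,v}
--             - Σ_{z < v, σz < z} μ(z,v) q^{(l(w)-l(z))/2} P_{x,z},
-- P_{x,e} = δ_{x,e}.  (P_{x,y} = 0 for x ≰ y.)

ltB : Word → Word → Bool
ltB a b = len a <ᵇ len b

memB : Word → List Word → Bool
memB z = any (sameB z)

dedup : List Word → List Word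
dedup = foldr (λ z acc → if memB z acc then acc else z ∷ acc) []

subwords : Word → List Word
subwords []       = [] ∷ []
subwords (g ∷ xs) = map (g ∷_) (subwords xs) ++ subwords xs

below : Word → List Word
below v = filterᵇ (λ z → not (sameB z v)) (dedup (subwords v))

sumP : List Poly → Poly
sumP = foldr _⊕_ []

-- KLrec fuel x a : P_{x,w} where a is a reduced expression of w
-- (correct as long as fuel ≥ length a)
KLrec : ℕ → Word → Word → Poly
KLrec _       x []      = if sameB x [] then (+ 1 ∷ []) else []
KLrec zero    x (g ∷ a) = []
KLrec (suc n) x (g ∷ a) =
  shift (if c then 0 else 1) (KLrec n (g ∷ x) a)
  ⊕ (shift (if c then 1 else 0) (KLrec n x a)
  ⊕ neg (sumP (map term (filterᵇ (λ z → ltB (g ∷ z) z) (below a)))))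
  where
  c : Bool
  c = ltB (g ∷ x) x
  term : Word → Poly
  term z = scale (muOf (KLrec n z a) (len z) (length a))
                 (shift ((suc (length a) ∸ len z) / 2) (KLrec n x (redWord z)))

KL : Word → Word → Poly
KL u w = KLrec (length (redWord w)) u (redWord w)

μ : Word → Word → ℤ
μ u w = muOf (KL u w) (len u) (len w)

IsE : Word → Set
IsE w = eval w ≡ idW

InC1 : Word → Set
InC1 w = ¬ IsE w ×
  (∀ a b → Reduced a → Reduced b → eval a ≡ eval w → eval b ≡ eval w → a ≡ b)

InC0 : Word → Set
InC0 w = ¬ IsE w × ¬ InC1 w

InL : Word → Gen → Set
InL u σ = len (σ ∷ u) < len u

InR : Word → Gen → Set
InR u σ = len (u ++ (σ ∷ [])) < len u

ExactlyOne : (Gen → Set) → Set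
ExactlyOne P = ∃[ σ ] (P σ × (∀ τ → P τ → τ ≡ σ))

{-# OPTIONS --safe #-}
module Submission where

open import Defs
open import Data.Integer using (+_)
open import Data.Product using (_×_)
open import Relation.Binary.PropositionalEquality using (_≡_)

-- A non-identity element with a unique reduced expression is a cyclic word A = i , i±1 , i±2 , ….  Its
-- Kazhdan–Lusztig polynomials are P(x , A) = [x ∈ R₀] + q [x ∈ R₁] for explicit polygonal regions R₀ and R₁ of
-- alcoves.  Multiplying by C_g sends the indicator of a lower set D to the indicator of D ∪ gD plus q times that of
-- D ∩ gD, so C_g C_A is computed by comparing polygons; it involves only cyclic words and words i+1 , A.
-- The correction terms of the recursion run through a much larger set of elements, so the formula is not proved by
-- following the recursion: instead, P is characterised as the unique function of small degree in the span of the
-- symmetric multiples of the C_v, which also shows that the recursion does not depend on the reduced word.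
-- Hence μ(u , A) can be nonzero only if u is shorter by 1 or 3.  If by 1, then u is A with a letter deleted: it is
-- again cyclic, or it begins or ends with a braid, or it is not reduced.  If by 3, then u is a maximal element of
-- R₁: a cyclic word, or a word beginning with a braid.

-- The bar involution is never constructed. Its role is played by membership in the span of the
-- elements (q^i + q^j) C_v with i + j + ℓ(v) fixed: at a longest v that occurs, the coefficient is
-- a palindrome whose upper half is killed by the degree bound, so the difference of two candidates
-- is 0. The identities between polygons depend on a parameter m. Each is an equation between
-- integer combinations of indicators of affine inequalities in x, y, m, so one evaluation of a
-- verified Fourier-Motzkin test settles it for all m; lattice points that belong to no group
-- element are excluded by a congruence modulo 3. Among the corrections in the products that are
-- computed, only one drops the length by three: the term q² C_B for A of even length, and this B
-- begins with a braid. The hypothesis on L(u) excludes it, and also the deletion of the second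
-- letter of A; the hypothesis on R(u) excludes the deletion of the last letter but one.

module Regions where

  open import Data.Bool using (Bool; true; false; if_then_else_; _∧_; _∨_)
  open import Data.Empty using (⊥; ⊥-elim)
  open import Data.Nat as ℕ using (ℕ; zero; suc)
  open import Data.Integer as ℤ using (ℤ; +_; -[1+_]; -_; _+_; _*_; _-_; _≤_; +≤+)
  open import Data.Integer.Properties as ℤP using (_≤?_; _≟_)
  open import Data.Integer.DivMod using (_/ℕ_)
  open import Data.Integer.Tactic.RingSolver using (solve-∀)
  open import Data.List using (List; []; _∷_; _++_; map; concatMap; filterᵇ; foldr)
  open import Data.List.Relation.Unary.All using (All; []; _∷_)
  open import Data.List.Relation.Unary.All.Properties using (++⁺)
  open import Data.Maybe using (Maybe; just; nothing)
  open import Data.Product using (_×_; _,_; proj₁; proj₂; ∃)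
  open import Data.Product.Properties using (≡-dec)
  open import Data.Sum using (_⊎_; inj₁; inj₂)
  open import Relation.Binary.PropositionalEquality using (_≡_; refl; sym; trans; cong; cong₂; subst)
  open import Relation.Nullary using (¬_; does; yes; no; Dec)
  open import Relation.Nullary.Decidable using (_×-dec_)

  -- Affine forms and Fourier-Motzkin elimination over the integers

  -- (a , b , c , d) is the affine form a·x + b·y + c·m + d.
  Lin : Set
  Lin = ℤ × ℤ × ℤ × ℤ

  Env : Set
  Env = ℤ × ℤ × ℤ

  ⟦_⟧ : Lin → Env → ℤ
  ⟦ a , b , c , d ⟧ (x , y , m) = a * x + b * y + c * m + d

  Sat : Env → Lin → Set
  Sat ρ f = + 0 ≤ ⟦ f ⟧ ρ

  comb : ℕ → Lin → ℕ → Lin → Lin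
  comb p (a , b , c , d) q (a' , b' , c' , d') =
    (+ p * a + + q * a' , + p * b + + q * b' , + p * c + + q * c' , + p * d + + q * d')

  comb-sound : ∀ ρ p f q g → Sat ρ f → Sat ρ g → Sat ρ (comb p f q g)
  comb-sound ρ@(x , y , m) p f@(a , b , c , d) q g@(a' , b' , c' , d') sf sg =
    subst (+ 0 ≤_) (sym (lemma (+ p) a b c d (+ q) a' b' c' d' x y m))
      (ℤP.+-mono-≤ (nonneg p sf) (nonneg q sg))
    where
    nonneg : ∀ n {i} → + 0 ≤ i → + 0 ≤ + n * i
    nonneg n {i} h = subst (_≤ + n * i) (ℤP.*-zeroʳ (+ n)) (ℤP.*-monoˡ-≤-nonNeg (+ n) h)
    lemma : ∀ p a b c d q a' b' c' d' x y m →
      (p * a + q * a') * x + (p * b + q * b') * y + (p * c + q * c') * m + (p * d + q * d')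
      ≡ p * (a * x + b * y + c * m + d) + q * (a' * x + b' * y + c' * m + d')
    lemma = solve-∀

  -- Rounding the constant after a division is the only integral step; it excludes the lattice points that are not group elements.
  module _ (n-1 : ℕ) where
    private
      n : ℤ
      n = + suc n-1

      quot : ℤ → ℤ
      quot i = i /ℕ suc n-1

    -- The remainder bound on `d` is tested together with the divisibilities, so that soundness
    -- rests on the test and not on the theory of floor division.
    Divisible : Lin → Set
    Divisible (a , b , c , d) = n * quot a ≡ a × n * quot b ≡ b × n * quot c ≡ c × d ≤ n * quot d + + n-1

    divisible? : ∀ f → Dec (Divisible f)
    divisible? (a , b , c , d) =
      (n * quot a ≟ a) ×-dec ((n * quot b ≟ b) ×-dec ((n * quot c ≟ c) ×-dec (d ≤? n * quot d + + n-1)))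

    tightenBy : Lin → Lin
    tightenBy f@(a , b , c , d) with divisible? f
    ... | yes _ = (quot a , quot b , quot c , quot d)
    ... | no _  = f

    tightenBy-sound : ∀ ρ f → Sat ρ f → Sat ρ (tightenBy f)
    tightenBy-sound (x , y , m) f@(a , b , c , d) sf with divisible? f
    ... | no _ = sf
    ... | yes (pa , pb , pc , pd) = cancel (quot a * x + quot b * y + quot c * m + quot d) (begin
        + 0                                               ≤⟨ sf ⟩
        a * x + b * y + c * m + d                         ≤⟨ ℤP.+-monoʳ-≤ (a * x + b * y + c * m) pd ⟩
        a * x + b * y + c * m + (n * quot d + + n-1)      ≡⟨ cong₂ (λ u v → u + v * m + (n * quot d + + n-1)) (cong₂ (λ u v → u * x + v * y) (sym pa) (sym pb)) (sym pc) ⟩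
        n * quot a * x + n * quot b * y + n * quot c * m + (n * quot d + + n-1)
                                                          ≡⟨ factor n (quot a) (quot b) (quot c) (quot d) x y m (+ n-1) ⟩
        n * (quot a * x + quot b * y + quot c * m + quot d) + + n-1 ∎)
      where
      open ℤP.≤-Reasoning
      factor : ∀ n a b c d x y m r → n * a * x + n * b * y + n * c * m + (n * d + r) ≡ n * (a * x + b * y + c * m + d) + r
      factor = solve-∀
      -1<0 : ∀ k → -[1+ k ] + + k ≡ -[1+ 0 ]
      -1<0 k = trans (cong (λ i → i + + k) (ℤP.neg-distrib-+ (+ 1) (+ k))) (trans (ℤP.+-assoc -[1+ 0 ] (- + k) (+ k)) (cong (λ i → -[1+ 0 ] + i) (ℤP.+-inverseˡ (+ k))))
      cancel : ∀ i → + 0 ≤ n * i + + n-1 → + 0 ≤ i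
      cancel (+ _) _ = +≤+ ℕ.z≤n
      cancel -[1+ k ] h with subst (+ 0 ≤_) (trans (cong (λ i → i + + n-1) (trans (ℤP.*-comm n -[1+ 0 ]) (ℤP.-1*i≡-i n))) (-1<0 n-1))
          (ℤP.≤-trans h (ℤP.+-monoˡ-≤ (+ n-1) (ℤP.*-monoˡ-≤-nonNeg n (ℤ.-≤- {m = k} {n = 0} ℕ.z≤n))))
      ... | ()

  -- The arguments of `tightenBy` are the divisors less one: 3 is tried before 2. Multiples of 3
  -- come from the coefficient 3 in `residue`.
  tighten : Lin → Lin
  tighten f = tightenBy 1 (tightenBy 2 f)

  tighten-sound : ∀ ρ f → Sat ρ f → Sat ρ (tighten f)
  tighten-sound ρ f sf = tightenBy-sound 1 ρ (tightenBy 2 f) (tightenBy-sound 2 ρ f sf)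

  parallel : Lin → Lin → Bool
  parallel (a , b , c , _) (a' , b' , c' , _) = does (a ≟ a') ∧ (does (b ≟ b') ∧ does (c ≟ c'))

  constant : Lin → ℤ
  constant (_ , _ , _ , d) = d

  -- Of two parallel constraints the one with the smaller constant is the stronger. Keeping only
  -- that one contains the quadratic growth of `eliminate`.
  insert : Lin → List Lin → List Lin
  insert f [] = f ∷ []
  insert f (g ∷ cs) = if parallel f g
    then (if does (constant f ≤? constant g) then f ∷ cs else g ∷ cs)
    else g ∷ insert f cs

  insert-sound : ∀ ρ f {cs} → Sat ρ f → All (Sat ρ) cs → All (Sat ρ) (insert f cs)
  insert-sound ρ f sf [] = sf ∷ []
  insert-sound ρ f {g ∷ cs} sf (sg ∷ ss) with parallel f g
  ... | false = sg ∷ insert-sound ρ f sf ss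
  ... | true with does (constant f ≤? constant g)
  ...   | true  = sf ∷ ss
  ...   | false = sg ∷ ss

  prune : List Lin → List Lin
  prune = foldr insert []

  prune-sound : ∀ ρ {cs} → All (Sat ρ) cs → All (Sat ρ) (prune cs)
  prune-sound ρ [] = []
  prune-sound ρ (s ∷ ss) = insert-sound ρ _ s (prune-sound ρ ss)

  coord : ℕ → Lin → ℤ
  coord 0 (a , _ , _ , _) = a
  coord 1 (_ , b , _ , _) = b
  coord _ (_ , _ , c , _) = c

  -- The multipliers are the absolute values of two coefficients of opposite sign, so variable `i`
  -- cancels. One order of signs suffices because `eliminate` runs over all ordered pairs.
  pairWith : ℕ → Lin → Lin → List Lin
  pairWith i f g with coord i f | coord i g
  ... | + suc p | -[1+ q ] = tighten (comb (suc q) f (suc p) g) ∷ []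
  ... | _       | _        = []

  pairWith-sound : ∀ ρ i f g → Sat ρ f → Sat ρ g → All (Sat ρ) (pairWith i f g)
  pairWith-sound ρ i f g sf sg with coord i f | coord i g
  ... | + suc p | -[1+ q ] = tighten-sound ρ (comb (suc q) f (suc p) g) (comb-sound ρ (suc q) f (suc p) g sf sg) ∷ []
  ... | + zero | _ = []
  ... | -[1+ _ ] | _ = []
  ... | + suc p | + q = []

  isZero : ℤ → Bool
  isZero (+ zero) = true
  isZero _ = false

  eliminate : ℕ → List Lin → List Lin
  eliminate i cs = prune (filterᵇ (λ f → isZero (coord i f)) cs ++ concatMap (λ f → concatMap (pairWith i f) cs) cs)

  filterᵇ⁺ : ∀ {A : Set} {P : A → Set} (p : A → Bool) {xs} → All P xs → All P (filterᵇ p xs)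
  filterᵇ⁺ p [] = []
  filterᵇ⁺ p {x ∷ xs} (px ∷ pxs) with p x
  ... | true  = px ∷ filterᵇ⁺ p pxs
  ... | false = filterᵇ⁺ p pxs

  concatMap⁺ : ∀ {A B : Set} {P : A → Set} {Q : B → Set} (h : A → List B) →
    (∀ x → P x → All Q (h x)) → ∀ {xs} → All P xs → All Q (concatMap h xs)
  concatMap⁺ h H [] = []
  concatMap⁺ h H (px ∷ pxs) = ++⁺ (H _ px) (concatMap⁺ h H pxs)

  eliminate-sound : ∀ ρ i {cs} → All (Sat ρ) cs → All (Sat ρ) (eliminate i cs)
  eliminate-sound ρ i {cs} ss = prune-sound ρ (++⁺ (filterᵇ⁺ _ ss)
    (concatMap⁺ _ (λ f sf → concatMap⁺ _ (λ g sg → pairWith-sound ρ i f g sf sg) ss) ss))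

  absurdLin : Lin → Bool
  absurdLin (+ 0 , + 0 , + 0 , -[1+ _ ]) = true
  absurdLin _ = false

  anyAbsurd : List Lin → Bool
  anyAbsurd [] = false
  anyAbsurd (f ∷ fs) = absurdLin f ∨ anyAbsurd fs

  absurdLin-sound : ∀ ρ f → absurdLin f ≡ true → Sat ρ f → ⊥
  absurdLin-sound (x , y , m) (+ 0 , + 0 , + 0 , -[1+ _ ]) _ ()

  anyAbsurd-sound : ∀ ρ fs → anyAbsurd fs ≡ true → All (Sat ρ) fs → ⊥
  anyAbsurd-sound ρ (f ∷ fs) e (sf ∷ sfs) with absurdLin f in eq
  ... | true  = absurdLin-sound ρ f eq sf
  ... | false = anyAbsurd-sound ρ fs e sfs

  -- Only soundness is proved. A contradiction that the elimination misses could at worst make a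
  -- check evaluate to `false`.
  refute : List Lin → Bool
  refute cs = anyAbsurd (eliminate 2 (eliminate 1 (eliminate 0 cs)))

  refute-sound : ∀ ρ cs → refute cs ≡ true → All (Sat ρ) cs → ⊥
  refute-sound ρ cs e ss = anyAbsurd-sound ρ _ e (eliminate-sound ρ 2 (eliminate-sound ρ 1 (eliminate-sound ρ 0 ss)))

  -- Integer combinations of indicator functions

  _≟L_ : (f g : Lin) → Dec (f ≡ g)
  _≟L_ = ≡-dec _≟_ (≡-dec _≟_ (≡-dec _≟_ _≟_))

  holds : Env → Lin → Bool
  holds ρ f = does (+ 0 ≤? ⟦ f ⟧ ρ)

  ind : Env → List Lin → ℤ
  ind ρ []      = + 1
  ind ρ (f ∷ R) = if holds ρ f then ind ρ R else + 0

  Terms : Set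
  Terms = List (ℤ × List Lin)

  value : Env → Terms → ℤ
  value ρ []             = + 0
  value ρ ((c , R) ∷ ts) = c * ind ρ R + value ρ ts

  complement : Lin → Lin
  complement (a , b , c , d) = (- a , - b , - c , - d - + 1)

  complement-sound : ∀ ρ f → ¬ Sat ρ f → Sat ρ (complement f)
  complement-sound (x , y , m) f@(a , b , c , d) ns =
    subst (+ 0 ≤_) (lemma a b c d x y m) (ℤP.i≤j⇒0≤j-i (ℤP.i<j⇒suc[i]≤j (ℤP.neg-mono-< (ℤP.≰⇒> ns))))
    where
    lemma : ∀ a b c d x y m → - (a * x + b * y + c * m + d) - + 1 ≡ (- a) * x + (- b) * y + (- c) * m + (- d - + 1)
    lemma = solve-∀

  without : Lin → List Lin → List Lin
  without f [] = []
  without f (g ∷ R) with f ≟L g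
  ... | yes _ = without f R
  ... | no _  = g ∷ without f R

  mentions : Lin → List Lin → Bool
  mentions f [] = false
  mentions f (g ∷ R) with f ≟L g
  ... | yes _ = true
  ... | no _  = mentions f R

  without-sound : ∀ ρ f → holds ρ f ≡ true → ∀ R → ind ρ (without f R) ≡ ind ρ R
  without-sound ρ f h [] = refl
  without-sound ρ f h (g ∷ R) with f ≟L g
  ... | yes refl rewrite h = without-sound ρ f h R
  ... | no _ = cong (if holds ρ g then_else + 0) (without-sound ρ f h R)

  mentions-sound : ∀ ρ f → holds ρ f ≡ false → ∀ R → mentions f R ≡ true → ind ρ R ≡ + 0
  mentions-sound ρ f h (g ∷ R) e with f ≟L g
  ... | yes refl rewrite h = refl
  ... | no _ rewrite mentions-sound ρ f h R e with holds ρ g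
  ...   | true  = refl
  ...   | false = refl

  assumeTrue assumeFalse : Lin → Terms → Terms
  assumeTrue f = map (λ { (c , R) → c , without f R })
  assumeFalse f [] = []
  assumeFalse f ((c , R) ∷ ts) = if mentions f R then assumeFalse f ts else (c , R) ∷ assumeFalse f ts

  assumeTrue-sound : ∀ ρ f → holds ρ f ≡ true → ∀ ts → value ρ (assumeTrue f ts) ≡ value ρ ts
  assumeTrue-sound ρ f h [] = refl
  assumeTrue-sound ρ f h ((c , R) ∷ ts) = cong₂ (λ a b → c * a + b) (without-sound ρ f h R) (assumeTrue-sound ρ f h ts)

  assumeFalse-sound : ∀ ρ f → holds ρ f ≡ false → ∀ ts → value ρ (assumeFalse f ts) ≡ value ρ ts
  assumeFalse-sound ρ f h [] = refl
  assumeFalse-sound ρ f h ((c , R) ∷ ts) with mentions f R in e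
  ... | false = cong (λ v → c * ind ρ R + v) (assumeFalse-sound ρ f h ts)
  ... | true rewrite mentions-sound ρ f h R e | ℤP.*-zeroʳ c =
    trans (assumeFalse-sound ρ f h ts) (sym (ℤP.+-identityˡ _))

  nextAtom : Terms → Maybe Lin
  nextAtom [] = nothing
  nextAtom ((c , []) ∷ ts) = nextAtom ts
  nextAtom ((c , f ∷ R) ∷ ts) = just f

  constantSum : Terms → ℤ
  constantSum [] = + 0
  constantSum ((c , R) ∷ ts) = c + constantSum ts

  value-constantSum : ∀ ρ ts → nextAtom ts ≡ nothing → value ρ ts ≡ constantSum ts
  value-constantSum ρ [] e = refl
  value-constantSum ρ ((c , []) ∷ ts) e = cong₂ _+_ (ℤP.*-identityʳ c) (value-constantSum ρ ts e)

  -- A decision tree over the affine forms that occur. Refutation is tried first, so the empty cells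
  -- of the arrangement impose no condition on the coefficients.
  vanishes : ℕ → List Lin → Terms → Bool
  vanishes n cs ts with refute cs
  ... | true = true
  ... | false with nextAtom ts
  vanishes n cs ts | false | nothing = isZero (constantSum ts)
  vanishes zero cs ts | false | just f = false
  vanishes (suc n) cs ts | false | just f =
    vanishes n (insert f cs) (assumeTrue f ts) ∧ vanishes n (insert (complement f) cs) (assumeFalse f ts)

  isZero-sound : ∀ i → isZero i ≡ true → i ≡ + 0
  isZero-sound (+ zero) _ = refl

  ∧-true : ∀ {a b} → a ∧ b ≡ true → a ≡ true × b ≡ true
  ∧-true {true} {true} _ = refl , refl

  vanishes-sound : ∀ ρ n cs ts → vanishes n cs ts ≡ true → All (Sat ρ) cs → value ρ ts ≡ + 0
  vanishes-sound ρ n cs ts e ss with refute cs in r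
  ... | true = ⊥-elim (refute-sound ρ cs r ss)
  ... | false with nextAtom ts in a
  vanishes-sound ρ n cs ts e ss | false | nothing = trans (value-constantSum ρ ts a) (isZero-sound _ e)
  vanishes-sound ρ (suc n) cs ts e ss | false | just f with + 0 ≤? ⟦ f ⟧ ρ in d
  ... | yes p = trans (sym (assumeTrue-sound ρ f (cong does d) ts))
                  (vanishes-sound ρ n (insert f cs) _ (proj₁ (∧-true e)) (insert-sound ρ f p ss))
  ... | no np = trans (sym (assumeFalse-sound ρ f (cong does d) ts))
                  (vanishes-sound ρ n (insert (complement f) cs) _ (proj₂ (∧-true e)) (insert-sound ρ (complement f) (complement-sound ρ f np) ss))

  -- Affine substitutions

  Sub : Set
  Sub = Lin × Lin × Lin

  subEnv : Sub → Env → Env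
  subEnv (X , Y , M) ρ = ⟦ X ⟧ ρ , ⟦ Y ⟧ ρ , ⟦ M ⟧ ρ

  infixl 8 _[_]
  _[_] : Lin → Sub → Lin
  (a , b , c , d) [ (x₁ , x₂ , x₃ , x₄) , (y₁ , y₂ , y₃ , y₄) , (z₁ , z₂ , z₃ , z₄) ] =
    ( a * x₁ + b * y₁ + c * z₁ , a * x₂ + b * y₂ + c * z₂
    , a * x₃ + b * y₃ + c * z₃ , a * x₄ + b * y₄ + c * z₄ + d )

  ⟦[]⟧ : ∀ f σ ρ → ⟦ f [ σ ] ⟧ ρ ≡ ⟦ f ⟧ (subEnv σ ρ)
  ⟦[]⟧ (a , b , c , d) ((x₁ , x₂ , x₃ , x₄) , (y₁ , y₂ , y₃ , y₄) , (z₁ , z₂ , z₃ , z₄)) (x , y , m) =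
    trans (cong (λ t → t + (a * x₄ + b * y₄ + c * z₄ + d)) (regroup a b c x₁ y₁ z₁ x₂ y₂ z₂ x₃ y₃ z₃ x y m))
          (collect a b c d (x₁ * x + x₂ * y + x₃ * m) x₄ (y₁ * x + y₂ * y + y₃ * m) y₄ (z₁ * x + z₂ * y + z₃ * m) z₄)
    where
    regroup : ∀ a b c x₁ y₁ z₁ x₂ y₂ z₂ x₃ y₃ z₃ x y m →
      (a * x₁ + b * y₁ + c * z₁) * x + (a * x₂ + b * y₂ + c * z₂) * y + (a * x₃ + b * y₃ + c * z₃) * m
      ≡ a * (x₁ * x + x₂ * y + x₃ * m) + b * (y₁ * x + y₂ * y + y₃ * m) + c * (z₁ * x + z₂ * y + z₃ * m)
    regroup = solve-∀
    collect : ∀ a b c d u x v y w z → a * u + b * v + c * w + (a * x + b * y + c * z + d) ≡ a * (u + x) + b * (v + y) + c * (w + z) + d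
    collect = solve-∀

  holds-sub : ∀ f σ ρ → holds ρ (f [ σ ]) ≡ holds (subEnv σ ρ) f
  holds-sub f σ ρ = cong (λ v → does (+ 0 ≤? v)) (⟦[]⟧ f σ ρ)

  ind-sub : ∀ R σ ρ → ind ρ (map (_[ σ ]) R) ≡ ind (subEnv σ ρ) R
  ind-sub [] σ ρ = refl
  ind-sub (f ∷ R) σ ρ = cong₂ (λ b v → if b then v else + 0) (holds-sub f σ ρ) (ind-sub R σ ρ)

  subT : Sub → Terms → Terms
  subT σ [] = []
  subT σ ((c , R) ∷ ts) = (c , map (_[ σ ]) R) ∷ subT σ ts

  value-sub : ∀ ts σ ρ → value ρ (subT σ ts) ≡ value (subEnv σ ρ) ts
  value-sub [] σ ρ = refl
  value-sub ((c , R) ∷ ts) σ ρ = cong₂ (λ a b → c * a + b) (ind-sub R σ ρ) (value-sub ts σ ρ)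

  value-++ : ∀ ρ ts us → value ρ (ts ++ us) ≡ value ρ ts + value ρ us
  value-++ ρ [] us = sym (ℤP.+-identityˡ _)
  value-++ ρ ((c , R) ∷ ts) us = trans (cong (λ v → c * ind ρ R + v) (value-++ ρ ts us)) (sym (ℤP.+-assoc (c * ind ρ R) _ _))

  guard : Lin → Terms → Terms
  guard f [] = []
  guard f ((c , R) ∷ ts) = (c , f ∷ R) ∷ guard f ts

  value-guard-true : ∀ ρ f ts → holds ρ f ≡ true → value ρ (guard f ts) ≡ value ρ ts
  value-guard-true ρ f [] h = refl
  value-guard-true ρ f ((c , R) ∷ ts) h rewrite h = cong (λ v → c * ind ρ R + v) (value-guard-true ρ f ts h)

  value-guard-false : ∀ ρ f ts → holds ρ f ≡ false → value ρ (guard f ts) ≡ + 0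
  value-guard-false ρ f [] h = refl
  value-guard-false ρ f ((c , R) ∷ ts) h rewrite h | ℤP.*-zeroʳ c = trans (ℤP.+-identityˡ _) (value-guard-false ρ f ts h)

  minus : Terms → Terms
  minus [] = []
  minus ((c , R) ∷ ts) = (- c , R) ∷ minus ts

  value-minus : ∀ ρ ts → value ρ (minus ts) ≡ - value ρ ts
  value-minus ρ [] = refl
  value-minus ρ ((c , R) ∷ ts) = trans (cong₂ _+_ (sym (ℤP.neg-distribˡ-* c (ind ρ R))) (value-minus ρ ts)) (sym (ℤP.neg-distrib-+ (c * ind ρ R) (value ρ ts)))

  -- The congruence satisfied by group elements

  -- The points with 2x + y ≡ 0 or 1 (mod 3) are those coming from group elements.
  OnOrbit : ℤ → ℤ → Set
  OnOrbit x y = ∃ λ k → (y ≡ + 3 * k - + 2 * x) ⊎ (y ≡ + 3 * k - + 2 * x + + 1)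

  -- The second variable becomes k, whose integrality encodes the congruence on 2x + y; in this form
  -- the rounding after division by 3 can exploit it.
  residue : ℤ → Sub
  residue e = (+ 1 , + 0 , + 0 , + 0) , (- + 2 , + 3 , + 0 , e) , (+ 0 , + 0 , + 1 , + 0)

  check : List Lin → Terms → Bool
  -- 60 bounds the depth of the case distinction; it has to be at least the number of distinct
  -- affine forms in the terms.
  check cs ts with vanishes 60 (map (_[ residue (+ 0) ]) cs) (subT (residue (+ 0)) ts)
  ... | false = false
  ... | true  = vanishes 60 (map (_[ residue (+ 1) ]) cs) (subT (residue (+ 1)) ts)

  form-x : ∀ x y m → + 1 * x + + 0 * y + + 0 * m + + 0 ≡ x
  form-x = solve-∀

  form-y : ∀ x y m → + 0 * x + + 1 * y + + 0 * m + + 0 ≡ y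
  form-y = solve-∀

  form-m : ∀ x y m → + 0 * x + + 0 * y + + 1 * m + + 0 ≡ m
  form-m = solve-∀

  residueEnv : ∀ e x k m → subEnv (residue e) (x , k , m) ≡ (x , + 3 * k - + 2 * x + e , m)
  residueEnv e x k m = cong₂ _,_ (form-x x k m) (cong₂ _,_ (lemma e x k m) (form-m x k m))
    where
    lemma : ∀ e x k m → - + 2 * x + + 3 * k + + 0 * m + e ≡ + 3 * k - + 2 * x + e
    lemma = solve-∀

  sat-sub : ∀ σ ρ {cs} → All (Sat (subEnv σ ρ)) cs → All (Sat ρ) (map (_[ σ ]) cs)
  sat-sub σ ρ [] = []
  sat-sub σ ρ {f ∷ _} (s ∷ ss) = subst (+ 0 ≤_) (sym (⟦[]⟧ f σ ρ)) s ∷ sat-sub σ ρ ss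

  vanishes-residue : ∀ e cs ts x k m → vanishes 60 (map (_[ residue e ]) cs) (subT (residue e) ts) ≡ true →
    All (Sat (x , + 3 * k - + 2 * x + e , m)) cs → value (x , + 3 * k - + 2 * x + e , m) ts ≡ + 0
  vanishes-residue e cs ts x k m h ss =
    trans (cong (λ ρ → value ρ ts) (sym (residueEnv e x k m)))
    (trans (sym (value-sub ts (residue e) (x , k , m)))
    (vanishes-sound (x , k , m) 60 _ _ h (sat-sub (residue e) _ (subst (λ ρ → All (Sat ρ) cs) (sym (residueEnv e x k m)) ss))))

  check-sound : ∀ cs ts → check cs ts ≡ true → ∀ x y m → OnOrbit x y → All (Sat (x , y , m)) cs → value (x , y , m) ts ≡ + 0
  check-sound cs ts h x y m o ss with vanishes 60 (map (_[ residue (+ 0) ]) cs) (subT (residue (+ 0)) ts) in v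
  check-sound cs ts h x y m (k , inj₁ p) ss | true =
    subst (λ y → value (x , y , m) ts ≡ + 0) (sym p')
      (vanishes-residue (+ 0) cs ts x k m v (subst (λ y → All (Sat (x , y , m)) cs) p' ss))
    where p' = trans p (sym (ℤP.+-identityʳ _))
  check-sound cs ts h x y m (k , inj₂ refl) ss | true = vanishes-residue (+ 1) cs ts x k m h ss

  -- Polygons of alcoves and their symmetries

  x≥ y≥ z≥ x≤ y≤ z≤ : ℤ → ℤ → Lin
  x≥ p q = + 1 , + 0 , - p , - q
  y≥ p q = + 0 , + 1 , - p , - q
  z≥ p q = - + 1 , - + 1 , - p , - q
  x≤ p q = - + 1 , + 0 , p , q
  y≤ p q = + 0 , - + 1 , p , q
  z≤ p q = + 1 , + 1 , p , q

  Region : Set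
  Region = List Lin

  -1ℤ -2ℤ : ℤ
  -1ℤ = - + 1
  -2ℤ = - + 2

  -- Let A be the cyclic word i , i+1 , i+2 , … with n letters, and B the word i+1 followed by A with n - 1 letters.
  -- Their Kazhdan–Lusztig polynomials at x are [x ∈ R₀] + q [x ∈ R₁] with the regions below (R₁ empty if omitted), where
  -- n = 2 m (even) or n = 2 m + 1 (odd); oddA needs m ≥ 1, and A with 1 and 0 letters has R₀ = unitA and zeroA.
  evenA₀ evenA₁ oddA₀ oddA₁ oddB₀ evenB₀ evenB₁ unitA zeroA : Region
  evenA₀ = x≥ -1ℤ (+ 1) ∷ y≥ -1ℤ (+ 0) ∷ z≥ -1ℤ (+ 0) ∷ []
  evenA₁ = x≥ -1ℤ (+ 2) ∷ y≥ -1ℤ (+ 1) ∷ z≥ -1ℤ (+ 2) ∷ []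
  oddA₀  = x≥ -1ℤ (+ 0) ∷ y≥ -1ℤ -1ℤ ∷ z≥ -1ℤ (+ 0) ∷ z≤ (+ 2) -1ℤ ∷ []
  oddA₁  = x≥ -1ℤ (+ 2) ∷ y≥ -1ℤ (+ 1) ∷ z≥ -1ℤ (+ 1) ∷ []
  zeroA  = x≥ (+ 0) (+ 0) ∷ y≥ (+ 0) (+ 0) ∷ z≥ (+ 0) (+ 0) ∷ []
  unitA  = x≥ (+ 0) (+ 0) ∷ y≥ (+ 0) -1ℤ ∷ z≥ (+ 0) (+ 0) ∷ []
  oddB₀  = x≥ -1ℤ (+ 1) ∷ y≥ -1ℤ (+ 0) ∷ z≥ -1ℤ -1ℤ ∷ []
  evenB₀ = x≥ -1ℤ (+ 1) ∷ y≥ -1ℤ (+ 0) ∷ z≥ -1ℤ -1ℤ ∷ x≤ (+ 2) -1ℤ ∷ y≤ (+ 2) -2ℤ ∷ z≤ (+ 2) (- + 3) ∷ []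
  evenB₁ = x≥ -1ℤ (+ 3) ∷ y≥ -1ℤ (+ 2) ∷ z≥ -1ℤ (+ 1) ∷ []

  Coeffs : Set
  Coeffs = ℕ → Terms

  _+q_ : Region → Region → Coeffs
  (R₀ +q R₁) 0 = (+ 1 , R₀) ∷ []
  (R₀ +q R₁) 1 = (+ 1 , R₁) ∷ []
  (R₀ +q R₁) _ = []

  [_]₀ : Region → Coeffs
  [ R ]₀ 0 = (+ 1 , R) ∷ []
  [ R ]₀ _ = []

  evenA oddA oneA nilA oddB evenB : Coeffs
  evenA = evenA₀ +q evenA₁
  oddA  = oddA₀ +q oddA₁
  oneA  = [ unitA ]₀
  nilA  = [ zeroA ]₀
  oddB  = [ oddB₀ ]₀
  evenB = evenB₀ +q evenB₁

  raise : Coeffs → Coeffs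
  raise F zero    = []
  raise F (suc k) = F k

  at : Sub → Coeffs → Coeffs
  at σ F k = subT σ (F k)

  -- The generators i, i+1 and i+2 in the coordinates (x, y, z = - x - y) relative to i.
  data Axis : Set where
    axis₀ axis₁ axis₂ : Axis

  reflectS : Axis → Sub
  reflectS axis₀ = (+ 0 , + 1 , + 0 , + 1) , (+ 1 , + 0 , + 0 , -1ℤ) , (+ 0 , + 0 , + 1 , + 0)
  reflectS axis₁ = (+ 1 , + 0 , + 0 , + 0) , (-1ℤ , -1ℤ , + 0 , + 1) , (+ 0 , + 0 , + 1 , + 0)
  reflectS axis₂ = (-1ℤ , -1ℤ , + 0 , -1ℤ) , (+ 0 , + 1 , + 0 , + 0) , (+ 0 , + 0 , + 1 , + 0)

  -- Rotations of the Coxeter diagram act by cyclic shifts of (x, y, z).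
  rotS : Axis → Sub
  rotS axis₀ = (+ 1 , + 0 , + 0 , + 0) , (+ 0 , + 1 , + 0 , + 0) , (+ 0 , + 0 , + 1 , + 0)
  rotS axis₁ = (+ 0 , + 1 , + 0 , + 0) , (-1ℤ , -1ℤ , + 0 , + 0) , (+ 0 , + 0 , + 1 , + 0)
  rotS axis₂ = (-1ℤ , -1ℤ , + 0 , + 0) , (+ 1 , + 0 , + 0 , + 0) , (+ 0 , + 0 , + 1 , + 0)

  mS : ℤ → Sub
  mS j = (+ 1 , + 0 , + 0 , + 0) , (+ 0 , + 1 , + 0 , + 0) , (+ 0 , + 0 , + 1 , j)

  -- A descent means `num < 0`; the non-strict inequality for this is `- num - 1 ≥ 0`, whence the
  -- constants -2.
  descentL : Axis → Lin
  descentL axis₀ = + 1 , -1ℤ , + 0 , -2ℤ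
  descentL axis₁ = + 1 , + 2 , + 0 , -2ℤ
  descentL axis₂ = -2ℤ , -1ℤ , + 0 , -2ℤ

  -- The counterpart of `_⋆_` on lists of terms. The guards put both cases, descent and no descent,
  -- into one list, so that a single check covers the whole plane.
  starT : Axis → Coeffs → Coeffs
  starT i F k = guard (descentL i) (at (reflectS i) F k ++ raise F k)
             ++ guard (complement (descentL i)) (raise (at (reflectS i) F) k ++ F k)

  m≥ : ℤ → Lin
  m≥ j = + 0 , + 0 , + 1 , - j

  setM : ℤ → Sub
  setM j = (+ 1 , + 0 , + 0 , + 0) , (+ 0 , + 1 , + 0 , + 0) , (+ 0 , + 0 , + 0 , j)

  checkAt : ℤ → Terms → Bool
  checkAt j ts = check [] (subT (setM j) ts)

  checkAt-sound : ∀ j ts → checkAt j ts ≡ true → ∀ x y → OnOrbit x y → value (x , y , j) ts ≡ + 0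
  checkAt-sound j ts h x y o = trans (cong (λ ρ → value ρ ts) (sym e)) (trans (sym (value-sub ts (setM j) (x , y , + 0)))
    (check-sound [] (subT (setM j) ts) h x y (+ 0) o []))
    where
    lemma : ∀ x y j → + 0 * x + + 0 * y + + 0 * + 0 + j ≡ j
    lemma = solve-∀
    e : subEnv (setM j) (x , y , + 0) ≡ (x , y , j)
    e = cong₂ _,_ (form-x x y (+ 0)) (cong₂ _,_ (form-y x y (+ 0)) (lemma x y j))

  -- Identities and inclusions settled by evaluation

  infix 5 _⊝_
  _⊝_ : Coeffs → Coeffs → ℕ → Terms
  (F ⊝ G) k = F k ++ minus (G k)

  infixr 6 _⊕T_
  _⊕T_ : Coeffs → Coeffs → Coeffs
  (F ⊕T G) k = F k ++ G k

  -- Each right-hand side is C_{gA} followed by the terms μ(z, A) q^e C_z with 2e = ℓ(A) + 1 - ℓ(z).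
  -- All z are shorter than A by one, except for the q² term of `stepA-even`: there A has 2m letters
  -- and z has 2(m - 2) + 1.
  stepA-nil stepA-one stepA-odd stepA-even stepB-odd stepB-even stepB-two : ℕ → Terms
  stepA-nil  = starT axis₂ nilA ⊝ at (rotS axis₂) oneA
  stepA-one  = starT axis₂ oneA ⊝ at (rotS axis₂) evenA
  stepA-odd  = starT axis₂ oddA ⊝ at (rotS axis₂) (at (mS (+ 1)) evenA) ⊕T raise (at (rotS axis₂) evenB)
  stepA-even = starT axis₂ evenA ⊝ at (rotS axis₂) oddA ⊕T raise (at (rotS axis₂) (at (mS -1ℤ) oddB))
                                                        ⊕T raise (raise (at (rotS axis₂) (at (mS -2ℤ) oddB)))
  stepB-odd  = starT axis₁ oddA ⊝ at (mS (+ 1)) evenB ⊕T raise (at (rotS axis₁) evenA)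
  stepB-even = starT axis₁ evenA ⊝ oddB ⊕T raise (at (rotS axis₁) (at (mS -1ℤ) oddA)) ⊕T raise (at (mS -1ℤ) oddB)
  stepB-two  = starT axis₁ evenA ⊝ oddB ⊕T raise (at (rotS axis₁) oneA)

  check-A-nil : ∀ k → check [] (stepA-nil k) ≡ true
  check-A-nil 0 = refl
  check-A-nil 1 = refl
  check-A-nil (suc (suc _)) = refl

  check-A-one : ∀ k → checkAt (+ 1) (stepA-one k) ≡ true
  check-A-one 0 = refl
  check-A-one 1 = refl
  check-A-one 2 = refl
  check-A-one (suc (suc (suc _))) = refl

  check-A-odd : ∀ k → check (m≥ (+ 1) ∷ []) (stepA-odd k) ≡ true
  check-A-odd 0 = refl
  check-A-odd 1 = refl
  check-A-odd 2 = refl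
  check-A-odd (suc (suc (suc _))) = refl

  check-A-even : ∀ k → check (m≥ (+ 1) ∷ []) (stepA-even k) ≡ true
  check-A-even 0 = refl
  check-A-even 1 = refl
  check-A-even 2 = refl
  check-A-even (suc (suc (suc _))) = refl

  check-B-odd : ∀ k → check (m≥ (+ 1) ∷ []) (stepB-odd k) ≡ true
  check-B-odd 0 = refl
  check-B-odd 1 = refl
  check-B-odd 2 = refl
  check-B-odd (suc (suc (suc _))) = refl

  check-B-even : ∀ k → check (m≥ (+ 2) ∷ []) (stepB-even k) ≡ true
  check-B-even 0 = refl
  check-B-even 1 = refl
  check-B-even 2 = refl
  check-B-even (suc (suc (suc _))) = refl

  check-B-two : ∀ k → checkAt (+ 1) (stepB-two k) ≡ true
  check-B-two 0 = refl
  check-B-two 1 = refl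
  check-B-two 2 = refl
  check-B-two (suc (suc (suc _))) = refl

  -- The corrections of too small an index are 0, so the general step identities remain valid from m
  -- = 1 on and can start the induction.
  check-B-odd-empty : ∀ k → checkAt (+ 0) (oddB k) ≡ true
  check-B-odd-empty 0 = refl
  check-B-odd-empty (suc _) = refl

  check-B-odd-empty' : ∀ k → checkAt -1ℤ (oddB k) ≡ true
  check-B-odd-empty' 0 = refl
  check-B-odd-empty' (suc _) = refl

  check-B-even-empty : ∀ k → checkAt (+ 1) (evenB k) ≡ true
  check-B-even-empty 0 = refl
  check-B-even-empty 1 = refl
  check-B-even-empty (suc (suc _)) = refl

  -- Inclusion–exclusion: the value is 0 exactly when R ⊆ R₁ ∪ R₂.
  cover : Region → Region → Region → Terms
  cover R R₁ R₂ = (+ 1 , R) ∷ (-1ℤ , R ++ R₁) ∷ (-1ℤ , R ++ R₂) ∷ (+ 1 , R ++ (R₁ ++ R₂)) ∷ []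

  subset : Region → Region → Terms
  subset R R₁ = (+ 1 , R) ∷ (-1ℤ , R ++ R₁) ∷ []

  _⟨_⟩ : Region → Sub → Region
  R ⟨ σ ⟩ = map (_[ σ ]) R

  -- The frame is that of i + 1, the first letter of the tail of A. In it A itself is seen through
  -- `rotS axis₂`, and multiplication by the letter i is the reflection in `axis₂`.
  coverOne coverTwo coverEven coverOdd : Terms
  coverOne  = cover (unitA ⟨ rotS axis₂ ⟩) zeroA (zeroA ⟨ reflectS axis₂ ⟩)
  coverTwo  = cover (evenA₀ ⟨ rotS axis₂ ⟩) unitA (unitA ⟨ reflectS axis₂ ⟩)
  coverEven = cover (evenA₀ ⟨ mS (+ 1) ⟩ ⟨ rotS axis₂ ⟩) oddA₀ (oddA₀ ⟨ reflectS axis₂ ⟩)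
  coverOdd  = cover (oddA₀ ⟨ rotS axis₂ ⟩) evenA₀ (evenA₀ ⟨ reflectS axis₂ ⟩)

  check-cover-one : check [] coverOne ≡ true
  check-cover-one = refl

  check-cover-two : checkAt (+ 1) coverTwo ≡ true
  check-cover-two = refl

  check-cover-even : check (m≥ (+ 1) ∷ []) coverEven ≡ true
  check-cover-even = refl

  check-cover-odd : check (m≥ (+ 1) ∷ []) coverOdd ≡ true
  check-cover-odd = refl

  check-cover-B : check (m≥ (+ 1) ∷ []) (cover oddB₀ evenA₀ (evenA₀ ⟨ reflectS axis₁ ⟩)) ≡ true
  check-cover-B = refl

  check-top-one : check [] (subset zeroA (unitA ⟨ rotS axis₂ ⟩ ⟨ reflectS axis₂ ⟩)) ≡ true
  check-top-one = refl

  check-top-two : checkAt (+ 1) (subset unitA (evenA₀ ⟨ rotS axis₂ ⟩ ⟨ reflectS axis₂ ⟩)) ≡ true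
  check-top-two = refl

  check-top-even : check (m≥ (+ 1) ∷ []) (subset oddA₀ (evenA₀ ⟨ mS (+ 1) ⟩ ⟨ rotS axis₂ ⟩ ⟨ reflectS axis₂ ⟩)) ≡ true
  check-top-even = refl

  check-top-odd : check (m≥ (+ 1) ∷ []) (subset evenA₀ (oddA₀ ⟨ rotS axis₂ ⟩ ⟨ reflectS axis₂ ⟩)) ≡ true
  check-top-odd = refl

  -- For A with 2m letters, both covering words have 2(m - 2) + 1 letters, three fewer: one is
  -- cyclic with the same start, the other is a word B in the frame of i + 2.
  check-edge-even : check (m≥ (+ 3) ∷ []) (cover evenA₁ (oddA₀ ⟨ mS -2ℤ ⟩) (oddB₀ ⟨ mS -2ℤ ⟩ ⟨ rotS axis₂ ⟩)) ≡ true
  check-edge-even = refl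

  check-edge-four : checkAt (+ 2) (subset evenA₁ (unitA ⟨ mS -1ℤ ⟩)) ≡ true
  check-edge-four = refl

  check-edge-two : checkAt (+ 1) ((+ 1 , evenA₁) ∷ []) ≡ true
  check-edge-two = refl

  check-edge-odd : check (m≥ (+ 2) ∷ []) (subset oddA₁ (evenA₀ ⟨ mS -1ℤ ⟩)) ≡ true
  check-edge-odd = refl

  check-edge-three : checkAt (+ 1) ((+ 1 , oddA₁) ∷ []) ≡ true
  check-edge-three = refl

open Regions
open import Data.Bool using (Bool; true; false; if_then_else_; not)
open import Data.Bool.ListAction using (any)
open import Data.Bool.Properties using (not-involutive)
open import Data.Empty using (⊥; ⊥-elim)
open import Data.Unit using (⊤; tt)
open import Data.Fin as Fin using (zero; suc)
open import Data.Fin.Properties using (all?)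
open import Data.Nat as ℕ using (ℕ; zero; suc; pred; _≤_; _<_; z≤n; s≤s; _∸_; _/_; _%_; _<ᵇ_)
import Data.Nat.Properties as ℕP
import Data.Nat.DivMod as DM
open import Data.Nat.Tactic.RingSolver using () renaming (solve-∀ to solveℕ-∀)
open import Data.Integer as ℤ using (ℤ; -[1+_]; -_; _+_; _*_; _-_; ∣_∣; +≤+)
import Data.Integer.Properties as ℤP
open import Data.Integer.Tactic.RingSolver using (solve-∀)
open import Data.List using (List; []; _∷_; _++_; map; foldr; foldl; length; reverse; filterᵇ; concatMap)
import Data.List.Properties as ListP
open import Data.List.Membership.Propositional using (_∈_)
open import Data.List.Membership.Propositional.Properties using (∈-map⁺; ∈-map⁻; ∈-concatMap⁺; ∈-concatMap⁻; ∈-++⁺ˡ; ∈-++⁺ʳ; ∈-++⁻)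
open import Data.List.Relation.Unary.Any using (Any; here; there)
open import Data.List.Relation.Unary.All as All using (All; []; _∷_)
open import Data.List.Relation.Unary.All.Properties using (++⁺)
open import Data.List.Relation.Unary.AllPairs using (AllPairs; []; _∷_)
open import Data.Product using (_,_; proj₁; proj₂; ∃)
open import Data.Product.Properties using (≡-dec)
open import Data.Sum as Sum using (_⊎_; inj₁; inj₂)
open import Function using (_∘_)
open import Relation.Binary.PropositionalEquality using (refl; sym; trans; cong; cong₂; subst; subst₂; module ≡-Reasoning)
open import Relation.Nullary using (¬_; does; yes; no; Dec)
open import Relation.Nullary.Decidable using (dec-true; _⊎-dec_; ¬?; from-yes)

-- The group as orbit of windows

-- The window of the inverse of x: left multiplication by g becomes act, and g is a left descent when num g is negative.
iv : Word → Win
iv = foldr (λ g p → act p g) idW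

-- The values of the affine simple roots; their sum 3 is the value of the null root.
num : Gen → Win → ℤ
num zero             (a , b , c) = a + + 3 - c
num (suc zero)       (a , b , c) = b - a
num (suc (suc zero)) (a , b , c) = c - b

num-act-self : ∀ g p → num g (act p g) ≡ - num g p
num-act-self zero (a , b , c) = lemma a c
  where
  lemma : ∀ a c → c - + 3 + + 3 - (a + + 3) ≡ - (a + + 3 - c)
  lemma = solve-∀
num-act-self (suc zero) (a , b , c) = lemma a b
  where
  lemma : ∀ a b → a - b ≡ - (b - a)
  lemma = solve-∀
num-act-self (suc (suc zero)) (a , b , c) = lemma b c
  where
  lemma : ∀ a b → a - b ≡ - (b - a)
  lemma = solve-∀

num-act-other : ∀ g h p → ¬ g ≡ h → num h (act p g) ≡ num h p + num g p
num-act-other zero             zero             p ne = ⊥-elim (ne refl)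
num-act-other (suc zero)       (suc zero)       p ne = ⊥-elim (ne refl)
num-act-other (suc (suc zero)) (suc (suc zero)) p ne = ⊥-elim (ne refl)
num-act-other zero (suc zero) (a , b , c) ne = lemma a b c
  where
  lemma : ∀ a b c → b - (c - + 3) ≡ (b - a) + (a + + 3 - c)
  lemma = solve-∀
num-act-other zero (suc (suc zero)) (a , b , c) ne = lemma a b c
  where
  lemma : ∀ a b c → a + + 3 - b ≡ (c - b) + (a + + 3 - c)
  lemma = solve-∀
num-act-other (suc zero) zero (a , b , c) ne = lemma a b c
  where
  lemma : ∀ a b c → b + + 3 - c ≡ (a + + 3 - c) + (b - a)
  lemma = solve-∀
num-act-other (suc zero) (suc (suc zero)) (a , b , c) ne = lemma a b c
  where
  lemma : ∀ a b c → c - a ≡ (c - b) + (b - a)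
  lemma = solve-∀
num-act-other (suc (suc zero)) zero (a , b , c) ne = lemma a b c
  where
  lemma : ∀ a b c → a + + 3 - b ≡ (a + + 3 - c) + (c - b)
  lemma = solve-∀
num-act-other (suc (suc zero)) (suc zero) (a , b , c) ne = lemma a b c
  where
  lemma : ∀ a b c → c - a ≡ (b - a) + (c - b)
  lemma = solve-∀

num-total : ∀ p → num r p + num s p + num t p ≡ + 3
num-total (a , b , c) = lemma a b c
  where
  lemma : ∀ a b c → a + + 3 - c + (b - a) + (c - b) ≡ + 3
  lemma = solve-∀

-3+3 : ∀ a → a - + 3 + + 3 ≡ a
-3+3 = solve-∀

+3-3 : ∀ a → a + + 3 - + 3 ≡ a
+3-3 = solve-∀

act-involutive : ∀ p g → act (act p g) g ≡ p
act-involutive (a , b , c) zero = cong₂ (λ x y → x , b , y) (+3-3 a) (-3+3 c)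
act-involutive p (suc zero) = refl
act-involutive p (suc (suc zero)) = refl

act-braid : ∀ p g h → ¬ g ≡ h → act (act (act p g) h) g ≡ act (act (act p h) g) h
act-braid p zero zero ne = refl
act-braid (a , b , c) zero (suc zero) ne = cong₂ (λ x y → x , y , b + + 3) (+3-3 a) refl
act-braid (a , b , c) zero (suc (suc zero)) ne = cong₂ (λ x y → b - + 3 , x , y) refl (-3+3 c)
act-braid (a , b , c) (suc zero) zero ne = cong₂ (λ x y → x , y , b + + 3) (sym (+3-3 a)) refl
act-braid p (suc zero) (suc zero) ne = refl
act-braid p (suc zero) (suc (suc zero)) ne = refl
act-braid (a , b , c) (suc (suc zero)) zero ne = cong₂ (λ x y → b - + 3 , x , y) refl (sym (-3+3 c))
act-braid p (suc (suc zero)) (suc zero) ne = refl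
act-braid p (suc (suc zero)) (suc (suc zero)) ne = refl

div3 : ℕ → ℕ
div3 (suc (suc (suc n))) = suc (div3 n)
div3 _ = 0

NonMultiple : ℕ → Set
NonMultiple 0 = ⊥
NonMultiple 1 = ⊤
NonMultiple 2 = ⊤
NonMultiple (suc (suc (suc n))) = NonMultiple n

div3-suc : ∀ n → NonMultiple (suc n) → div3 n ≡ div3 (suc n)
div3-suc 0 _ = refl
div3-suc 1 _ = refl
div3-suc (suc (suc (suc n))) p = cong suc (div3-suc n p)

-- ∣⌊ d / 3 ⌋∣
height : ℤ → ℕ
height (+ n)    = div3 n
height -[1+ n ] = suc (div3 n)

nonMultiple-3- : ∀ d → NonMultiple ∣ d ∣ → NonMultiple ∣ + 3 - d ∣
nonMultiple-3- (+ 1) _ = tt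
nonMultiple-3- (+ 2) _ = tt
nonMultiple-3- (+ suc (suc (suc zero))) ()
nonMultiple-3- (+ suc (suc (suc (suc n)))) p = p
nonMultiple-3- -[1+ n ] p = p

-- If 3 does not divide d, then ⌊(3 - d)/3⌋ = -⌊d/3⌋. Hence a generator merely exchanges the heights
-- of the other two simple roots.
height-3- : ∀ d → NonMultiple ∣ d ∣ → height (+ 3 - d) ≡ height d
height-3- (+ 1) _ = refl
height-3- (+ 2) _ = refl
height-3- (+ suc (suc (suc zero))) ()
height-3- (+ suc (suc (suc (suc n)))) p = cong suc (div3-suc n p)
height-3- -[1+ n ] p = cong suc (sym (div3-suc n p))

isNeg : ℤ → Bool
isNeg (+ _)    = false
isNeg -[1+ _ ] = true

height-neg-pos : ∀ d → NonMultiple ∣ d ∣ → isNeg d ≡ false → height (- d) ≡ suc (height d)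
height-neg-pos (+ suc n) p _ = cong suc (div3-suc n p)

desc : Gen → Win → Bool
desc g p = isNeg (num g p)

-- The inversion count of an affine permutation: each of the three pairs of entries contributes the
-- number of parallel hyperplanes that separate the alcove from the fundamental one.
ℓ : Win → ℕ
ℓ p = height (num r p) ℕ.+ height (num s p) ℕ.+ height (num t p)

total : Win → ℤ
total (a , b , c) = a + b + c

-- This describes the orbit of the identity window: `nonMult` says that the entries are pairwise
-- incongruent modulo 3.
record Valid (p : Win) : Set where
  constructor valid
  field
    total≡6 : total p ≡ + 6
    nonMult : ∀ g → NonMultiple ∣ num g p ∣
open Valid

num-swap : ∀ p → (num s (act p r) ≡ + 3 - num t p × num t (act p r) ≡ + 3 - num s p)
              × (num r (act p s) ≡ + 3 - num t p × num t (act p s) ≡ + 3 - num r p)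
              × (num r (act p t) ≡ + 3 - num s p × num s (act p t) ≡ + 3 - num r p)
num-swap (a , b , c) = (l₁ b c , l₂ a b) , (l₃ b c , l₄ a c) , (l₅ a b , l₄ a c)
  where
  l₁ : ∀ b c → b - (c - + 3) ≡ + 3 - (c - b)
  l₁ = solve-∀
  l₂ : ∀ a b → a + + 3 - b ≡ + 3 - (b - a)
  l₂ = solve-∀
  l₃ : ∀ b c → b + + 3 - c ≡ + 3 - (c - b)
  l₃ = solve-∀
  l₄ : ∀ a c → c - a ≡ + 3 - (a + + 3 - c)
  l₄ = solve-∀
  l₅ : ∀ a b → a + + 3 - b ≡ + 3 - (b - a)
  l₅ = solve-∀

nonMult-neg : ∀ d → NonMultiple ∣ d ∣ → NonMultiple ∣ - d ∣
nonMult-neg d = subst NonMultiple (sym (ℤP.∣-i∣≡∣i∣ d))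

valid-act : ∀ {p} g → Valid p → Valid (act p g)
valid-act {p@(a , b , c)} g (valid tot nm) = valid (trans (total-act g) tot) (nm' g)
  where
  total-act : ∀ g → total (act p g) ≡ total p
  total-act zero = lemma a b c
    where
    lemma : ∀ a b c → c - + 3 + b + (a + + 3) ≡ a + b + c
    lemma = solve-∀
  total-act (suc zero) = lemma a b c
    where
    lemma : ∀ a b c → b + a + c ≡ a + b + c
    lemma = solve-∀
  total-act (suc (suc zero)) = lemma a b c
    where
    lemma : ∀ a b c → a + c + b ≡ a + b + c
    lemma = solve-∀
  by : ∀ {d} e → d ≡ + 3 - e → NonMultiple ∣ e ∣ → NonMultiple ∣ d ∣
  by e refl n = nonMultiple-3- e n
  self : ∀ g → NonMultiple ∣ num g (act p g) ∣
  self g = subst (λ d → NonMultiple ∣ d ∣) (sym (num-act-self g p)) (nonMult-neg (num g p) (nm g))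
  nm' : ∀ g h → NonMultiple ∣ num h (act p g) ∣
  nm' zero zero = self r
  nm' zero (suc zero) = by (num t p) (proj₁ (proj₁ (num-swap p))) (nm t)
  nm' zero (suc (suc zero)) = by (num s p) (proj₂ (proj₁ (num-swap p))) (nm s)
  nm' (suc zero) zero = by (num t p) (proj₁ (proj₁ (proj₂ (num-swap p)))) (nm t)
  nm' (suc zero) (suc zero) = self s
  nm' (suc zero) (suc (suc zero)) = by (num r p) (proj₂ (proj₁ (proj₂ (num-swap p)))) (nm r)
  nm' (suc (suc zero)) zero = by (num s p) (proj₁ (proj₂ (proj₂ (num-swap p)))) (nm s)
  nm' (suc (suc zero)) (suc zero) = by (num r p) (proj₂ (proj₂ (proj₂ (num-swap p)))) (nm r)
  nm' (suc (suc zero)) (suc (suc zero)) = self t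

ℓ-asc : ∀ {p} g → Valid p → desc g p ≡ false → ℓ (act p g) ≡ suc (ℓ p)
ℓ-asc {p} g (valid _ nm) d = go g d
  where
  self : ∀ g → desc g p ≡ false → height (num g (act p g)) ≡ suc (height (num g p))
  self g d = trans (cong height (num-act-self g p)) (height-neg-pos (num g p) (nm g) d)
  by : ∀ {d} e → d ≡ + 3 - e → NonMultiple ∣ e ∣ → height d ≡ height e
  by e refl n = height-3- e n
  go : ∀ g → desc g p ≡ false → ℓ (act p g) ≡ suc (ℓ p)
  go zero d rewrite self r d | by (num t p) (proj₁ (proj₁ (num-swap p))) (nm t) | by (num s p) (proj₂ (proj₁ (num-swap p))) (nm s) =
    lemma (height (num r p)) (height (num s p)) (height (num t p))
    where
    lemma : ∀ a b c → suc a ℕ.+ c ℕ.+ b ≡ suc (a ℕ.+ b ℕ.+ c)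
    lemma = solveℕ-∀
  go (suc zero) d rewrite self s d | by (num t p) (proj₁ (proj₁ (proj₂ (num-swap p)))) (nm t) | by (num r p) (proj₂ (proj₁ (proj₂ (num-swap p)))) (nm r) =
    lemma (height (num r p)) (height (num s p)) (height (num t p))
    where
    lemma : ∀ a b c → c ℕ.+ suc b ℕ.+ a ≡ suc (a ℕ.+ b ℕ.+ c)
    lemma = solveℕ-∀
  go (suc (suc zero)) d rewrite self t d | by (num s p) (proj₁ (proj₂ (proj₂ (num-swap p)))) (nm s) | by (num r p) (proj₂ (proj₂ (proj₂ (num-swap p)))) (nm r) =
    lemma (height (num r p)) (height (num s p)) (height (num t p))
    where
    lemma : ∀ a b c → b ℕ.+ a ℕ.+ suc c ≡ suc (a ℕ.+ b ℕ.+ c)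
    lemma = solveℕ-∀

isNeg-neg : ∀ d → NonMultiple ∣ d ∣ → isNeg (- d) ≡ not (isNeg d)
isNeg-neg (+ suc n) _ = refl
isNeg-neg -[1+ n ] _ = refl

desc-act : ∀ {p} g → Valid p → desc g (act p g) ≡ not (desc g p)
desc-act {p} g v = trans (cong isNeg (num-act-self g p)) (isNeg-neg (num g p) (nonMult v g))

ℓ-desc : ∀ {p} g → Valid p → desc g p ≡ true → ℓ p ≡ suc (ℓ (act p g))
ℓ-desc {p} g v d = trans (cong ℓ (sym (act-involutive p g)))
  (ℓ-asc g (valid-act g v) (trans (desc-act g v) (cong not d)))

valid-id : Valid idW
valid-id = valid refl λ { zero → tt ; (suc zero) → tt ; (suc (suc zero)) → tt }

valid-iv : ∀ x → Valid (iv x)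
valid-iv [] = valid-id
valid-iv (g ∷ x) = valid-act g (valid-iv x)

-- Three positive integers with sum 3 are all 1, and 1 has height 0.
no-descent : ∀ {p} → Valid p → desc r p ≡ false → desc s p ≡ false → desc t p ≡ false → ℓ p ≡ 0
no-descent {p} v dr ds dt = go (num r p) (num s p) (num t p) (num-total p) dr ds dt (nonMult v r) (nonMult v s) (nonMult v t)
  where
  go : ∀ x y z → x + y + z ≡ + 3 → isNeg x ≡ false → isNeg y ≡ false → isNeg z ≡ false →
    NonMultiple ∣ x ∣ → NonMultiple ∣ y ∣ → NonMultiple ∣ z ∣ → height x ℕ.+ height y ℕ.+ height z ≡ 0
  go (+ 1) (+ 1) (+ 1) e _ _ _ _ _ _ = refl
  go (+ 2) (+ y) (+ z) e _ _ _ _ q q' with ℤP.+-injective e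
  go (+ 2) (+ suc zero) (+ suc z) e _ _ _ _ q q' | ()
  go (+ 2) (+ suc (suc y)) (+ suc z) e _ _ _ _ q q' | ()
  go (+ suc (suc (suc (suc x)))) (+ suc y) (+ z) () _ _ _ _ q q'
  go (+ 1) (+ suc (suc zero)) (+ suc z) () _ _ _ _ q q'
  go (+ 1) (+ suc (suc (suc y))) (+ suc z) () _ _ _ _ q q'
  go (+ 1) (+ 1) (+ suc (suc z)) () _ _ _ _ q q'

-- Braid moves, normal forms and the word problem

infix 4 _≃_ _⇒_
data _≃_ : Word → Word → Set where
  ≃-refl  : ∀ {x} → x ≃ x
  ≃-trans : ∀ {x y z} → x ≃ y → y ≃ z → x ≃ z
  braid   : ∀ {g h x} → ¬ g ≡ h → g ∷ h ∷ g ∷ x ≃ h ∷ g ∷ h ∷ x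
  ≃-cons  : ∀ {g x y} → x ≃ y → g ∷ x ≃ g ∷ y

≃-sym : ∀ {x y} → x ≃ y → y ≃ x
≃-sym ≃-refl = ≃-refl
≃-sym (≃-trans p q) = ≃-trans (≃-sym q) (≃-sym p)
≃-sym (braid ne) = braid (ne ∘ sym)
≃-sym (≃-cons p) = ≃-cons (≃-sym p)

-- Deletions but no insertions, as in Tits's solution of the word problem; this makes the passage to
-- the normal form monotone for the Bruhat order in `InD-⇒`.
data _⇒_ : Word → Word → Set where
  move    : ∀ {x y} → x ≃ y → x ⇒ y
  ⇒-trans : ∀ {x y z} → x ⇒ y → y ⇒ z → x ⇒ z
  delete  : ∀ {g x} → g ∷ g ∷ x ⇒ x
  ⇒-cons  : ∀ {g x y} → x ⇒ y → g ∷ x ⇒ g ∷ y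

nfF : ℕ → Win → Word
nfF zero    p = []
nfF (suc n) p = if desc r p then r ∷ nfF n (act p r)
           else if desc s p then s ∷ nfF n (act p s)
                            else t ∷ nfF n (act p t)

nf : Win → Word
nf p = nfF (ℓ p) p

nfF-head : ∀ n {p} → Valid p → ℓ p ≡ suc n → ∃ λ h → desc h p ≡ true × nfF (suc n) p ≡ h ∷ nfF n (act p h)
nfF-head n {p} v e with desc r p in dr
... | true = r , dr , refl
... | false with desc s p in ds
...   | true = s , ds , refl
...   | false with desc t p in dt
...     | true = t , dt , refl
...     | false with () ← trans (sym e) (no-descent v dr ds dt)

isNeg-+ : ∀ a b → isNeg a ≡ true → isNeg b ≡ true → isNeg (a + b) ≡ true
isNeg-+ -[1+ _ ] -[1+ _ ] _ _ = refl

desc-after : ∀ {p} g h → ¬ g ≡ h → desc g p ≡ true → desc h p ≡ true → desc h (act p g) ≡ true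
desc-after {p} g h ne dg dh = trans (cong isNeg (num-act-other g h p ne)) (isNeg-+ _ _ dh dg)

desc-after₂ : ∀ {p} g h → ¬ g ≡ h → desc g p ≡ true → desc h p ≡ true → desc g (act (act p g) h) ≡ true
desc-after₂ {p} g h ne dg dh = trans (cong isNeg eq) dh
  where
  lemma : ∀ a b → - a + (b + a) ≡ b
  lemma = solve-∀
  eq : num g (act (act p g) h) ≡ num h p
  eq = trans (num-act-other h g (act p g) (ne ∘ sym))
      (trans (cong₂ _+_ (num-act-self g p) (num-act-other g h p ne)) (lemma (num g p) (num h p)))

Exchange : ℕ → Set
Exchange n = ∀ {p} g → Valid p → ℓ p ≡ suc n → desc g p ≡ true → nfF (suc n) p ≃ g ∷ nfF n (act p g)

-- Let h be the first letter of the normal form. If h differs from g, both are descents, so the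
-- element begins with ghg = hgh: three letters can be stripped on either side and the remainders
-- agree, up to one braid.
exchange-step : ∀ n → Exchange (suc n) → Exchange n → Exchange (suc (suc n))
exchange-step n ex₁ ex₀ {p} g v e d = go (nfF-head (suc (suc n)) v e)
  where
  e₁ : ∀ h → desc h p ≡ true → ℓ (act p h) ≡ suc (suc n)
  e₁ h dh = ℕP.suc-injective (trans (sym (ℓ-desc h v dh)) e)
  IH₂ : ∀ h g → ¬ h ≡ g → desc h p ≡ true → desc g p ≡ true →
    nfF (suc (suc n)) (act p h) ≃ g ∷ nfF (suc n) (act (act p h) g)
  IH₂ h g ne dh dg = ex₁ g (valid-act h v) (e₁ h dh) (desc-after h g ne dh dg)
  IH₁ : ∀ h g → ¬ h ≡ g → desc h p ≡ true → desc g p ≡ true →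
    nfF (suc n) (act (act p h) g) ≃ h ∷ nfF n (act (act (act p h) g) h)
  IH₁ h g ne dh dg = ex₀ h (valid-act g (valid-act h v))
    (ℕP.suc-injective (trans (sym (ℓ-desc g (valid-act h v) (desc-after h g ne dh dg))) (e₁ h dh)))
    (desc-after₂ h g ne dh dg)
  go : (∃ λ h → desc h p ≡ true × nfF (suc (suc (suc n))) p ≡ h ∷ nfF (suc (suc n)) (act p h)) →
    nfF (suc (suc (suc n))) p ≃ g ∷ nfF (suc (suc n)) (act p g)
  go (h , dh , eq) with g Fin.≟ h
  ... | yes refl = subst (λ w → nfF (suc (suc (suc n))) p ≃ w) eq ≃-refl
  ... | no ne =
    subst (_≃ g ∷ nfF (suc (suc n)) (act p g)) (sym eq)
      (≃-trans (≃-cons (≃-trans (IH₂ h g (ne ∘ sym) dh d) (≃-cons (IH₁ h g (ne ∘ sym) dh d))))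
      (≃-trans (braid (ne ∘ sym))
      (≃-trans (subst (λ q → g ∷ h ∷ g ∷ nfF n (act (act (act p h) g) h) ≃ g ∷ h ∷ g ∷ nfF n q) (act-braid p h g (ne ∘ sym)) ≃-refl)
      (≃-cons (≃-sym (≃-trans (IH₂ g h ne d dh) (≃-cons (IH₁ g h ne d dh))))))))

-- Two different descents force length at least 3, so in lengths 1 and 2 the first letter must be g
-- itself.
exchange : ∀ n → Exchange n
exchange zero {p} g v e d with nfF-head zero v e
... | h , dh , eq with g Fin.≟ h
...   | yes refl = subst (λ w → nfF 1 p ≃ w) eq ≃-refl
...   | no ne
  with () ← trans (sym (ℕP.suc-injective (trans (sym (ℓ-desc h v dh)) e))) (ℓ-desc g (valid-act h v) (desc-after h g (ne ∘ sym) dh d))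
exchange (suc zero) {p} g v e d with nfF-head 1 v e
... | h , dh , eq with g Fin.≟ h
...   | yes refl = subst (λ w → nfF 2 p ≃ w) eq ≃-refl
...   | no ne
  with () ← trans (sym (ℕP.suc-injective (trans (sym (ℓ-desc g (valid-act h v) (desc-after h g (ne ∘ sym) dh d))) (ℕP.suc-injective (trans (sym (ℓ-desc h v dh)) e)))))
    (ℓ-desc h (valid-act g (valid-act h v)) (desc-after₂ h g (ne ∘ sym) dh d))
exchange (suc (suc n)) g v e d = exchange-step n (exchange (suc n)) (exchange n) g v e d

⇒-nf : ∀ x → x ⇒ nf (iv x)
⇒-nf [] = move ≃-refl
⇒-nf (g ∷ x) with desc g (iv x) in d
... | true = ⇒-trans (⇒-cons (⇒-trans (⇒-nf x) (move (subst (λ n → nfF n (iv x) ≃ g ∷ nf (act (iv x) g)) (sym e) (exchange (ℓ (act (iv x) g)) g (valid-iv x) e d))))) delete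
  where e = ℓ-desc g (valid-iv x) d
... | false = ⇒-trans (⇒-cons (⇒-nf x)) (move (≃-sym (subst₂ (λ n q → nfF n (act (iv x) g) ≃ g ∷ nfF (ℓ (iv x)) q) (sym e) (act-involutive (iv x) g)
      (exchange (ℓ (iv x)) g (valid-act g (valid-iv x)) e (trans (desc-act g (valid-iv x)) (cong not d))))))
  where e = ℓ-asc g (valid-iv x) d

foldl-≃ : ∀ {x y} p → x ≃ y → foldl act p x ≡ foldl act p y
foldl-≃ p ≃-refl = refl
foldl-≃ p (≃-trans e f) = trans (foldl-≃ p e) (foldl-≃ p f)
foldl-≃ p (braid {g} {h} {x} ne) = cong (λ q → foldl act q x) (act-braid p g h ne)
foldl-≃ p (≃-cons {g} e) = foldl-≃ (act p g) e

foldl-⇒ : ∀ {x y} p → x ⇒ y → foldl act p x ≡ foldl act p y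
foldl-⇒ p (move e) = foldl-≃ p e
foldl-⇒ p (⇒-trans e f) = trans (foldl-⇒ p e) (foldl-⇒ p f)
foldl-⇒ p (delete {g} {x}) = cong (λ q → foldl act q x) (act-involutive p g)
foldl-⇒ p (⇒-cons {g} e) = foldl-⇒ (act p g) e

-- The two windows belong to inverse permutations. No formula for the inverse is needed: equal `iv`
-- gives the same normal form, and rewriting preserves `eval`.
iv≡⇒eval≡ : ∀ {x y} → iv x ≡ iv y → eval x ≡ eval y
iv≡⇒eval≡ {x} {y} e = trans (foldl-⇒ idW (⇒-nf x)) (trans (cong (eval ∘ nf) e) (sym (foldl-⇒ idW (⇒-nf y))))

eval-reverse : ∀ x → eval (reverse x) ≡ iv x
eval-reverse x = ListP.reverse-foldl act idW x

iv-reverse : ∀ x → iv (reverse x) ≡ eval x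
iv-reverse x = trans (sym (eval-reverse (reverse x))) (cong eval (ListP.reverse-involutive x))

eval≡⇒iv≡ : ∀ {x y} → eval x ≡ eval y → iv x ≡ iv y
eval≡⇒iv≡ {x} {y} e = trans (sym (eval-reverse x)) (trans
  (iv≡⇒eval≡ {reverse x} {reverse y} (trans (iv-reverse x) (trans e (sym (iv-reverse y))))) (eval-reverse y))

length-nfF : ∀ n {p} → length (nfF n p) ≡ n
length-nfF zero = refl
length-nfF (suc n) {p} with desc r p
... | true = cong suc (length-nfF n)
... | false with desc s p
...   | true = cong suc (length-nfF n)
...   | false = cong suc (length-nfF n)

ℓ≤ : ∀ g {p} → Valid p → ℓ (act p g) ≤ suc (ℓ p)
ℓ≤ g {p} v with desc g p in d
... | true = ℕP.≤-trans (ℕP.n≤1+n _) (ℕP.≤-trans (ℕP.≤-reflexive (sym (ℓ-desc g v d))) (ℕP.n≤1+n _))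
... | false = ℕP.≤-reflexive (ℓ-asc g v d)

ℓ≤length : ∀ x → ℓ (iv x) ≤ length x
ℓ≤length [] = z≤n
ℓ≤length (g ∷ x) = ℕP.≤-trans (ℓ≤ g (valid-iv x)) (s≤s (ℓ≤length x))

-- Length, reduced words and the Bruhat order

_∼_ : Word → Word → Set
x ∼ y = iv x ≡ iv y

sameB-complete : ∀ {x y} → x ∼ y → sameB x y ≡ true
sameB-complete {x} {y} e = dec-true (≡-dec ℤ._≟_ (≡-dec ℤ._≟_ ℤ._≟_) (eval x) (eval y)) (iv≡⇒eval≡ {x} {y} e)

sameB-sound : ∀ {x y} → sameB x y ≡ true → x ∼ y
sameB-sound {x} {y} e with ≡-dec ℤ._≟_ (≡-dec ℤ._≟_ ℤ._≟_) (eval x) (eval y)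
... | yes p = eval≡⇒iv≡ {x} {y} p

_∼?_ : ∀ x y → Dec (x ∼ y)
x ∼? y = ≡-dec ℤ._≟_ (≡-dec ℤ._≟_ ℤ._≟_) (iv x) (iv y)

sameB-false : ∀ {x y} → ¬ x ∼ y → sameB x y ≡ false
sameB-false {x} {y} ne with sameB x y in e
... | true  = ⊥-elim (ne (sameB-sound {x} {y} e))
... | false = refl

sameB-congʳ : ∀ b {x y} → x ∼ y → sameB b x ≡ sameB b y
sameB-congʳ b {x} {y} e = cong (eqWin (eval b)) (iv≡⇒eval≡ {x} {y} e)

sameB-congˡ : ∀ {x y} b → x ∼ y → sameB x b ≡ sameB y b
sameB-congˡ {x} {y} b e = cong (λ w → eqWin w (eval b)) (iv≡⇒eval≡ {x} {y} e)

ℓw : Word → ℕ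
ℓw x = ℓ (iv x)

any-∈ : ∀ {A : Set} (p : A → Bool) {x xs} → x ∈ xs → p x ≡ true → any p xs ≡ true
any-∈ p (here refl) e rewrite e = refl
any-∈ p {xs = y ∷ _} (there i) e with p y
... | true  = refl
... | false = any-∈ p i e

any-witness : ∀ {A : Set} (p : A → Bool) xs → any p xs ≡ true → ∃ λ x → x ∈ xs × p x ≡ true
any-witness p (x ∷ xs) e with p x in px
... | true = x , here refl , px
... | false with any-witness p xs e
...   | y , i , py = y , there i , py

words-complete : ∀ b → b ∈ words (length b)
words-complete [] = here refl
words-complete (g ∷ b) = ∈-concatMap⁺ (λ g → map (g ∷_) (words (length b))) (go g)
  where
  m : ∀ g → (g ∷ b) ∈ map (g ∷_) (words (length b))
  m g = ∈-map⁺ (g ∷_) (words-complete b)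
  go : ∀ g → Any (λ h → (g ∷ b) ∈ map (h ∷_) (words (length b))) gens
  go zero             = here (m r)
  go (suc zero)       = there (here (m s))
  go (suc (suc zero)) = there (there (here (m t)))

words-length : ∀ k {b} → b ∈ words k → length b ≡ k
words-length zero (here refl) = refl
words-length (suc k) {b} i = go (∈-concatMap⁻ (λ g → map (g ∷_) (words k)) {xs = gens} i)
  where
  go : ∀ {gs} → Any (λ h → b ∈ map (h ∷_) (words k)) gs → length b ≡ suc k
  go (here j) with ∈-map⁻ _ j
  ... | c , c∈ , refl = cong suc (words-length k c∈)
  go (there a) = go a

nf-∼ : ∀ x → nf (iv x) ∼ x
nf-∼ x = eval≡⇒iv≡ {nf (iv x)} {x} (sym (foldl-⇒ idW (⇒-nf x)))

length-nf : ∀ p → length (nf p) ≡ ℓ p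
length-nf p = length-nfF (ℓ p)

lenSearch-ℓ : ∀ w k fuel → k ≤ ℓw w → ℓw w ≤ k ℕ.+ fuel → lenSearch w k fuel ≡ ℓw w
lenSearch-ℓ w k zero lo hi = ℕP.≤-antisym lo (subst (ℓw w ≤_) (ℕP.+-identityʳ k) hi)
lenSearch-ℓ w k (suc fuel) lo hi with any (λ b → sameB b w) (words k) in e
... | true with any-witness (λ b → sameB b w) (words k) e
...   | b , b∈ , same = ℕP.≤-antisym lo (subst₂ _≤_ (cong ℓ (sameB-sound {b} {w} same)) (words-length k b∈) (ℓ≤length b))
lenSearch-ℓ w k (suc fuel) lo hi | false with k ℕ.≟ ℓw w
... | yes refl with () ← trans (sym e) (any-∈ (λ b → sameB b w)
         (subst (λ n → nf (iv w) ∈ words n) (length-nf (iv w)) (words-complete (nf (iv w)))) (sameB-complete {nf (iv w)} {w} (nf-∼ w)))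
... | no ne = lenSearch-ℓ w (suc k) fuel (ℕP.≤∧≢⇒< lo ne) (subst (ℓw w ≤_) (ℕP.+-suc k fuel) hi)

len≡ℓ : ∀ w → len w ≡ ℓw w
len≡ℓ w = lenSearch-ℓ w 0 (length w) z≤n (ℓ≤length w)

ltB-desc : ∀ g x → ltB (g ∷ x) x ≡ desc g (iv x)
ltB-desc g x rewrite len≡ℓ (g ∷ x) | len≡ℓ x with desc g (iv x) in d
... | true rewrite ℓ-desc g (valid-iv x) d = go (ℓw (g ∷ x))
  where
  go : ∀ n → (n <ᵇ suc n) ≡ true
  go zero = refl
  go (suc n) = go n
... | false rewrite ℓ-asc g (valid-iv x) d = go (ℓw x)
  where
  go : ∀ n → (suc n <ᵇ n) ≡ false
  go zero = refl
  go (suc n) = go n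

Red : Word → Set
Red a = ℓw a ≡ length a

red-tail : ∀ g a → Red (g ∷ a) → Red a × desc g (iv a) ≡ false
red-tail g a e with desc g (iv a) in d
... | false = ℕP.suc-injective (trans (sym (ℓ-asc g (valid-iv a) d)) e) , refl
... | true = ⊥-elim (ℕP.<-irrefl refl (begin-strict
    length a <⟨ ℕP.n<1+n _ ⟩
    suc (length a) ≡⟨ e ⟨
    ℓw (g ∷ a) <⟨ ℕP.n<1+n _ ⟩
    suc (ℓw (g ∷ a)) ≡⟨ ℓ-desc g (valid-iv a) d ⟨
    ℓw a ≤⟨ ℓ≤length a ⟩
    length a ∎))
  where open ℕP.≤-Reasoning

red-cons : ∀ g a → Red a → desc g (iv a) ≡ false → Red (g ∷ a)
red-cons g a e d = trans (ℓ-asc g (valid-iv a) d) (cong suc e)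

filterᵇ-∈⁺ : ∀ {A : Set} (p : A → Bool) {x xs} → x ∈ xs → p x ≡ true → x ∈ filterᵇ p xs
filterᵇ-∈⁺ p (here refl) e rewrite e = here refl
filterᵇ-∈⁺ p {xs = y ∷ _} (there i) e with p y
... | true  = there (filterᵇ-∈⁺ p i e)
... | false = filterᵇ-∈⁺ p i e

filterᵇ-∈⁻ : ∀ {A : Set} (p : A → Bool) {x} xs → x ∈ filterᵇ p xs → x ∈ xs × p x ≡ true
filterᵇ-∈⁻ p (y ∷ xs) i with p y in e
filterᵇ-∈⁻ p (y ∷ xs) (here refl) | true = here refl , e
filterᵇ-∈⁻ p (y ∷ xs) (there i) | true with filterᵇ-∈⁻ p xs i
... | j , px = there j , px
filterᵇ-∈⁻ p (y ∷ xs) i | false with filterᵇ-∈⁻ p xs i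
... | j , px = there j , px

candidates : Word → List Word
candidates w = filterᵇ (λ b → sameB b w) (words (len w))

redWord-head : ∀ w {b bs} → candidates w ≡ b ∷ bs → redWord w ≡ b
redWord-head w e rewrite e = refl

nf∈candidates : ∀ w → nf (iv w) ∈ candidates w
nf∈candidates w = filterᵇ-∈⁺ _ (subst (λ n → nf (iv w) ∈ words n) (trans (length-nf (iv w)) (sym (len≡ℓ w)))
  (words-complete (nf (iv w)))) (sameB-complete {nf (iv w)} {w} (nf-∼ w))

redWord∈ : ∀ w → redWord w ∈ candidates w
redWord∈ w with candidates w | nf∈candidates w
... | b ∷ bs | _ = here refl

redWord-∼ : ∀ w → redWord w ∼ w
redWord-∼ w = sameB-sound {redWord w} {w} (proj₂ (filterᵇ-∈⁻ (λ b → sameB b w) (words (len w)) (redWord∈ w)))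

redWord-length : ∀ w → length (redWord w) ≡ ℓw w
redWord-length w = trans (words-length (len w) (proj₁ (filterᵇ-∈⁻ (λ b → sameB b w) (words (len w)) (redWord∈ w)))) (len≡ℓ w)

redWord-red : ∀ w → Red (redWord w)
redWord-red w = trans (cong ℓ (redWord-∼ w)) (sym (redWord-length w))

filterᵇ-cong : ∀ {A : Set} {p q : A → Bool} → (∀ x → p x ≡ q x) → ∀ xs → filterᵇ p xs ≡ filterᵇ q xs
filterᵇ-cong e [] = refl
filterᵇ-cong {p = p} {q} e (x ∷ xs) with p x | q x | e x
... | true  | .true  | refl = cong (x ∷_) (filterᵇ-cong e xs)
... | false | .false | refl = filterᵇ-cong e xs

redWord-cong : ∀ {x y} → x ∼ y → redWord x ≡ redWord y
redWord-cong {x} {y} e with candidates x in cx | nf∈candidates x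
... | b ∷ bs | _ = sym (redWord-head y (trans (sym same) cx))
  where
  same : candidates x ≡ candidates y
  same = trans (cong (λ n → filterᵇ (λ b → sameB b x) (words n)) (trans (len≡ℓ x) (trans (cong ℓ e) (sym (len≡ℓ y)))))
               (filterᵇ-cong (λ b → sameB-congʳ b {x} {y} e) (words (len y)))

-- Bruhat order: x is represented by a subword of a.
InD : Word → Word → Set
InD []      x = x ∼ []
InD (g ∷ a) x = InD a x ⊎ InD a (g ∷ x)

InD-resp : ∀ a {x y} → x ∼ y → InD a x → InD a y
InD-resp [] e p = trans (sym e) p
InD-resp (g ∷ a) e (inj₁ p) = inj₁ (InD-resp a e p)
InD-resp (g ∷ a) {x} {y} e (inj₂ p) = inj₂ (InD-resp a {g ∷ x} {g ∷ y} (cong (λ q → act q g) e) p)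

InD-self : ∀ a → InD a a
InD-self [] = refl
InD-self (g ∷ a) = inj₂ (InD-resp a {a} {g ∷ g ∷ a} (sym (act-involutive (iv a) g)) (InD-self a))

InD-subword : ∀ a {x} → InD a x → ∃ λ b → b ∈ subwords a × b ∼ x
InD-subword [] p = [] , here refl , sym p
InD-subword (g ∷ a) (inj₁ p) with InD-subword a p
... | b , b∈ , e = b , ∈-++⁺ʳ _ b∈ , e
InD-subword (g ∷ a) {x} (inj₂ p) with InD-subword a p
... | b , b∈ , e = g ∷ b , ∈-++⁺ˡ (∈-map⁺ (g ∷_) b∈) , trans (cong (λ q → act q g) e) (act-involutive (iv x) g)

subword-InD : ∀ a {b} → b ∈ subwords a → ∀ x → InD b x → InD a x
subword-InD [] (here refl) x p = p
subword-InD (g ∷ a) i x p with ∈-++⁻ (map (g ∷_) (subwords a)) i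
... | inj₂ j = inj₁ (subword-InD a j x p)
... | inj₁ j with ∈-map⁻ (g ∷_) j
subword-InD (g ∷ a) i x (inj₁ p) | inj₁ j | b , b∈ , refl = inj₁ (subword-InD a b∈ x p)
subword-InD (g ∷ a) i x (inj₂ p) | inj₁ j | b , b∈ , refl = inj₂ (subword-InD a b∈ (g ∷ x) p)

-- For a braid, the eight subwords of ghg and the eight of hgh represent the same six elements:
-- omitting the middle letter cancels the outer ones, and the full words agree by the relation.
InD-≃ : ∀ {a b} → a ≃ b → ∀ x → InD a x → InD b x
InD-≃ ≃-refl x p = p
InD-≃ (≃-trans e f) x p = InD-≃ f x (InD-≃ e x p)
InD-≃ (≃-cons e) x (inj₁ p) = inj₁ (InD-≃ e x p)
InD-≃ (≃-cons {g} e) x (inj₂ p) = inj₂ (InD-≃ e (g ∷ x) p)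
InD-≃ (braid ne) x (inj₁ (inj₁ (inj₁ p))) = inj₁ (inj₁ (inj₁ p))
InD-≃ (braid ne) x (inj₁ (inj₁ (inj₂ p))) = inj₁ (inj₂ (inj₁ p))
InD-≃ (braid ne) x (inj₁ (inj₂ (inj₁ p))) = inj₂ (inj₁ (inj₁ p))
InD-≃ (braid ne) x (inj₁ (inj₂ (inj₂ p))) = inj₂ (inj₂ (inj₁ p))
InD-≃ (braid ne) x (inj₂ (inj₁ (inj₁ p))) = inj₁ (inj₂ (inj₁ p))
InD-≃ (braid {g} {h} {a} ne) x (inj₂ (inj₁ (inj₂ p))) = inj₁ (inj₁ (inj₁ (InD-resp a {g ∷ g ∷ x} {x} (act-involutive (iv x) g) p)))
InD-≃ (braid ne) x (inj₂ (inj₂ (inj₁ p))) = inj₁ (inj₂ (inj₂ p))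
InD-≃ (braid {g} {h} {a} ne) x (inj₂ (inj₂ (inj₂ p))) = inj₂ (inj₂ (inj₂ (InD-resp a {g ∷ h ∷ g ∷ x} {h ∷ g ∷ h ∷ x} (act-braid (iv x) g h ne) p)))

InD-⇒ : ∀ {a b} → a ⇒ b → ∀ x → InD b x → InD a x
InD-⇒ (move e) x p = InD-≃ (≃-sym e) x p
InD-⇒ (⇒-trans e f) x p = InD-⇒ e x (InD-⇒ f x p)
InD-⇒ delete x p = inj₁ (inj₁ p)
InD-⇒ (⇒-cons e) x (inj₁ p) = inj₁ (InD-⇒ e x p)
InD-⇒ (⇒-cons {g} e) x (inj₂ p) = inj₂ (InD-⇒ e (g ∷ x) p)

red-≃-nf : ∀ a → Red a → a ≃ nf (iv a)
red-≃-nf [] _ = ≃-refl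
red-≃-nf (g ∷ a) e with red-tail g a e
... | ea , d = ≃-trans (≃-cons (red-≃-nf a ea)) (≃-sym (subst₂ (λ n q → nfF n (act (iv a) g) ≃ g ∷ nfF (ℓ (iv a)) q) (sym l) (act-involutive (iv a) g)
      (exchange (ℓ (iv a)) g (valid-act g (valid-iv a)) l (trans (desc-act g (valid-iv a)) (cong not d)))))
  where l = ℓ-asc g (valid-iv a) d

-- A subword of `a` that represents z rewrites to the normal form of z without insertions, and the
-- reduced word b is braid equivalent to that normal form.
InD-trans : ∀ a z b → InD a z → Red b → b ∼ z → ∀ x → InD b x → InD a x
InD-trans a z b pz rb bz x px with InD-subword a pz
... | b' , b'∈ , e = subword-InD a b'∈ x (InD-⇒ (⇒-nf b') x
       (subst (λ p → InD (nf p) x) (trans bz (sym e)) (InD-≃ (red-≃-nf b rb) x px)))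

cancel-act : ∀ g {x y} → (g ∷ x) ∼ y → x ∼ (g ∷ y)
cancel-act g {x} e = trans (sym (act-involutive (iv x) g)) (cong (λ q → act q g) e)

InD-length : ∀ a x → InD a x → ℓw x ≤ length a
InD-length [] x p = ℕP.≤-reflexive (cong ℓ p)
InD-length (g ∷ a) x (inj₁ p) = ℕP.≤-trans (InD-length a x p) (ℕP.n≤1+n _)
InD-length (g ∷ a) x (inj₂ p) = ℕP.≤-trans (subst (_≤ suc (ℓw (g ∷ x))) (cong ℓ (act-involutive (iv x) g)) (ℓ≤ g (valid-iv (g ∷ x)))) (s≤s (InD-length a (g ∷ x) p))

InD-top : ∀ a x → InD a x → length a ≤ ℓw x → x ∼ a
InD-top [] x p _ = p
InD-top (g ∷ a) x (inj₁ p) l = ⊥-elim (ℕP.<-irrefl refl (ℕP.≤-trans l (InD-length a x p)))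
InD-top (g ∷ a) x (inj₂ p) l = cancel-act g {x} {a} (InD-top a (g ∷ x) p (ℕ.s≤s⁻¹ (ℕP.≤-trans l
  (subst (_≤ suc (ℓw (g ∷ x))) (cong ℓ (act-involutive (iv x) g)) (ℓ≤ g (valid-iv (g ∷ x)))))))

Distinct : List Word → Set
Distinct = AllPairs (λ x y → ¬ x ∼ y)

dedup-∈⁻ : ∀ xs {z} → z ∈ dedup xs → z ∈ xs
dedup-∈⁻ (x ∷ xs) i with memB x (dedup xs)
... | true = there (dedup-∈⁻ xs i)
dedup-∈⁻ (x ∷ xs) (here refl) | false = here refl
dedup-∈⁻ (x ∷ xs) (there i) | false = there (dedup-∈⁻ xs i)

dedup-complete : ∀ xs {z} → z ∈ xs → ∃ λ y → y ∈ dedup xs × y ∼ z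
dedup-complete (x ∷ xs) i with memB x (dedup xs) in e
dedup-complete (x ∷ xs) (here refl) | true with any-witness (sameB x) (dedup xs) e
... | y , y∈ , same = y , y∈ , sym (sameB-sound {x} {y} same)
dedup-complete (x ∷ xs) (there i) | true = dedup-complete xs i
dedup-complete (x ∷ xs) (here refl) | false = x , here refl , refl
dedup-complete (x ∷ xs) (there i) | false with dedup-complete xs i
... | y , y∈ , same = y , there y∈ , same

dedup-distinct : ∀ xs → Distinct (dedup xs)
dedup-distinct [] = []
dedup-distinct (x ∷ xs) with memB x (dedup xs) in e
... | true  = dedup-distinct xs
... | false = All.tabulate (λ {y} y∈ same → no-member y∈ (sameB-complete {x} {y} same)) ∷ dedup-distinct xs
  where
  no-member : ∀ {y} → y ∈ dedup xs → sameB x y ≡ true → ⊥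
  no-member i same with () ← trans (sym e) (any-∈ (sameB x) i same)

filterᵇ-distinct : ∀ (p : Word → Bool) {xs} → Distinct xs → Distinct (filterᵇ p xs)
filterᵇ-distinct p [] = []
filterᵇ-distinct p {x ∷ xs} (d ∷ ds) with p x
... | true  = filterᵇ⁺ p d ∷ filterᵇ-distinct p ds
... | false = filterᵇ-distinct p ds

lower : Gen → Word → List Word
lower g a = filterᵇ (λ z → ltB (g ∷ z) z) (below a)

lower-distinct : ∀ g a → Distinct (lower g a)
lower-distinct g a = filterᵇ-distinct _ (filterᵇ-distinct _ (dedup-distinct (subwords a)))

lower-∈ : ∀ g a {z} → z ∈ lower g a → InD a z × ¬ z ∼ a × desc g (iv z) ≡ true
lower-∈ g a {z} i with filterᵇ-∈⁻ (λ z → ltB (g ∷ z) z) (below a) i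
... | j , d with filterᵇ-∈⁻ (λ z → not (sameB z a)) (dedup (subwords a)) j
...   | k , ns = subword-InD a (dedup-∈⁻ (subwords a) k) z (InD-self z) , ne , trans (sym (ltB-desc g z)) d
  where
  ne : ¬ z ∼ a
  ne e with () ← trans (sym ns) (cong not (sameB-complete {z} {a} e))

lower-complete : ∀ g a x → InD a x → ¬ x ∼ a → desc g (iv x) ≡ true → ∃ λ z → z ∈ lower g a × z ∼ x
lower-complete g a x p ne d with InD-subword a p
... | b , b∈ , e with dedup-complete (subwords a) b∈
...   | z , z∈ , e' = z , filterᵇ-∈⁺ _ (filterᵇ-∈⁺ _ z∈ (cong not (sameB-false {z} {a} λ q → ne (trans (sym (trans e' e)) q))))
          (trans (ltB-desc g z) (trans (cong (desc g) (trans e' e)) d)) , trans e' e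

-- The Kazhdan–Lusztig recursion

Seq : Set
Seq = ℕ → ℤ

Fun : Set
Fun = Word → Seq

↑ : Seq → Seq
↑ f zero    = + 0
↑ f (suc k) = f k

↑^ : ℕ → Seq → Seq
↑^ zero    f = f
↑^ (suc i) f = ↑ (↑^ i f)

↑-cong : ∀ {f f' : Seq} → (∀ k → f k ≡ f' k) → ∀ k → ↑ f k ≡ ↑ f' k
↑-cong e zero    = refl
↑-cong e (suc k) = e k

↑^-cong : ∀ i {f f' : Seq} → (∀ k → f k ≡ f' k) → ∀ k → ↑^ i f k ≡ ↑^ i f' k
↑^-cong zero e k = e k
↑^-cong (suc i) e k = ↑-cong (↑^-cong i e) k

coeff-⊕ : ∀ p q k → coeff (p ⊕ q) k ≡ coeff p k + coeff q k
coeff-⊕ [] q k = sym (ℤP.+-identityˡ _)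
coeff-⊕ (a ∷ p) [] zero = sym (ℤP.+-identityʳ _)
coeff-⊕ (a ∷ p) [] (suc k) = sym (ℤP.+-identityʳ _)
coeff-⊕ (a ∷ p) (b ∷ q) zero = refl
coeff-⊕ (a ∷ p) (b ∷ q) (suc k) = coeff-⊕ p q k

coeff-scale : ∀ c p k → coeff (scale c p) k ≡ c * coeff p k
coeff-scale c [] k = sym (ℤP.*-zeroʳ c)
coeff-scale c (a ∷ p) zero = refl
coeff-scale c (a ∷ p) (suc k) = coeff-scale c p k

coeff-shift : ∀ i p k → coeff (shift i p) k ≡ ↑^ i (coeff p) k
coeff-shift zero p k = refl
coeff-shift (suc i) p zero = refl
coeff-shift (suc i) p (suc k) = coeff-shift i p k

sumOver : (Word → ℤ) → List Word → ℤ
sumOver h []       = + 0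
sumOver h (z ∷ zs) = h z + sumOver h zs

coeff-sumP : ∀ (F : Word → Poly) zs k → coeff (sumP (map F zs)) k ≡ sumOver (λ z → coeff (F z) k) zs
coeff-sumP F [] k = refl
coeff-sumP F (z ∷ zs) k = trans (coeff-⊕ (F z) (sumP (map F zs)) k) (cong (λ v → coeff (F z) k + v) (coeff-sumP F zs k))

sumOver-cong : ∀ {h h' : Word → ℤ} zs → (∀ z → z ∈ zs → h z ≡ h' z) → sumOver h zs ≡ sumOver h' zs
sumOver-cong [] e = refl
sumOver-cong (z ∷ zs) e = cong₂ _+_ (e z (here refl)) (sumOver-cong zs (λ y → e y ∘ there))

sumOver-zero : ∀ {h : Word → ℤ} zs → (∀ z → z ∈ zs → h z ≡ + 0) → sumOver h zs ≡ + 0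
sumOver-zero [] e = refl
sumOver-zero (z ∷ zs) e = cong₂ _+_ (e z (here refl)) (sumOver-zero zs (λ y → e y ∘ there))

sumOver-single : ∀ {h : Word → ℤ} {zs z₀} x → Distinct zs → z₀ ∈ zs → z₀ ∼ x →
  (∀ z → z ∈ zs → ¬ z ∼ x → h z ≡ + 0) → sumOver h zs ≡ h z₀
sumOver-single {h} {z ∷ zs} x (d ∷ ds) (here refl) e vanish =
  trans (cong (λ v → h z + v) (sumOver-zero zs (λ y y∈ → vanish y (there y∈) (λ q → All.lookup d y∈ (trans e (sym q))))))
        (ℤP.+-identityʳ (h z))
sumOver-single {h} {z ∷ zs} x (d ∷ ds) (there i) e vanish =
  trans (cong₂ _+_ (vanish z (here refl) (λ q → All.lookup d i (trans q (sym e)))) (sumOver-single x ds i e (λ y y∈ → vanish y (there y∈))))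
        (ℤP.+-identityˡ _)

klTerm : ℕ → Word → Word → Word → Poly
klTerm n x a z = scale (muOf (KLrec n z a) (len z) (length a))
                       (shift ((suc (length a) ∸ len z) / 2) (KLrec n x (redWord z)))

map-cong-∈ : ∀ {A B : Set} {f f' : A → B} xs → (∀ x → x ∈ xs → f x ≡ f' x) → map f xs ≡ map f' xs
map-cong-∈ [] e = refl
map-cong-∈ (x ∷ xs) e = cong₂ _∷_ (e x (here refl)) (map-cong-∈ xs (λ y → e y ∘ there))

lower-length : ∀ g a {z} → z ∈ lower g a → length (redWord z) < length a
lower-length g a {z} i with lower-∈ g a i
... | p , ne , _ = subst (_< length a) (sym (redWord-length z))
      (ℕP.≤∧≢⇒< (InD-length a z p) λ e → ne (InD-top a z p (ℕP.≤-reflexive (sym e))))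

KLrec-fuel : ∀ n m x a → length a ≤ n → length a ≤ m → KLrec n x a ≡ KLrec m x a
KLrec-fuel n m x [] _ _ = refl
KLrec-fuel (suc n) (suc m) x (g ∷ a) (s≤s p) (s≤s q) =
  cong₂ _⊕_ (cong (shift (if ltB (g ∷ x) x then 0 else 1)) (KLrec-fuel n m (g ∷ x) a p q))
  (cong₂ _⊕_ (cong (shift (if ltB (g ∷ x) x then 1 else 0)) (KLrec-fuel n m x a p q))
  (cong (neg ∘ sumP) (map-cong-∈ (lower g a) λ z z∈ →
    let l = ℕP.<⇒≤ (lower-length g a z∈) in
    cong₂ (λ P Q → scale (muOf P (len z) (length a)) (shift ((suc (length a) ∸ len z) / 2) Q))
      (KLrec-fuel n m z a p q) (KLrec-fuel n m x (redWord z) (ℕP.≤-trans l p) (ℕP.≤-trans l q)))))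

KLrec-resp : ∀ n {x y} a → x ∼ y → KLrec n x a ≡ KLrec n y a
KLrec-resp n {x} {y} [] e = cong (λ b → if b then + 1 ∷ [] else []) (sameB-congˡ {x} {y} [] e)
KLrec-resp zero (g ∷ a) e = refl
KLrec-resp (suc n) {x} {y} (g ∷ a) e =
  cong₂ _⊕_ (cong₂ (λ b → shift (if b then 0 else 1)) c (KLrec-resp n {g ∷ x} {g ∷ y} a (cong (λ q → act q g) e)))
  (cong₂ _⊕_ (cong₂ (λ b → shift (if b then 1 else 0)) c (KLrec-resp n a e))
  (cong (neg ∘ sumP) (map-cong-∈ (lower g a) λ z z∈ →
    cong (λ Q → scale (muOf (KLrec n z a) (len z) (length a)) (shift ((suc (length a) ∸ len z) / 2) Q)) (KLrec-resp n (redWord z) e))))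
  where
  c : ltB (g ∷ x) x ≡ ltB (g ∷ y) y
  c = trans (ltB-desc g x) (trans (cong (desc g) e) (sym (ltB-desc g y)))

K : Word → Fun
K a x = coeff (KLrec (length a) x a)

-- `K` depends a priori on the word, `C` only on the element; the statement `Indep` closes this gap.
C : Word → Fun
C z = K (redWord z)

C-cong : ∀ {z z'} → z ∼ z' → C z ≡ C z'
C-cong {z} {z'} e = cong K (redWord-cong {z} {z'} e)

Invariant : Fun → Set
Invariant f = ∀ {x y} → x ∼ y → ∀ k → f x k ≡ f y k

K-invariant : ∀ a → Invariant (K a)
K-invariant a e k = cong (λ p → coeff p k) (KLrec-resp (length a) a e)

mu : Word → Word → ℤ
mu a z = muOf (KLrec (length a) z a) (ℓw z) (length a)

mu-resp : ∀ a {x y} → x ∼ y → mu a x ≡ mu a y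
mu-resp a {x} {y} e = cong₂ (λ p l → muOf p l (length a)) (KLrec-resp (length a) a e) (cong ℓ e)

ex : Word → Word → ℕ
ex a z = (suc (length a) ∸ ℓw z) / 2

infixr 7 _⋆_
-- The product of 1 + T_g with Σ f(x) T_x in the Hecke algebra, read coefficientwise.
_⋆_ : Gen → Fun → Fun
(g ⋆ f) x k = if desc g (iv x) then f (g ∷ x) k + ↑ (f x) k else ↑ (f (g ∷ x)) k + f x k

lowerSum : Gen → Word → Fun
lowerSum g a x k = sumOver (λ z → mu a z * ↑^ (ex a z) (C z x) k) (lower g a)

K-cons : ∀ g a x k → K (g ∷ a) x k ≡ (g ⋆ K a) x k - lowerSum g a x k
K-cons g a x k = begin
  coeff (P ⊕ (Q ⊕ neg S)) k                                ≡⟨ coeff-⊕ P (Q ⊕ neg S) k ⟩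
  coeff P k + coeff (Q ⊕ neg S) k                        ≡⟨ cong (λ v → coeff P k + v) (coeff-⊕ Q (neg S) k) ⟩
  coeff P k + (coeff Q k + coeff (neg S) k)            ≡⟨ ℤP.+-assoc (coeff P k) (coeff Q k) (coeff (neg S) k) ⟨
  coeff P k + coeff Q k + coeff (neg S) k              ≡⟨ cong₂ _+_ PQ (trans (coeff-scale (- + 1) S k) (trans (ℤP.-1*i≡-i (coeff S k)) (cong -_ Ssum))) ⟩
  (g ⋆ K a) x k - lowerSum g a x k                       ∎
  where
  open ≡-Reasoning
  n = length a
  b = ltB (g ∷ x) x
  P = shift (if b then 0 else 1) (KLrec n (g ∷ x) a)
  Q = shift (if b then 1 else 0) (KLrec n x a)
  S = sumP (map (klTerm n x a) (lower g a))
  PQ : coeff P k + coeff Q k ≡ (g ⋆ K a) x k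
  PQ rewrite ltB-desc g x with desc g (iv x)
  ... | true  = cong (λ v → K a (g ∷ x) k + v) (coeff-shift 1 (KLrec n x a) k)
  ... | false = cong (λ v → v + K a x k) (coeff-shift 1 (KLrec n (g ∷ x) a) k)
  Ssum : coeff S k ≡ lowerSum g a x k
  Ssum = trans (coeff-sumP (klTerm n x a) (lower g a) k) (sumOver-cong (lower g a) λ z z∈ →
    trans (coeff-scale (muOf (KLrec n z a) (len z) n) (shift ((suc n ∸ len z) / 2) (KLrec n x (redWord z))) k)
    (cong₂ _*_ (cong (λ l → muOf (KLrec n z a) l n) (len≡ℓ z))
      (trans (coeff-shift ((suc n ∸ len z) / 2) (KLrec n x (redWord z)) k)
      (trans (cong (λ l → ↑^ ((suc n ∸ l) / 2) (coeff (KLrec n x (redWord z))) k) (len≡ℓ z))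
      (↑^-cong (ex a z) (λ j → cong (λ p → coeff p j) (KLrec-fuel n (length (redWord z)) x (redWord z) (ℕP.<⇒≤ (lower-length g a z∈)) ℕP.≤-refl)) k)))))

K-nil-self : ∀ x k → x ∼ [] → K [] x k ≡ coeff (+ 1 ∷ []) k
K-nil-self x k e rewrite sameB-complete {x} {[]} e = refl

K-nil-other : ∀ x k → ¬ x ∼ [] → K [] x k ≡ + 0
K-nil-other x k ne rewrite sameB-false {x} {[]} ne = refl

↑-zero : ∀ {f : Seq} → (∀ k → f k ≡ + 0) → ∀ k → ↑ f k ≡ + 0
↑-zero e zero = refl
↑-zero e (suc k) = e k

↑^-zero : ∀ i {f : Seq} → (∀ k → f k ≡ + 0) → ∀ k → ↑^ i f k ≡ + 0
↑^-zero zero e k = e k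
↑^-zero (suc i) e k = ↑-zero (↑^-zero i e) k

⋆-zero : ∀ g f x k → (∀ k → f x k ≡ + 0) → (∀ k → f (g ∷ x) k ≡ + 0) → (g ⋆ f) x k ≡ + 0
⋆-zero g f x k e e' with desc g (iv x)
... | true  = cong₂ _+_ (e' k) (↑-zero e k)
... | false = cong₂ _+_ (↑-zero e' k) (e k)

support : ∀ n a x k → length a ≤ n → ¬ InD a x → K a x k ≡ + 0
support n [] x k _ np = K-nil-other x k np
support (suc n) (g ∷ a) x k (s≤s l) np = trans (K-cons g a x k) (cong₂ _-_
  (⋆-zero g (K a) x k (λ k → support n a x k l (np ∘ inj₁)) (λ k → support n a (g ∷ x) k l (np ∘ inj₂)))
  (sumOver-zero (lower g a) λ z z∈ → trans (cong (λ v → mu a z * v)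
    (↑^-zero (ex a z) (λ k → support n (redWord z) x k (ℕP.≤-trans (ℕP.<⇒≤ (lower-length g a z∈)) l)
      (λ p → np (inj₁ (InD-trans a z (redWord z) (proj₁ (lower-∈ g a z∈)) (redWord-red z) (redWord-∼ z) x p)))) k))
    (ℤP.*-zeroʳ (mu a z))))

-- The degree bound

InD? : ∀ a x → Dec (InD a x)
InD? [] x = x ∼? []
InD? (g ∷ a) x = InD? a x ⊎-dec InD? a (g ∷ x)

-- The bound is deg f(x) ≤ (ℓ(a) - ℓ(x) - 1)/2, doubled to avoid division.
record Normalized (a : Word) (f : Fun) : Set where
  field
    atTop   : ∀ x k → x ∼ a → f x k ≡ coeff (+ 1 ∷ []) k
    bounded : ∀ x k → ¬ x ∼ a → length a ≤ k ℕ.+ k ℕ.+ ℓw x → f x k ≡ + 0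
open Normalized public

↑^-below : ∀ i (f : Seq) k → k < i → ↑^ i f k ≡ + 0
↑^-below (suc i) f zero _ = refl
↑^-below (suc i) f (suc k) (s≤s p) = ↑^-below i f k p

↑^-above : ∀ i (f : Seq) j → ↑^ i f (i ℕ.+ j) ≡ f j
↑^-above zero f j = refl
↑^-above (suc i) f j = ↑^-above i f j

half-double : ∀ m → m / 2 ℕ.+ m / 2 ≤ m
half-double m = subst (_≤ m) (lemma (m / 2)) (DM.m/n*n≤m m 2)
  where
  lemma : ∀ h → h ℕ.* 2 ≡ h ℕ.+ h
  lemma = solveℕ-∀

double-half : ∀ k → (k ℕ.+ k) / 2 ≡ k
double-half k = trans (cong (_/ 2) (lemma k)) (DM.m*n/n≡m k 2)
  where
  lemma : ∀ k → k ℕ.+ k ≡ k ℕ.* 2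
  lemma = solveℕ-∀

odd-%2 : ∀ k → suc (k ℕ.+ k) % 2 ≡ 1
odd-%2 k = trans (cong (_% 2) (lemma k)) (DM.[m+kn]%n≡m%n 1 k 2)
  where
  lemma : ∀ k → suc (k ℕ.+ k) ≡ 1 ℕ.+ k ℕ.* 2
  lemma = solveℕ-∀

half-mono : ∀ {m n} → m ≤ n → m / 2 ≤ n / 2
half-mono p = DM./-monoˡ-≤ 2 p

odd-half : ∀ k → suc (k ℕ.+ k) / 2 ≡ k
odd-half k = ℕP.≤-antisym upper (subst (_≤ suc (k ℕ.+ k) / 2) (double-half k) (half-mono (ℕP.n≤1+n (k ℕ.+ k))))
  where
  h = suc (k ℕ.+ k) / 2
  upper : h ≤ k
  upper with h ℕ.≤? k
  ... | yes p = p
  ... | no np = ⊥-elim (ℕP.<-irrefl refl (ℕP.≤-trans (ℕP.≤-reflexive (cong suc (sym (ℕP.+-suc k k))))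
                  (ℕP.≤-trans (ℕP.+-mono-≤ (ℕP.≰⇒> np) (ℕP.≰⇒> np)) (half-double (suc (k ℕ.+ k))))))

module _ (g : Gen) (a : Word) (NA : Normalized a (K a)) (NC : ∀ z → z ∈ lower g a → Normalized (redWord z) (C z))
         (da : desc g (iv a) ≡ false) where
  private
    n = length a

  ex-bound : ∀ z → z ∈ lower g a → ex a z ℕ.+ ex a z ℕ.+ ℓw z ≤ suc n
  ex-bound z z∈ = ℕP.≤-trans (ℕP.+-monoˡ-≤ (ℓw z) (half-double (suc n ∸ ℓw z)))
    (ℕP.≤-reflexive (ℕP.m∸n+n≡m (ℕP.≤-trans (InD-length a z (proj₁ (lower-∈ g a z∈))) (ℕP.n≤1+n n))))

  -- Since 2 `ex a z` + ℓ(z) ≤ n + 1, the shift by `ex a z` turns the degree bound relative to ℓ(z)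
  -- into one relative to n + 1.
  term-other : ∀ z x k → z ∈ lower g a → ¬ x ∼ z → suc n ≤ k ℕ.+ k ℕ.+ ℓw x → ↑^ (ex a z) (C z x) k ≡ + 0
  term-other z x k z∈ ne b with k ℕ.<? ex a z
  ... | yes p = ↑^-below (ex a z) (C z x) k p
  ... | no np = subst (λ k → ↑^ (ex a z) (C z x) k ≡ + 0) k≡ (trans (↑^-above e (C z x) j)
        (bounded (NC z z∈) x j (λ q → ne (trans q (redWord-∼ z)))
          (subst (_≤ j ℕ.+ j ℕ.+ ℓw x) (sym (redWord-length z)) (ℕP.+-cancelˡ-≤ (e ℕ.+ e) (ℓw z) (j ℕ.+ j ℕ.+ ℓw x)
            (ℕP.≤-trans (ex-bound z z∈) (ℕP.≤-trans b (ℕP.≤-reflexive (trans (cong (λ k → k ℕ.+ k ℕ.+ ℓw x) (sym k≡)) (lemma e j (ℓw x))))))))))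
    where
    e = ex a z
    j = k ∸ e
    k≡ : e ℕ.+ j ≡ k
    k≡ = ℕP.m+[n∸m]≡n (ℕP.≮⇒≥ np)
    lemma : ∀ e j l → (e ℕ.+ j) ℕ.+ (e ℕ.+ j) ℕ.+ l ≡ (e ℕ.+ e) ℕ.+ (j ℕ.+ j ℕ.+ l)
    lemma = solveℕ-∀

  term-self : ∀ z x k → z ∈ lower g a → x ∼ z → ¬ k ≡ ex a z → ↑^ (ex a z) (C z x) k ≡ + 0
  term-self z x k z∈ q ne with k ℕ.<? ex a z
  ... | yes p = ↑^-below (ex a z) (C z x) k p
  ... | no np = subst (λ k → ↑^ (ex a z) (C z x) k ≡ + 0) k≡ (trans (↑^-above e (C z x) j)
        (trans (atTop (NC z z∈) x j (trans q (sym (redWord-∼ z)))) (go j λ j≡0 → ne (trans (sym k≡) (trans (cong (e ℕ.+_) j≡0) (ℕP.+-identityʳ e))))))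
    where
    e = ex a z
    j = k ∸ e
    k≡ : e ℕ.+ j ≡ k
    k≡ = ℕP.m+[n∸m]≡n (ℕP.≮⇒≥ np)
    go : ∀ j → ¬ j ≡ 0 → coeff (+ 1 ∷ []) j ≡ + 0
    go zero ne = ⊥-elim (ne refl)
    go (suc j) ne = refl

  term-exact : ∀ z x → z ∈ lower g a → x ∼ z → ↑^ (ex a z) (C z x) (ex a z) ≡ + 1
  term-exact z x z∈ q = trans (cong (↑^ (ex a z) (C z x)) (sym (ℕP.+-identityʳ (ex a z))))
    (trans (↑^-above (ex a z) (C z x) 0) (atTop (NC z z∈) x 0 (trans q (sym (redWord-∼ z)))))

  -- The top coefficients of q K a are removed by the correction terms.
  lowerSum-cancels : ∀ x k → desc g (iv x) ≡ true → suc n ≤ k ℕ.+ k ℕ.+ ℓw x → lowerSum g a x k ≡ ↑ (K a x) k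
  lowerSum-cancels x k dx b with InD? a x
  ... | no np = trans (sumOver-zero (lower g a) λ z z∈ → trans (cong (λ v → mu a z * v)
                  (term-other z x k z∈ (λ q → np (InD-resp a {z} {x} (sym q) (proj₁ (lower-∈ g a z∈)))) b)) (ℤP.*-zeroʳ (mu a z)))
                (sym (↑-zero (λ j → support n a x j ℕP.≤-refl np) k))
  ... | yes p with lower-complete g a x p x≁a dx
    where
    x≁a : ¬ x ∼ a
    x≁a q with () ← trans (sym dx) (trans (cong (desc g) q) da)
  ... | z , z∈ , zx = trans (sumOver-single {h = λ z → mu a z * ↑^ (ex a z) (C z x) k} x (lower-distinct g a) z∈ zx λ y y∈ y≁x →
          trans (cong (λ v → mu a y * v) (term-other y x k y∈ (y≁x ∘ sym) b)) (ℤP.*-zeroʳ (mu a y))) (go k b)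
    where
    x≁a : ¬ x ∼ a
    x≁a q with () ← trans (sym dx) (trans (cong (desc g) q) da)
    lx : ℓw x ≤ n
    lx = InD-length a x p
    ez : ex a z ≡ (suc n ∸ ℓw x) / 2
    ez = cong (λ p → (suc n ∸ ℓ p) / 2) zx
    go : ∀ k → suc n ≤ k ℕ.+ k ℕ.+ ℓw x → mu a z * ↑^ (ex a z) (C z x) k ≡ ↑ (K a x) k
    go zero b = ⊥-elim (ℕP.<-irrefl refl (ℕP.≤-trans b lx))
    go (suc k) b with n ℕ.≤? k ℕ.+ k ℕ.+ ℓw x
    ... | yes q = trans (trans (cong (λ v → mu a z * v) (term-self z x (suc k) z∈ (sym zx) λ e →
                    ℕP.<-irrefl refl (ℕP.≤-trans (ℕP.≤-reflexive (trans e ez)) small))) (ℤP.*-zeroʳ (mu a z)))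
                  (sym (bounded NA x k x≁a q))
      where
      small : (suc n ∸ ℓw x) / 2 ≤ k
      small = ℕP.≤-trans (half-mono (ℕP.≤-trans (ℕP.∸-monoˡ-≤ (ℓw x) (s≤s q)) (ℕP.≤-reflexive (ℕP.m+n∸n≡m (suc (k ℕ.+ k)) (ℓw x)))))
                (ℕP.≤-reflexive (odd-half k))
    ... | no nq = trans (cong₂ _*_ mu≡ one) (ℤP.*-identityʳ (K a x k))
      where
      n≡ : n ≡ suc (k ℕ.+ k) ℕ.+ ℓw x
      n≡ = ℕP.≤-antisym (ℕ.s≤s⁻¹ (ℕP.≤-trans b (ℕP.≤-reflexive (cong (λ m → suc m ℕ.+ ℓw x) (ℕP.+-suc k k))))) (ℕP.≰⇒> nq)
      diff : n ∸ ℓw x ≡ suc (k ℕ.+ k)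
      diff = trans (cong (_∸ ℓw x) n≡) (ℕP.m+n∸n≡m (suc (k ℕ.+ k)) (ℓw x))
      mu≡ : mu a z ≡ K a x k
      mu≡ = trans (mu-resp a {z} {x} zx) eq
        where
        eq : mu a x ≡ K a x k
        eq rewrite diff | odd-%2 k | double-half k = refl
      k≡ : suc k ≡ ex a z
      k≡ = sym (trans ez (trans (cong (λ m → (suc m ∸ ℓw x) / 2) n≡) (trans (cong (_/ 2) (ℕP.m+n∸n≡m (suc (suc (k ℕ.+ k))) (ℓw x)))
             (trans (cong (λ m → suc m / 2) (sym (ℕP.+-suc k k))) (double-half (suc k))))))
      one : ↑^ (ex a z) (C z x) (suc k) ≡ + 1
      one = trans (cong (↑^ (ex a z) (C z x)) k≡) (term-exact z x z∈ (sym zx))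

  -- Every correction element has g as a left descent, so x is none of them and only `term-other`
  -- applies.
  lowerSum-asc : ∀ x k → desc g (iv x) ≡ false → suc n ≤ k ℕ.+ k ℕ.+ ℓw x → lowerSum g a x k ≡ + 0
  lowerSum-asc x k dx b = sumOver-zero (lower g a) λ z z∈ → trans (cong (λ v → mu a z * v)
    (term-other z x k z∈ (λ q → ne (trans (sym dx) (trans (cong (desc g) q) (proj₂ (proj₂ (lower-∈ g a z∈)))))) b)) (ℤP.*-zeroʳ (mu a z))
    where
    ne : ¬ false ≡ true
    ne ()

  -- Only the unshifted summand survives in these degrees, so the normalisation of `K a` at g x
  -- carries over to x.
  K-desc : ∀ x k → desc g (iv x) ≡ true → suc n ≤ k ℕ.+ k ℕ.+ ℓw x → K (g ∷ a) x k ≡ K a (g ∷ x) k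
  K-desc x k dx b = trans (K-cons g a x k) (trans (cong₂ _-_ star (lowerSum-cancels x k dx b)) (lemma (K a (g ∷ x) k) (↑ (K a x) k)))
    where
    star : (g ⋆ K a) x k ≡ K a (g ∷ x) k + ↑ (K a x) k
    star rewrite dx = refl
    lemma : ∀ i j → i + j - j ≡ i
    lemma i j = trans (ℤP.+-assoc i j (- j)) (trans (cong (λ v → i + v) (ℤP.+-inverseʳ j)) (ℤP.+-identityʳ i))

  normalized-cons : Red a → Normalized (g ∷ a) (K (g ∷ a))
  normalized-cons ra .atTop x k q = trans (K-desc x k dx (ℕP.≤-trans (ℕP.≤-reflexive (sym lx)) (ℕP.m≤n+m (ℓw x) (k ℕ.+ k))))
      (atTop NA (g ∷ x) k (trans (cong (λ p → act p g) q) (act-involutive (iv a) g)))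
    where
    dx : desc g (iv x) ≡ true
    dx = trans (cong (desc g) q) (trans (desc-act g (valid-iv a)) (cong not da))
    lx : ℓw x ≡ suc n
    lx = trans (cong ℓ q) (red-cons g a ra da)
  normalized-cons ra .bounded x k ne b = go (desc g (iv x)) refl
    where
    gx≁a : ¬ (g ∷ x) ∼ a
    gx≁a q = ne (cancel-act g {x} {a} q)
    go : ∀ b → desc g (iv x) ≡ b → K (g ∷ a) x k ≡ + 0
    go true dx = trans (K-desc x k dx b) (bounded NA (g ∷ x) k gx≁a
      (ℕ.s≤s⁻¹ (ℕP.≤-trans b (ℕP.≤-reflexive (trans (cong (k ℕ.+ k ℕ.+_) (ℓ-desc g (valid-iv x) dx)) (ℕP.+-suc (k ℕ.+ k) (ℓw (g ∷ x))))))))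
    go false dx = trans (K-cons g a x k) (cong₂ _-_ (trans star (cong₂ _+_ (up k b) mid)) (lowerSum-asc x k dx b))
      where
      star : (g ⋆ K a) x k ≡ ↑ (K a (g ∷ x)) k + K a x k
      star rewrite dx = refl
      up : ∀ k → suc n ≤ k ℕ.+ k ℕ.+ ℓw x → ↑ (K a (g ∷ x)) k ≡ + 0
      up zero _ = refl
      up (suc k) b = bounded NA (g ∷ x) k gx≁a (ℕ.s≤s⁻¹ (ℕP.≤-trans b (ℕP.≤-reflexive
        (trans (cong (λ m → suc m ℕ.+ ℓw x) (ℕP.+-suc k k)) (cong suc (trans (sym (ℕP.+-suc (k ℕ.+ k) (ℓw x))) (cong (k ℕ.+ k ℕ.+_) (sym (ℓ-asc g (valid-iv x) dx)))))))))
      mid : K a x k ≡ + 0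
      mid with x ∼? a
      ... | no x≁a = bounded NA x k x≁a (ℕP.≤-trans (ℕP.n≤1+n n) b)
      ... | yes q = trans (atTop NA x k q) (pos k b)
        where
        pos : ∀ k → suc n ≤ k ℕ.+ k ℕ.+ ℓw x → coeff (+ 1 ∷ []) k ≡ + 0
        pos zero b = ⊥-elim (ℕP.<-irrefl refl (ℕP.≤-trans b (ℕP.≤-reflexive (trans (cong ℓ q) ra))))
        pos (suc k) b = refl

-- The correction elements enter through their own reduced words, which are shorter; so the
-- induction runs before anything is known about independence of the word.
normalized : ∀ N a → length a ≤ N → Red a → Normalized a (K a)
normalized N [] _ _ .atTop x k q = K-nil-self x k q
normalized N [] _ _ .bounded x k ne _ = K-nil-other x k ne
normalized (suc N) (g ∷ a) (s≤s l) ra = normalized-cons g a (normalized N a l (proj₁ (red-tail g a ra)))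
  (λ z z∈ → normalized N (redWord z) (ℕP.≤-trans (ℕP.<⇒≤ (lower-length g a z∈)) l) (redWord-red z))
  (proj₂ (red-tail g a ra)) (proj₁ (red-tail g a ra))

C-normalized : ∀ z → Normalized (redWord z) (C z)
C-normalized z = normalized (length (redWord z)) (redWord z) ℕP.≤-refl (redWord-red z)

-- Uniqueness of Kazhdan–Lusztig elements

infix 4 _≐_
_≐_ : Fun → Fun → Set
f ≐ f' = ∀ x k → f x k ≡ f' x k

≐-sym : ∀ {f f'} → f ≐ f' → f' ≐ f
≐-sym e x k = sym (e x k)

≐-trans : ∀ {f f' f''} → f ≐ f' → f' ≐ f'' → f ≐ f''
≐-trans e e' x k = trans (e x k) (e' x k)

infixl 6 _⊞_ _⊟_
infixr 8 _·_
_⊞_ _⊟_ : Fun → Fun → Fun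
(f ⊞ f') x k = f x k + f' x k
(f ⊟ f') x k = f x k - f' x k

_·_ : ℤ → Fun → Fun
(c · f) x k = c * f x k

𝟘 : Fun
𝟘 x k = + 0

q^ : ℕ → Fun → Fun
q^ i f x = ↑^ i (f x)

↑-+ : ∀ (f f' : Seq) k → ↑ (λ j → f j + f' j) k ≡ ↑ f k + ↑ f' k
↑-+ f f' zero = refl
↑-+ f f' (suc k) = refl

↑-* : ∀ c (f : Seq) k → ↑ (λ j → c * f j) k ≡ c * ↑ f k
↑-* c f zero = sym (ℤP.*-zeroʳ c)
↑-* c f (suc k) = refl

↑^-+ : ∀ i (f f' : Seq) k → ↑^ i (λ j → f j + f' j) k ≡ ↑^ i f k + ↑^ i f' k
↑^-+ zero f f' k = refl
↑^-+ (suc i) f f' k = trans (↑-cong (↑^-+ i f f') k) (↑-+ (↑^ i f) (↑^ i f') k)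

↑^-* : ∀ i c (f : Seq) k → ↑^ i (λ j → c * f j) k ≡ c * ↑^ i f k
↑^-* zero c f k = refl
↑^-* (suc i) c f k = trans (↑-cong (↑^-* i c f) k) (↑-* c (↑^ i f) k)

↑^-↑^ : ∀ i j (f : Seq) k → ↑^ i (↑^ j f) k ≡ ↑^ (i ℕ.+ j) f k
↑^-↑^ zero j f k = refl
↑^-↑^ (suc i) j f k = ↑-cong (↑^-↑^ i j f) k

↑^-↑ : ∀ i (f : Seq) k → ↑^ i (↑ f) k ≡ ↑^ (suc i) f k
↑^-↑ zero f k = refl
↑^-↑ (suc i) f k = ↑-cong (↑^-↑ i f) k

⋆-cong : ∀ g {f f'} → f ≐ f' → g ⋆ f ≐ g ⋆ f'
⋆-cong g e x k with desc g (iv x)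
... | true  = cong₂ _+_ (e (g ∷ x) k) (↑-cong (e x) k)
... | false = cong₂ _+_ (↑-cong (e (g ∷ x)) k) (e x k)

interchange : ∀ a b c d → (a + b) + (c + d) ≡ (a + c) + (b + d)
interchange = solve-∀

⋆-⊞ : ∀ g f f' → g ⋆ (f ⊞ f') ≐ (g ⋆ f) ⊞ (g ⋆ f')
⋆-⊞ g f f' x k with desc g (iv x)
... | true  = trans (cong (λ v → f (g ∷ x) k + f' (g ∷ x) k + v) (↑-+ (f x) (f' x) k)) (interchange (f (g ∷ x) k) (f' (g ∷ x) k) (↑ (f x) k) (↑ (f' x) k))
... | false = trans (cong (λ v → v + (f x k + f' x k)) (↑-+ (f (g ∷ x)) (f' (g ∷ x)) k)) (interchange (↑ (f (g ∷ x)) k) (↑ (f' (g ∷ x)) k) (f x k) (f' x k))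

⋆-· : ∀ g c f → g ⋆ (c · f) ≐ c · (g ⋆ f)
⋆-· g c f x k with desc g (iv x)
... | true  = trans (cong (λ v → c * f (g ∷ x) k + v) (↑-* c (f x) k)) (sym (ℤP.*-distribˡ-+ c (f (g ∷ x) k) (↑ (f x) k)))
... | false = trans (cong (λ v → v + c * f x k) (↑-* c (f (g ∷ x)) k)) (sym (ℤP.*-distribˡ-+ c (↑ (f (g ∷ x)) k) (f x k)))

⋆-q^ : ∀ g i f → g ⋆ q^ i f ≐ q^ i (g ⋆ f)
⋆-q^ g zero f x k = refl
⋆-q^ g (suc i) f x k = trans (one (q^ i f) x k) (↑-cong (⋆-q^ g i f x) k)
  where
  one : ∀ f x k → (g ⋆ q^ 1 f) x k ≡ q^ 1 (g ⋆ f) x k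
  one f x k with desc g (iv x)
  one f x zero | true = refl
  one f x zero | false = refl
  one f x (suc k) | true = refl
  one f x (suc k) | false = refl

⋆-𝟘 : ∀ g {f} → f ≐ 𝟘 → g ⋆ f ≐ 𝟘
⋆-𝟘 g {f} e x k = ⋆-zero g f x k (e x) (e (g ∷ x))

-- c (q^i + q^j) C v; such an element is fixed by the bar involution up to the factor q^(i + j + ℓ v).
Sym : Set
Sym = ℤ × ℕ × ℕ × Word

symC : ℕ → ℕ → Word → Fun
symC i j v x k = ↑^ i (C v x) k + ↑^ j (C v x) k

⟪_⟫ : List Sym → Fun
⟪ [] ⟫ x k = + 0
⟪ (c , i , j , v) ∷ ts ⟫ x k = c * symC i j v x k + ⟪ ts ⟫ x k

Weight : ℕ → ℕ → Sym → Set
Weight n N (c , i , j , v) = i ℕ.+ j ℕ.+ ℓw v ≡ n × ℓw v ≤ N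

Span : ℕ → ℕ → Fun → Set
Span n N f = ∃ λ ts → All (Weight n N) ts × f ≐ ⟪ ts ⟫

span-ext : ∀ {n N f f'} → f' ≐ f → Span n N f → Span n N f'
span-ext e (ts , w , h) = ts , w , ≐-trans e h

span-𝟘 : ∀ {n N f} → f ≐ 𝟘 → Span n N f
span-𝟘 e = [] , [] , e

⟪⟫-++ : ∀ ts us → ⟪ ts ++ us ⟫ ≐ ⟪ ts ⟫ ⊞ ⟪ us ⟫
⟪⟫-++ [] us x k = sym (ℤP.+-identityˡ _)
⟪⟫-++ ((c , i , j , v) ∷ ts) us x k = trans (cong (λ z → c * symC i j v x k + z) (⟪⟫-++ ts us x k))
  (sym (ℤP.+-assoc (c * symC i j v x k) (⟪ ts ⟫ x k) (⟪ us ⟫ x k)))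

span-⊞ : ∀ {n N f f'} → Span n N f → Span n N f' → Span n N (f ⊞ f')
span-⊞ (ts , w , h) (us , w' , h') = ts ++ us , ++⁺ w w' ,
  λ x k → trans (cong₂ _+_ (h x k) (h' x k)) (sym (⟪⟫-++ ts us x k))

scaleS : ℤ → List Sym → List Sym
scaleS c [] = []
scaleS c ((d , r) ∷ ts) = (c * d , r) ∷ scaleS c ts

⟪⟫-scale : ∀ c ts → ⟪ scaleS c ts ⟫ ≐ c · ⟪ ts ⟫
⟪⟫-scale c [] x k = sym (ℤP.*-zeroʳ c)
⟪⟫-scale c ((d , i , j , v) ∷ ts) x k = trans (cong₂ _+_ (ℤP.*-assoc c d (symC i j v x k)) (⟪⟫-scale c ts x k))
  (sym (ℤP.*-distribˡ-+ c (d * symC i j v x k) (⟪ ts ⟫ x k)))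

scaleS-weight : ∀ {n N} c ts → All (Weight n N) ts → All (Weight n N) (scaleS c ts)
scaleS-weight c [] [] = []
scaleS-weight c (t ∷ ts) (w ∷ ws) = w ∷ scaleS-weight c ts ws

span-· : ∀ {n N f} c → Span n N f → Span n N (c · f)
span-· c (ts , w , h) = scaleS c ts , scaleS-weight c ts w ,
  λ x k → trans (cong (λ z → c * z) (h x k)) (sym (⟪⟫-scale c ts x k))

span-⊟ : ∀ {n N f f'} → Span n N f → Span n N f' → Span n N (f ⊟ f')
span-⊟ {f = f} {f'} S S' = span-ext (λ x k → cong (λ z → f x k + z) (sym (ℤP.-1*i≡-i (f' x k)))) (span-⊞ S (span-· (- + 1) S'))

span-sym : ∀ {n N} i j v → i ℕ.+ j ℕ.+ ℓw v ≡ n → ℓw v ≤ N → Span n N (symC i j v)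
span-sym i j v e l = (+ 1 , i , j , v) ∷ [] , (e , l) ∷ [] ,
  λ x k → sym (trans (ℤP.+-identityʳ _) (ℤP.*-identityˡ _))

span-mono : ∀ {n N N' f} → N ≤ N' → Span n N f → Span n N' f
span-mono l (ts , w , h) = ts , All.map (λ { (e , b) → e , ℕP.≤-trans b l }) w , h

-- The Cauchy product; it lets all summands with the same v be gathered into one polynomial times
-- `C v`.
conv : Seq → Seq → Seq
conv p h zero    = p 0 * h 0
conv p h (suc k) = p 0 * h (suc k) + conv (p ∘ suc) h k

conv-cong : ∀ {p p' : Seq} h → (∀ k → p k ≡ p' k) → ∀ k → conv p h k ≡ conv p' h k
conv-cong h e zero = cong (λ v → v * h 0) (e 0)
conv-cong h e (suc k) = cong₂ (λ u v → u * h (suc k) + v) (e 0) (conv-cong h (e ∘ suc) k)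

conv-zero : ∀ {p : Seq} h → (∀ k → p k ≡ + 0) → ∀ k → conv p h k ≡ + 0
conv-zero h e zero = cong (λ v → v * h 0) (e 0)
conv-zero h e (suc k) = cong₂ (λ u v → u * h (suc k) + v) (e 0) (conv-zero h (e ∘ suc) k)

conv-+ : ∀ (p p' : Seq) h k → conv (λ j → p j + p' j) h k ≡ conv p h k + conv p' h k
conv-+ p p' h zero = ℤP.*-distribʳ-+ (h 0) (p 0) (p' 0)
conv-+ p p' h (suc k) = trans (cong₂ _+_ (ℤP.*-distribʳ-+ (h (suc k)) (p 0) (p' 0)) (conv-+ (p ∘ suc) (p' ∘ suc) h k))
  (interchange (p 0 * h (suc k)) (p' 0 * h (suc k)) (conv (p ∘ suc) h k) (conv (p' ∘ suc) h k))

conv-* : ∀ c (p : Seq) h k → conv (λ j → c * p j) h k ≡ c * conv p h k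
conv-* c p h zero = ℤP.*-assoc c (p 0) (h 0)
conv-* c p h (suc k) = trans (cong₂ _+_ (ℤP.*-assoc c (p 0) (h (suc k))) (conv-* c (p ∘ suc) h k))
  (sym (ℤP.*-distribˡ-+ c (p 0 * h (suc k)) (conv (p ∘ suc) h k)))

one : Seq
one = coeff (+ 1 ∷ [])

conv-one : ∀ i h k → conv (↑^ i one) h k ≡ ↑^ i h k
conv-one zero h zero = ℤP.*-identityˡ (h 0)
conv-one zero h (suc k) = trans (cong₂ _+_ (ℤP.*-identityˡ (h (suc k))) (conv-zero h (λ _ → refl) k)) (ℤP.+-identityʳ (h (suc k)))
conv-one (suc i) h zero = refl
conv-one (suc i) h (suc k) = trans (ℤP.+-identityˡ (conv (↑^ i one) h k)) (conv-one i h k)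

symSeq : ℕ → ℕ → Seq
symSeq i j k = ↑^ i one k + ↑^ j one k

polyOf : List Sym → Seq
polyOf [] k = + 0
polyOf ((c , i , j , v) ∷ ts) k = c * symSeq i j k + polyOf ts k

⟪⟫-conv : ∀ x ts → All (λ t → proj₂ (proj₂ (proj₂ t)) ∼ x) ts → ∀ y k → ⟪ ts ⟫ y k ≡ conv (polyOf ts) (C x y) k
⟪⟫-conv x [] [] y k = sym (conv-zero (C x y) (λ _ → refl) k)
⟪⟫-conv x ((c , i , j , v) ∷ ts) (e ∷ es) y k = sym (trans
  (conv-+ (λ m → c * symSeq i j m) (polyOf ts) (C x y) k)
  (cong₂ _+_ (trans (conv-* c (symSeq i j) (C x y) k) (cong (λ z → c * z)
      (trans (conv-+ (↑^ i one) (↑^ j one) (C x y) k) (cong₂ _+_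
        (trans (conv-one i (C x y) k) (cong (λ F → ↑^ i (F y) k) (sym (C-cong {v} {x} e))))
        (trans (conv-one j (C x y) k) (cong (λ F → ↑^ j (F y) k) (sym (C-cong {v} {x} e))))))))
    (sym (⟪⟫-conv x ts es y k))))

↑^-one-self : ∀ i → ↑^ i one i ≡ + 1
↑^-one-self zero = refl
↑^-one-self (suc i) = ↑^-one-self i

↑^-one-other : ∀ i k → ¬ k ≡ i → ↑^ i one k ≡ + 0
↑^-one-other zero zero ne = ⊥-elim (ne refl)
↑^-one-other zero (suc k) ne = refl
↑^-one-other (suc i) zero ne = refl
↑^-one-other (suc i) (suc k) ne = ↑^-one-other i k (ne ∘ cong suc)

↑^-one-flip : ∀ i j m m' → i ℕ.+ j ≡ m ℕ.+ m' → ↑^ i one m ≡ ↑^ j one m'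
↑^-one-flip i j m m' e with m ℕ.≟ i
... | yes refl = trans (↑^-one-self i) (sym (trans (cong (↑^ j one) (sym (ℕP.+-cancelˡ-≡ i j m' e))) (↑^-one-self j)))
... | no ne = trans (↑^-one-other i m ne) (sym (↑^-one-other j m' λ { refl → ne (sym (ℕP.+-cancelʳ-≡ m' i m e)) }))

polyOf-flip : ∀ d ts → All (λ { (c , i , j , v) → i ℕ.+ j ≡ d }) ts → ∀ m m' → m ℕ.+ m' ≡ d → polyOf ts m ≡ polyOf ts m'
polyOf-flip d [] [] m m' e = refl
polyOf-flip d ((c , i , j , v) ∷ ts) (w ∷ ws) m m' e = cong₂ (λ a b → c * a + b)
  (trans (cong₂ _+_ (↑^-one-flip i j m m' (trans w (sym e))) (↑^-one-flip j i m m' (trans (ℕP.+-comm j i) (trans w (sym e)))))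
         (ℤP.+-comm (↑^ j one m') (↑^ i one m')))
  (polyOf-flip d ts ws m m' e)

wordOf : Sym → Word
wordOf (c , i , j , v) = v

same other : Word → List Sym → List Sym
same x [] = []
same x (t ∷ ts) with wordOf t ∼? x
... | yes _ = t ∷ same x ts
... | no _  = same x ts
other x [] = []
other x (t ∷ ts) with wordOf t ∼? x
... | yes _ = other x ts
... | no _  = t ∷ other x ts

same-other : ∀ x ts → ⟪ ts ⟫ ≐ ⟪ same x ts ⟫ ⊞ ⟪ other x ts ⟫
same-other x [] y k = refl
same-other x (t@(c , i , j , v) ∷ ts) y k with v ∼? x
... | yes _ = trans (cong (λ z → c * symC i j v y k + z) (same-other x ts y k)) (sym (ℤP.+-assoc (c * symC i j v y k) _ _))
... | no _  = trans (cong (λ z → c * symC i j v y k + z) (same-other x ts y k))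
                    (lemma (c * symC i j v y k) (⟪ same x ts ⟫ y k) (⟪ other x ts ⟫ y k))
  where
  lemma : ∀ a b c → a + (b + c) ≡ b + (a + c)
  lemma = solve-∀

same-All : ∀ {P : Sym → Set} x ts → All P ts → All (λ t → P t × wordOf t ∼ x) (same x ts)
same-All x [] [] = []
same-All x (t ∷ ts) (p ∷ ps) with wordOf t ∼? x
... | yes q = (p , q) ∷ same-All x ts ps
... | no _  = same-All x ts ps

other-All : ∀ {P : Sym → Set} x ts → All P ts → All (λ t → P t × ¬ wordOf t ∼ x) (other x ts)
other-All x [] [] = []
other-All x (t ∷ ts) (p ∷ ps) with wordOf t ∼? x
... | yes _ = other-All x ts ps
... | no q  = (p , q) ∷ other-All x ts ps

other-length : ∀ x ts → length (other x ts) ≤ length ts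
other-length x [] = z≤n
other-length x (t ∷ ts) with wordOf t ∼? x
... | yes _ = ℕP.≤-trans (other-length x ts) (ℕP.n≤1+n _)
... | no _  = s≤s (other-length x ts)

other-shorter : ∀ {t} ts → t ∈ ts → length (other (wordOf t) ts) < length ts
other-shorter {t} (u ∷ ts) i with wordOf u ∼? wordOf t
... | yes _ = s≤s (other-length (wordOf t) ts)
other-shorter {t} (u ∷ ts) (here refl) | no q = ⊥-elim (q refl)
other-shorter {t} (u ∷ ts) (there i) | no q = s≤s (other-shorter ts i)

longest : ∀ t ts → ∃ λ u → u ∈ t ∷ ts × All (λ t → ℓw (wordOf t) ≤ ℓw (wordOf u)) (t ∷ ts)
longest t [] = t , here refl , ℕP.≤-refl ∷ []
longest t (t' ∷ ts) with longest t' ts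
... | u , u∈ , m with ℓw (wordOf t) ℕ.≤? ℓw (wordOf u)
...   | yes p = u , there u∈ , p ∷ m
...   | no np = t , here refl , ℕP.≤-refl ∷ All.map (λ q → ℕP.≤-trans q (ℕP.<⇒≤ (ℕP.≰⇒> np))) m

-- If x is at least as long as v but different from it, the degree bound already excludes the
-- constant term.
C-above : ∀ v x k → ¬ v ∼ x → ℓw v ≤ ℓw x → C v x k ≡ + 0
C-above v x k ne l = bounded (C-normalized v) x k (λ q → ne (sym (trans q (redWord-∼ v))))
  (ℕP.≤-trans (ℕP.≤-reflexive (redWord-length v)) (ℕP.≤-trans l (ℕP.m≤n+m (ℓw x) (k ℕ.+ k))))

⟪⟫-above : ∀ x ts → All (λ t → ℓw (wordOf t) ≤ ℓw x × ¬ wordOf t ∼ x) ts → ∀ k → ⟪ ts ⟫ x k ≡ + 0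
⟪⟫-above x [] [] k = refl
⟪⟫-above x ((c , i , j , v) ∷ ts) ((l , ne) ∷ ps) k = cong₂ _+_
  (trans (cong (λ z → c * z) (cong₂ _+_ (↑^-zero i (λ k → C-above v x k ne l) k) (↑^-zero j (λ k → C-above v x k ne l) k))) (ℤP.*-zeroʳ c))
  (⟪⟫-above x ts ps k)

conv-oneʳ : ∀ (p : Seq) k → conv p one k ≡ p k
conv-oneʳ p zero = ℤP.*-identityʳ (p 0)
conv-oneʳ p (suc k) = trans (cong₂ _+_ (ℤP.*-zeroʳ (p 0)) (conv-oneʳ (p ∘ suc) k)) (ℤP.+-identityˡ (p (suc k)))

conv-congʳ : ∀ (p : Seq) {h h' : Seq} → (∀ k → h k ≡ h' k) → ∀ k → conv p h k ≡ conv p h' k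
conv-congʳ p e zero = cong (λ z → p 0 * z) (e 0)
conv-congʳ p e (suc k) = cong₂ (λ u v → p 0 * u + v) (e (suc k)) (conv-congʳ (p ∘ suc) e k)

Strict : ℕ → Fun → Set
Strict n f = ∀ x k → n ≤ k ℕ.+ k ℕ.+ ℓw x → f x k ≡ + 0

-- At a longest word x the coefficient is symmetric about (n - ℓ x) / 2 and of smaller degree.
strict-vanishes : ∀ s n f ts → length ts ≤ s → All (λ { (c , i , j , v) → i ℕ.+ j ℕ.+ ℓw v ≡ n }) ts →
  f ≐ ⟪ ts ⟫ → Strict n f → f ≐ 𝟘
strict-vanishes s n f [] _ _ e _ = e
strict-vanishes (suc s) n f (t₀ ∷ ts₀) l ws e st with longest t₀ ts₀
... | u@(c , i , j , x) , u∈ , mx = strict-vanishes s n f (other x ts) (ℕ.s≤s⁻¹ (ℕP.≤-trans (other-shorter ts u∈) l))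
        (All.map proj₁ (other-All x ts ws)) e' st
  where
  ts = t₀ ∷ ts₀
  d = i ℕ.+ j
  d≡ : d ℕ.+ ℓw x ≡ n
  d≡ = All.lookup ws u∈
  ws' : All (λ { (c , i , j , v) → i ℕ.+ j ≡ d }) (same x ts)
  ws' = All.map (λ { {_ , i' , j' , _} (w , q) → ℕP.+-cancelʳ-≡ (ℓw x) (i' ℕ.+ j') d (trans (trans (cong (λ p → i' ℕ.+ j' ℕ.+ ℓ p) (sym q)) w) (sym d≡)) }) (same-All x ts ws)
  sim : All (λ t → wordOf t ∼ x) (same x ts)
  sim = All.map proj₂ (same-All x ts ws)
  P = polyOf (same x ts)
  atx : ∀ k → f x k ≡ P k
  atx k = trans (e x k) (trans (same-other x ts x k) (trans (cong₂ _+_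
      (trans (⟪⟫-conv x (same x ts) sim x k) (trans (conv-congʳ P (λ k → atTop (C-normalized x) x k (sym (redWord-∼ x))) k) (conv-oneʳ P k)))
      (⟪⟫-above x (other x ts) (other-All x ts mx) k)) (ℤP.+-identityʳ (P k))))
  high : ∀ k → d ≤ k ℕ.+ k → P k ≡ + 0
  high k b = trans (sym (atx k)) (st x k (subst (_≤ k ℕ.+ k ℕ.+ ℓw x) d≡ (ℕP.+-monoˡ-≤ (ℓw x) b)))
  P≡0 : ∀ k → P k ≡ + 0
  P≡0 k with d ℕ.≤? k ℕ.+ k
  ... | yes p = high k p
  ... | no np = trans (polyOf-flip d (same x ts) ws' k (d ∸ k) k+) (high (d ∸ k) big)
    where
    k≤d : k ≤ d
    k≤d = ℕP.≤-trans (ℕP.m≤m+n k k) (ℕP.<⇒≤ (ℕP.≰⇒> np))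
    k+ : k ℕ.+ (d ∸ k) ≡ d
    k+ = ℕP.m+[n∸m]≡n k≤d
    big : d ≤ (d ∸ k) ℕ.+ (d ∸ k)
    big = subst (_≤ (d ∸ k) ℕ.+ (d ∸ k)) k+ (ℕP.+-monoˡ-≤ (d ∸ k) (ℕP.+-cancelˡ-≤ k k (d ∸ k) (ℕP.≤-trans (ℕP.<⇒≤ (ℕP.≰⇒> np)) (ℕP.≤-reflexive (sym k+)))))
  e' : f ≐ ⟪ other x ts ⟫
  e' y k = trans (e y k) (trans (same-other x ts y k) (trans (cong (λ z → z + ⟪ other x ts ⟫ y k)
    (trans (⟪⟫-conv x (same x ts) sim y k) (conv-zero (C x y) P≡0 k))) (ℤP.+-identityˡ _)))

span-strict : ∀ {n N f} → Span n N f → Strict n f → f ≐ 𝟘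
span-strict {n} {f = f} (ts , w , e) st = strict-vanishes (length ts) n f ts ℕP.≤-refl (All.map proj₁ w) e st

-- Independence of the reduced word

-- Twice f is a combination of the symmetric elements; the factor 2 accounts for the middle terms q^i + q^i.
record Inv (n N : ℕ) (f : Fun) : Set where
  constructor inv
  field
    twice : Span n N (f ⊞ f)

inv-ext : ∀ {n N f f'} → f' ≐ f → Inv n N f → Inv n N f'
inv-ext e (inv S) = inv (span-ext (λ x k → cong₂ _+_ (e x k) (e x k)) S)

inv-𝟘 : ∀ {n N f} → f ≐ 𝟘 → Inv n N f
inv-𝟘 e = inv (span-𝟘 (λ x k → cong₂ _+_ (e x k) (e x k)))

inv-⊞ : ∀ {n N f f'} → Inv n N f → Inv n N f' → Inv n N (f ⊞ f')
inv-⊞ {f = f} {f'} (inv S) (inv S') = inv (span-ext (λ x k → interchange (f x k) (f' x k) (f x k) (f' x k)) (span-⊞ S S'))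

inv-⊟ : ∀ {n N f f'} → Inv n N f → Inv n N f' → Inv n N (f ⊟ f')
inv-⊟ {f = f} {f'} (inv S) (inv S') = inv (span-ext (λ x k → lemma (f x k) (f' x k)) (span-⊟ S S'))
  where
  lemma : ∀ a b → (a - b) + (a - b) ≡ (a + a) - (b + b)
  lemma = solve-∀

inv-· : ∀ {n N f} c → Inv n N f → Inv n N (c · f)
inv-· {f = f} c (inv S) = inv (span-ext (λ x k → sym (ℤP.*-distribˡ-+ c (f x k) (f x k))) (span-· c S))

inv-C : ∀ {n N} i v → i ℕ.+ i ℕ.+ ℓw v ≡ n → ℓw v ≤ N → Inv n N (q^ i (C v))
inv-C i v e l = inv (span-sym i i v e l)

inv-mono : ∀ {n N N' f} → N ≤ N' → Inv n N f → Inv n N' f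
inv-mono l (inv S) = inv (span-mono l S)

inv-strict : ∀ {n N f} → Inv n N f → Strict n f → f ≐ 𝟘
inv-strict {f = f} (inv S) st x k = halve (f x k) (span-strict S (λ y j b → cong₂ _+_ (st y j b) (st y j b)) x k)
  where
  halve : ∀ i → i + i ≡ + 0 → i ≡ + 0
  halve (+ zero) _ = refl
  halve -[1+ n ] ()

double : ∀ m → m % 2 ≡ 1 → suc m / 2 ℕ.+ suc m / 2 ≡ suc m
double m e = subst (λ n → suc n / 2 ℕ.+ suc n / 2 ≡ suc n) (sym m≡) (trans (cong₂ ℕ._+_ h h) (cong suc (ℕP.+-suc k k)))
  where
  k = m / 2
  lemma : ∀ k → 1 ℕ.+ k ℕ.* 2 ≡ suc (k ℕ.+ k)
  lemma = solveℕ-∀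
  m≡ : m ≡ suc (k ℕ.+ k)
  m≡ = trans (DM.m≡m%n+[m/n]*n m 2) (trans (cong (λ r → r ℕ.+ k ℕ.* 2) e) (lemma k))
  h : suc (suc (k ℕ.+ k)) / 2 ≡ suc k
  h = trans (cong (λ j → suc j / 2) (sym (ℕP.+-suc k k))) (double-half (suc k))

-- `muOf` is 0 at even length differences. At odd ones the halving in `ex` is exact, so the
-- correction q^e C_z has just the weight required by the span.
mu-parity : ∀ a z → ℓw z ≤ length a → mu a z ≡ + 0 ⊎ ex a z ℕ.+ ex a z ℕ.+ ℓw z ≡ suc (length a)
mu-parity a z l with (length a ∸ ℓw z) % 2 in e
... | 0 = inj₁ refl
... | suc (suc _) = inj₁ refl
... | 1 = inj₂ (trans (cong (λ m → m / 2 ℕ.+ m / 2 ℕ.+ ℓw z) (ℕP.+-∸-assoc 1 l))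
            (trans (cong (ℕ._+ ℓw z) (double (length a ∸ ℓw z) e)) (cong suc (ℕP.m∸n+n≡m l))))

inv-sumOver : ∀ {n N} (h : Word → Fun) zs → (∀ z → z ∈ zs → Inv n N (h z)) → Inv n N (λ x k → sumOver (λ z → h z x k) zs)
inv-sumOver h [] H = inv-𝟘 λ _ _ → refl
inv-sumOver h (z ∷ zs) H = inv-⊞ (H z (here refl)) (inv-sumOver h zs (λ y → H y ∘ there))

inv-lowerSum : ∀ g a → Inv (suc (length a)) (pred (length a)) (lowerSum g a)
inv-lowerSum g a = inv-sumOver (λ z x k → mu a z * ↑^ (ex a z) (C z x) k) (lower g a) λ z z∈ → term z z∈
  where
  term : ∀ z → z ∈ lower g a → Inv (suc (length a)) (pred (length a)) (mu a z · q^ (ex a z) (C z))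
  term z z∈ with mu-parity a z (InD-length a z (proj₁ (lower-∈ g a z∈)))
  ... | inj₁ e = inv-𝟘 (λ x k → cong (λ m → m * ↑^ (ex a z) (C z x) k) e)
  ... | inj₂ e = inv-· (mu a z) (inv-C (ex a z) z e (ℕP.<⇒≤pred (subst (_< length a) (redWord-length z) (lower-length g a z∈))))

Indep : ℕ → Set
Indep N = ∀ a → length a ≤ N → Red a → K a ≐ C a

-- Multiplication by C_g on the span, given independence up to length N

module Below (N : ℕ) (indep : Indep N) where

  step-asc : ∀ g v → ℓw v < N → desc g (iv v) ≡ false → g ⋆ C v ≐ C (g ∷ v) ⊞ lowerSum g (redWord v)
  step-asc g v l d x k = trans (recover (K-cons g b x k)) (cong (λ z → z + lowerSum g b x k) K≡C)
    where
    b = redWord v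
    rb : Red (g ∷ b)
    rb = red-cons g b (redWord-red v) (trans (cong (desc g) (redWord-∼ v)) d)
    K≡C : K (g ∷ b) x k ≡ C (g ∷ v) x k
    K≡C = trans (indep (g ∷ b) (subst (_< N) (sym (redWord-length v)) l) rb x k)
      (cong (λ F → F x k) (C-cong {g ∷ b} {g ∷ v} (cong (λ p → act p g) (redWord-∼ v))))
    recover : ∀ {i j m} → i ≡ j - m → j ≡ i + m
    recover {i} {j} {m} refl = sym (trans (ℤP.+-assoc j (- m) m) (trans (cong (λ z → j + z) (ℤP.+-inverseˡ m)) (ℤP.+-identityʳ j)))

  -- Replacing x by g x interchanges the two cases of `_⋆_` together with their two arguments.
  ⋆-fixed : ∀ g f → Invariant f → ∀ x k → (g ⋆ f) (g ∷ x) k ≡ (g ⋆ f) x k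
  ⋆-fixed g f rsp x k rewrite desc-act g (valid-iv x) with desc g (iv x)
  ... | true  = trans (cong (λ z → ↑ (f (g ∷ g ∷ x)) k + z) refl) (trans (cong (λ z → z + f (g ∷ x) k) (↑-cong (λ j → rsp {g ∷ g ∷ x} {x} (act-involutive (iv x) g) j) k)) (ℤP.+-comm (↑ (f x) k) (f (g ∷ x) k)))
  ... | false = trans (cong (λ z → z + ↑ (f (g ∷ x)) k) (rsp {g ∷ g ∷ x} {x} (act-involutive (iv x) g) k)) (ℤP.+-comm (f x k) (↑ (f (g ∷ x)) k))

  -- Independence permits a reduced word of v that begins with g. Then C_v is a multiple of C_g
  -- minus terms C_z with gz < z, which are fixed by induction.
  C-fixed : ∀ M g v → ℓw v ≤ M → M ≤ N → desc g (iv v) ≡ true → ∀ x k → C v (g ∷ x) k ≡ C v x k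
  C-fixed zero g v l _ d x k with () ← ℕP.≤-trans (ℕP.≤-reflexive (sym (ℓ-desc g (valid-iv v) d))) l
  C-fixed (suc M) g v l m d x k = trans (v≡ (g ∷ x)) (trans (trans (K-cons g b (g ∷ x) k) (trans (cong₂ _-_
      (⋆-fixed g (K b) (K-invariant b) x k)
      (sumOver-cong (lower g b) λ z z∈ → cong (λ u → mu b z * u) (↑^-cong (ex b z)
        (λ j → C-fixed M g z (ℕP.≤-trans (ℕP.≤-reflexive (sym (redWord-length z))) (ℕP.≤-trans (ℕP.<⇒≤ (lower-length g b z∈)) lb))
                 (ℕP.<⇒≤ m) (proj₂ (proj₂ (lower-∈ g b z∈))) x j) k)))
      (sym (K-cons g b x k)))) (sym (v≡ x)))
    where
    b = redWord (g ∷ v)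
    lb : length b ≤ M
    lb = ℕ.s≤s⁻¹ (ℕP.≤-trans (ℕP.≤-reflexive (trans (cong suc (redWord-length (g ∷ v))) (sym (ℓ-desc g (valid-iv v) d)))) l)
    gb∼v : (g ∷ b) ∼ v
    gb∼v = trans (cong (λ p → act p g) (redWord-∼ (g ∷ v))) (act-involutive (iv v) g)
    rb : Red (g ∷ b)
    rb = trans (cong ℓ gb∼v) (trans (ℓ-desc g (valid-iv v) d) (cong suc (sym (redWord-length (g ∷ v)))))
    v≡ : ∀ x → C v x k ≡ K (g ∷ b) x k
    v≡ x = trans (cong (λ F → F x k) (C-cong {v} {g ∷ b} (sym gb∼v))) (sym (indep (g ∷ b) (ℕP.≤-trans (s≤s lb) m) rb x k))

  step-desc : ∀ g v → ℓw v ≤ N → desc g (iv v) ≡ true → g ⋆ C v ≐ C v ⊞ q^ 1 (C v)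
  step-desc g v l d x k with desc g (iv x)
  ... | true  = cong (λ z → z + ↑ (C v x) k) (C-fixed N g v l ℕP.≤-refl d x k)
  ... | false = trans (cong (λ z → z + C v x k) (↑-cong (C-fixed N g v l ℕP.≤-refl d x) k)) (ℤP.+-comm (↑ (C v x) k) (C v x k))

  -- If gv < v, the identity (q^i + q^j)(1 + q) = (q^i + q^{j+1}) + (q^{i+1} + q^j) restores
  -- symmetric pairs. If gv > v, the exponent of each correction is added to both i and j, and
  -- `mu-parity` gives the right weight.
  star-sym : ∀ g i j v M → ℓw v ≤ M → M < N → Span (suc (i ℕ.+ j ℕ.+ ℓw v)) (suc M) (g ⋆ symC i j v)
  star-sym g i j v M l m with desc g (iv v) in d
  ... | true = span-ext e (span-⊞ (span-sym i (suc j) v (cong (ℕ._+ ℓw v) (ℕP.+-suc i j)) (ℕP.≤-trans l (ℕP.n≤1+n M)))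
                                  (span-sym (suc i) j v refl (ℕP.≤-trans l (ℕP.n≤1+n M))))
    where
    e : g ⋆ symC i j v ≐ symC i (suc j) v ⊞ symC (suc i) j v
    e x k = trans (⋆-⊞ g (q^ i (C v)) (q^ j (C v)) x k) (trans (cong₂ _+_ (part i) (part j))
        (lemma (↑^ i (C v x) k) (↑^ (suc i) (C v x) k) (↑^ j (C v x) k) (↑^ (suc j) (C v x) k)))
      where
      part : ∀ i → (g ⋆ q^ i (C v)) x k ≡ ↑^ i (C v x) k + ↑^ (suc i) (C v x) k
      part i = trans (⋆-q^ g i (C v) x k) (trans (↑^-cong i (step-desc g v (ℕP.≤-trans l (ℕP.<⇒≤ m)) d x) k)
        (trans (↑^-+ i (C v x) (↑ (C v x)) k) (cong (λ z → ↑^ i (C v x) k + z) (↑^-↑ i (C v x) k))))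
      lemma : ∀ a b c d → (a + b) + (c + d) ≡ (a + d) + (b + c)
      lemma = solve-∀
  ... | false = span-ext e (span-⊞ (span-sym i j (g ∷ v) (trans (cong (i ℕ.+ j ℕ.+_) lgv) (ℕP.+-suc (i ℕ.+ j) (ℓw v)))
                    (ℕP.≤-trans (ℕP.≤-reflexive lgv) (s≤s l)))
                  (rest (lower g b) (λ z z∈ → InD-length b z (proj₁ (lower-∈ g b z∈)))))
    where
    b = redWord v
    lgv : ℓw (g ∷ v) ≡ suc (ℓw v)
    lgv = ℓ-asc g (valid-iv v) d
    S : List Word → Fun
    S zs x k = sumOver (λ z → mu b z * symC (i ℕ.+ ex b z) (j ℕ.+ ex b z) z x k) zs
    rest : ∀ zs → (∀ z → z ∈ zs → ℓw z ≤ length b) → Span (suc (i ℕ.+ j ℕ.+ ℓw v)) (suc M) (S zs)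
    rest [] _ = span-𝟘 λ _ _ → refl
    rest (z ∷ zs) H = span-⊞ (term (mu-parity b z (H z (here refl)))) (rest zs (λ y → H y ∘ there))
      where
      weight : ∀ i j e l → (i ℕ.+ e) ℕ.+ (j ℕ.+ e) ℕ.+ l ≡ i ℕ.+ j ℕ.+ (e ℕ.+ e ℕ.+ l)
      weight = solveℕ-∀
      term : mu b z ≡ + 0 ⊎ ex b z ℕ.+ ex b z ℕ.+ ℓw z ≡ suc (length b) →
        Span (suc (i ℕ.+ j ℕ.+ ℓw v)) (suc M) (mu b z · symC (i ℕ.+ ex b z) (j ℕ.+ ex b z) z)
      term (inj₁ p) = span-𝟘 (λ x k → cong (λ m → m * symC (i ℕ.+ ex b z) (j ℕ.+ ex b z) z x k) p)
      term (inj₂ p) = span-· (mu b z) (span-sym (i ℕ.+ ex b z) (j ℕ.+ ex b z) z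
        (trans (weight i j (ex b z) (ℓw z)) (trans (cong (i ℕ.+ j ℕ.+_) (trans p (cong suc (redWord-length v)))) (ℕP.+-suc (i ℕ.+ j) (ℓw v))))
        (ℕP.≤-trans (H z (here refl)) (ℕP.≤-trans (ℕP.≤-reflexive (redWord-length v)) (ℕP.≤-trans l (ℕP.n≤1+n M)))))
    shiftSum : ∀ i x k zs → ↑^ i (λ k → sumOver (λ z → mu b z * ↑^ (ex b z) (C z x) k) zs) k
      ≡ sumOver (λ z → mu b z * ↑^ (i ℕ.+ ex b z) (C z x) k) zs
    shiftSum i x k [] = ↑^-zero i (λ _ → refl) k
    shiftSum i x k (z ∷ zs) = trans (↑^-+ i (λ k → mu b z * ↑^ (ex b z) (C z x) k) (λ k → sumOver (λ z → mu b z * ↑^ (ex b z) (C z x) k) zs) k)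
      (cong₂ _+_ (trans (↑^-* i (mu b z) (↑^ (ex b z) (C z x)) k) (cong (λ u → mu b z * u) (↑^-↑^ i (ex b z) (C z x) k))) (shiftSum i x k zs))
    merge : ∀ x k zs → sumOver (λ z → mu b z * ↑^ (i ℕ.+ ex b z) (C z x) k) zs + sumOver (λ z → mu b z * ↑^ (j ℕ.+ ex b z) (C z x) k) zs ≡ S zs x k
    merge x k [] = refl
    merge x k (z ∷ zs) = trans (interchange (mu b z * ↑^ (i ℕ.+ ex b z) (C z x) k) _ (mu b z * ↑^ (j ℕ.+ ex b z) (C z x) k) _)
      (cong₂ _+_ (sym (ℤP.*-distribˡ-+ (mu b z) (↑^ (i ℕ.+ ex b z) (C z x) k) (↑^ (j ℕ.+ ex b z) (C z x) k))) (merge x k zs))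
    e : g ⋆ symC i j v ≐ symC i j (g ∷ v) ⊞ S (lower g b)
    e x k = trans (⋆-⊞ g (q^ i (C v)) (q^ j (C v)) x k) (trans (cong₂ _+_ (part i) (part j))
        (trans (interchange (↑^ i (C (g ∷ v) x) k) _ (↑^ j (C (g ∷ v) x) k) _) (cong (λ z → symC i j (g ∷ v) x k + z) (merge x k (lower g b)))))
      where
      part : ∀ i → (g ⋆ q^ i (C v)) x k ≡ ↑^ i (C (g ∷ v) x) k + sumOver (λ z → mu b z * ↑^ (i ℕ.+ ex b z) (C z x) k) (lower g b)
      part i = trans (⋆-q^ g i (C v) x k) (trans (↑^-cong i (step-asc g v (ℕP.≤-trans (s≤s l) m) d x) k)
        (trans (↑^-+ i (C (g ∷ v) x) (lowerSum g b x) k) (cong (λ z → ↑^ i (C (g ∷ v) x) k + z) (shiftSum i x k (lower g b)))))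

  star-list : ∀ g n M ts → All (Weight n M) ts → M < N → Span (suc n) (suc M) (g ⋆ ⟪ ts ⟫)
  star-list g n M [] [] m = span-𝟘 (⋆-𝟘 g λ _ _ → refl)
  star-list g n M ((c , i , j , v) ∷ ts) ((refl , l) ∷ ws) m = span-ext
    (λ x k → trans (⋆-⊞ g (c · symC i j v) ⟪ ts ⟫ x k) (cong (λ z → z + (g ⋆ ⟪ ts ⟫) x k) (⋆-· g c (symC i j v) x k)))
    (span-⊞ (span-· c (star-sym g i j v M l m)) (star-list g n M ts ws m))

  span-⋆ : ∀ g {n M f} → M < N → Span n M f → Span (suc n) (suc M) (g ⋆ f)
  span-⋆ g {n} {M} m (ts , w , e) = span-ext (⋆-cong g e) (star-list g n M ts w m)

  inv-⋆ : ∀ g {n M f} → M < N → Inv n M f → Inv (suc n) (suc M) (g ⋆ f)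
  inv-⋆ g {f = f} m (inv S) = inv (span-ext (≐-sym (⋆-⊞ g f f)) (span-⋆ g m S))

-- The braid relation between C_g and C_h

ST : Bool → Seq → Seq → Seq
ST d U V i = if d then V i + U (suc i) else V (suc i) + U i

-- V j i stands for q^i f evaluated at the j-th of the elements x, g x, h x, g h x, h g x, g h g x = h g h x.
braid-cases : ∀ a b c (V : ℕ → Seq) → (a ≡ true → b ≡ true → c ≡ true) → (a ≡ false → b ≡ false → c ≡ false) →
  ST a (ST b (ST a (V 0) (V 1)) (ST c (V 2) (V 3))) (ST c (ST (not a) (V 1) (V 0)) (ST b (V 4) (V 5))) 0 - ST a (V 0) (V 1) 1
  ≡ ST b (ST a (ST b (V 0) (V 2)) (ST c (V 1) (V 4))) (ST c (ST (not b) (V 2) (V 0)) (ST a (V 3) (V 5))) 0 - ST b (V 0) (V 2) 1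
braid-cases true  true  true  V hab hab' = lemma (V 0 2) (V 0 3) (V 1 1) (V 1 2) (V 2 1) (V 2 2) (V 3 1) (V 4 1) (V 5 0)
  where
  lemma : ∀ x02 x03 x11 x12 x21 x22 x31 x41 x50 → (((x50 + x41) + (x02 + x11)) + ((x31 + x22) + (x12 + x03))) - (x11 + x02)
    ≡ (((x50 + x31) + (x02 + x21)) + ((x41 + x12) + (x22 + x03))) - (x21 + x02)
  lemma = solve-∀
braid-cases true  false true  V hab hab' = lemma (V 0 1) (V 0 2) (V 1 1) (V 2 2) (V 2 3) (V 3 2) (V 4 0) (V 5 1)
  where
  lemma : ∀ x01 x02 x11 x22 x23 x32 x40 x51 → (((x51 + x40) + (x02 + x11)) + ((x32 + x23) + (x11 + x02))) - (x11 + x02)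
    ≡ (((x51 + x32) + (x02 + x23)) + ((x40 + x11) + (x22 + x01))) - (x22 + x01)
  lemma = solve-∀
braid-cases true  false false V hab hab' = lemma (V 0 1) (V 0 2) (V 1 0) (V 1 1) (V 2 2) (V 3 3) (V 4 1) (V 5 2)
  where
  lemma : ∀ x01 x02 x10 x11 x22 x33 x41 x52 → (((x52 + x41) + (x01 + x10)) + ((x33 + x22) + (x11 + x02))) - (x11 + x02)
    ≡ (((x52 + x33) + (x01 + x22)) + ((x41 + x10) + (x22 + x01))) - (x22 + x01)
  lemma = solve-∀
braid-cases false true  true  V hab hab' = lemma (V 0 1) (V 0 2) (V 1 2) (V 1 3) (V 2 1) (V 3 0) (V 4 2) (V 5 1)
  where
  lemma : ∀ x01 x02 x12 x13 x21 x30 x42 x51 → (((x51 + x42) + (x02 + x13)) + ((x30 + x21) + (x12 + x01))) - (x12 + x01)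
    ≡ (((x51 + x30) + (x02 + x21)) + ((x42 + x13) + (x21 + x02))) - (x21 + x02)
  lemma = solve-∀
braid-cases false true  false V hab hab' = lemma (V 0 1) (V 0 2) (V 1 2) (V 2 0) (V 2 1) (V 3 1) (V 4 3) (V 5 2)
  where
  lemma : ∀ x01 x02 x12 x20 x21 x31 x43 x52 → (((x52 + x43) + (x01 + x12)) + ((x31 + x20) + (x12 + x01))) - (x12 + x01)
    ≡ (((x52 + x31) + (x01 + x20)) + ((x43 + x12) + (x21 + x02))) - (x21 + x02)
  lemma = solve-∀
braid-cases false false false V hab hab' = lemma (V 0 0) (V 0 1) (V 1 1) (V 1 2) (V 2 1) (V 2 2) (V 3 2) (V 4 2) (V 5 3)
  where
  lemma : ∀ x00 x01 x11 x12 x21 x22 x32 x42 x53 → (((x53 + x42) + (x01 + x12)) + ((x32 + x21) + (x11 + x00))) - (x12 + x01)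
    ≡ (((x53 + x32) + (x01 + x22)) + ((x42 + x11) + (x21 + x00))) - (x22 + x01)
  lemma = solve-∀
braid-cases true true false V hab _ with () ← hab refl refl
braid-cases false false true V _ hab with () ← hab refl refl

ST-cong : ∀ d {U U' V V' : Seq} → (∀ i → U i ≡ U' i) → (∀ i → V i ≡ V' i) → ∀ i → ST d U V i ≡ ST d U' V' i
ST-cong true  e e' i = cong₂ _+_ (e' i) (e (suc i))
ST-cong false e e' i = cong₂ _+_ (e' (suc i)) (e i)

-- In `ST d U V` the sequences belong to x and to g x and their index counts factors of q, so the
-- operator can be iterated without leaving the six elements of a dihedral coset.
⋆-ST : ∀ g f x k d → desc g (iv x) ≡ d → ∀ i → ↑^ i ((g ⋆ f) x) k ≡ ST d (λ i → ↑^ i (f x) k) (λ i → ↑^ i (f (g ∷ x)) k) i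
⋆-ST g f x k true e i rewrite e = trans (↑^-+ i (f (g ∷ x)) (↑ (f x)) k) (cong (λ z → ↑^ i (f (g ∷ x)) k + z) (↑^-↑ i (f x) k))
⋆-ST g f x k false e i rewrite e = trans (↑^-+ i (↑ (f (g ∷ x))) (f x) k) (cong (λ z → z + ↑^ i (f x) k) (↑^-↑ i (f (g ∷ x)) k))

isNeg-+-pos : ∀ a b → isNeg a ≡ false → isNeg b ≡ false → isNeg (a + b) ≡ false
isNeg-+-pos (+ _) (+ _) _ _ = refl

values : Fun → Gen → Gen → Word → ℕ → ℕ → Seq
values f g h x k 0 i = ↑^ i (f x) k
values f g h x k 1 i = ↑^ i (f (g ∷ x)) k
values f g h x k 2 i = ↑^ i (f (h ∷ x)) k
values f g h x k 3 i = ↑^ i (f (g ∷ h ∷ x)) k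
values f g h x k 4 i = ↑^ i (f (h ∷ g ∷ x)) k
values f g h x k _ i = ↑^ i (f (g ∷ h ∷ g ∷ x)) k

module _ (f : Fun) (f-inv : Invariant f) where

  private
    fc : ∀ {x y} → x ∼ y → ∀ k i → ↑^ i (f x) k ≡ ↑^ i (f y) k
    fc {x} {y} e k i = ↑^-cong i (f-inv {x} {y} e) k

  -- The third sign c belongs to the sum of the two simple roots: it decides both whether g is a
  -- descent of h x and whether h is one of g x.
  ⋆³-ST : ∀ g h x k → ¬ g ≡ h → let a = desc g (iv x); b = desc h (iv x); c = isNeg (num g (iv x) + num h (iv x)); V = values f g h x k in
    (g ⋆ h ⋆ g ⋆ f) x k ≡ ST a (ST b (ST a (V 0) (V 1)) (ST c (V 2) (V 3))) (ST c (ST (not a) (V 1) (V 0)) (ST b (V 4) (V 5))) 0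
  ⋆³-ST g h x k ne = trans (⋆-ST g (h ⋆ g ⋆ f) x k (desc g (iv x)) refl 0)
    (ST-cong (desc g (iv x))
      (λ i → trans (⋆-ST h (g ⋆ f) x k (desc h (iv x)) refl i)
        (ST-cong (desc h (iv x)) (⋆-ST g f x k _ refl) (⋆-ST g f (h ∷ x) k _ (trans (cong isNeg (num-act-other h g (iv x) (ne ∘ sym))) refl)) i))
      (λ i → trans (⋆-ST h (g ⋆ f) (g ∷ x) k _ (trans (cong isNeg (num-act-other g h (iv x) ne)) (cong isNeg (ℤP.+-comm (num h (iv x)) (num g (iv x))))) i)
        (ST-cong (isNeg (num g (iv x) + num h (iv x)))
          (λ i → trans (⋆-ST g f (g ∷ x) k _ (desc-act g (valid-iv x)) i)
                   (ST-cong (not (desc g (iv x))) {λ i → ↑^ i (f (g ∷ x)) k} {λ i → ↑^ i (f (g ∷ x)) k} (λ _ → refl) (λ i → fc {g ∷ g ∷ x} {x} (act-involutive (iv x) g) k i) i))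
          (⋆-ST g f (h ∷ g ∷ x) k _ (cong isNeg back)) i)) 0)
    where
    lemma : ∀ a b → - a + (b + a) ≡ b
    lemma = solve-∀
    back : num g (act (act (iv x) g) h) ≡ num h (iv x)
    back = trans (num-act-other h g (act (iv x) g) (ne ∘ sym)) (trans (cong₂ _+_ (num-act-self g (iv x)) (num-act-other g h (iv x) ne)) (lemma (num g (iv x)) (num h (iv x))))

  -- Both sides are the product with the sum of T_v over the dihedral group generated by g and h,
  -- which is symmetric in g and h.
  ⋆-braid : ∀ g h → ¬ g ≡ h → (g ⋆ h ⋆ g ⋆ f) ⊟ q^ 1 (g ⋆ f) ≐ (h ⋆ g ⋆ h ⋆ f) ⊟ q^ 1 (h ⋆ f)
  ⋆-braid g h ne x k = trans (cong₂ _-_ (⋆³-ST g h x k ne) (⋆-ST g f x k a refl 1))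
    (trans (braid-cases a b c V (λ p q → isNeg-+ _ _ p q) (λ p q → isNeg-+-pos _ _ p q))
    (sym (cong₂ _-_ (trans (⋆³-ST h g x k (ne ∘ sym)) rearrange) (⋆-ST h f x k b refl 1))))
    where
    p = iv x
    a = desc g p
    b = desc h p
    c = isNeg (num g p + num h p)
    V = values f g h x k
    V' = values f h g x k
    rearrange : ST b (ST a (ST b (V' 0) (V' 1)) (ST (isNeg (num h p + num g p)) (V' 2) (V' 3)))
                     (ST (isNeg (num h p + num g p)) (ST (not b) (V' 1) (V' 0)) (ST a (V' 4) (V' 5))) 0
              ≡ ST b (ST a (ST b (V 0) (V 2)) (ST c (V 1) (V 4))) (ST c (ST (not b) (V 2) (V 0)) (ST a (V 3) (V 5))) 0
    rearrange rewrite ℤP.+-comm (num h p) (num g p) =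
      ST-cong b {U₁} {U₁} {ST c U₂ (ST a (V 3) (V' 5))} {ST c U₂ (ST a (V 3) (V 5))} (λ _ → refl)
        (ST-cong c {U₂} {U₂} {ST a (V 3) (V' 5)} {ST a (V 3) (V 5)} (λ _ → refl)
          (ST-cong a {V 3} {V 3} {V' 5} {V 5} (λ _ → refl) (fc {h ∷ g ∷ h ∷ x} {g ∷ h ∷ g ∷ x} (sym (act-braid p g h ne)) k))) 0
      where
      U₁ = ST a (ST b (V 0) (V 2)) (ST c (V 1) (V 4))
      U₂ = ST (not b) (V 2) (V 0)

raiseS : List Sym → List Sym
raiseS [] = []
raiseS ((c , i , j , v) ∷ ts) = (c , suc i , suc j , v) ∷ raiseS ts

⟪⟫-raise : ∀ ts → q^ 1 ⟪ ts ⟫ ≐ ⟪ raiseS ts ⟫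
⟪⟫-raise [] x zero = refl
⟪⟫-raise [] x (suc k) = refl
⟪⟫-raise ((c , i , j , v) ∷ ts) x k = trans (↑-+ (λ k → c * symC i j v x k) (⟪ ts ⟫ x) k) (cong₂ _+_
  (trans (↑-* c (symC i j v x) k) (cong (λ z → c * z) (↑-+ (↑^ i (C v x)) (↑^ j (C v x)) k))) (⟪⟫-raise ts x k))

raiseS-weight : ∀ {n N} ts → All (Weight n N) ts → All (Weight (suc (suc n)) N) (raiseS ts)
raiseS-weight [] [] = []
raiseS-weight ((c , i , j , v) ∷ ts) ((e , l) ∷ ws) =
  (trans (cong (λ m → suc m ℕ.+ ℓw v) (ℕP.+-suc i j)) (cong (λ m → suc (suc m)) e) , l) ∷ raiseS-weight ts ws

inv-q : ∀ {n N f} → Inv n N f → Inv (suc (suc n)) N (q^ 1 f)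
inv-q {f = f} (inv (ts , w , e)) = inv (raiseS ts , raiseS-weight ts w ,
  λ x k → trans (sym (↑-+ (f x) (f x) k)) (trans (↑-cong (e x) k) (⟪⟫-raise ts x k)))

-- Two reduced words of length N + 1

module IndepStep (N : ℕ) (IH : Indep N) where
  open Below N IH

  K≡ : ∀ g a → length a ≡ N → Red (g ∷ a) → K (g ∷ a) ≐ (g ⋆ C a) ⊟ lowerSum g a
  K≡ g a e ra x k = trans (K-cons g a x k) (cong (λ z → z - lowerSum g a x k)
    (⋆-cong g (IH a (ℕP.≤-reflexive e) (proj₁ (red-tail g a ra))) x k))

  inv-low : ∀ g a → length a ≡ N → Inv (suc N) N (lowerSum g a)
  inv-low g a refl = inv-mono (ℕP.pred[n]≤n {N}) (inv-lowerSum g a)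

  -- By independence in length N, `g ⋆ K a` and `g ⋆ K b` cancel, and only correction terms remain.
  difference-same : ∀ g a b → length a ≡ N → length b ≡ N → Red (g ∷ a) → Red (g ∷ b) → a ∼ b → Inv (suc N) N (K (g ∷ a) ⊟ K (g ∷ b))
  difference-same g a b la lb ra rb q = inv-ext e (inv-⊟ (inv-low g b lb) (inv-low g a la))
    where
    lemma : ∀ i j m → (i - j) - (i - m) ≡ m - j
    lemma = solve-∀
    e : K (g ∷ a) ⊟ K (g ∷ b) ≐ lowerSum g b ⊟ lowerSum g a
    e x k = trans (cong₂ _-_ (K≡ g a la ra x k) (trans (K≡ g b lb rb x k) (cong (λ F → (g ⋆ F) x k - lowerSum g b x k) (C-cong {b} {a} (sym q)))))
      (lemma ((g ⋆ C a) x k) (lowerSum g a x k) (lowerSum g b x k))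

  -- Two left descents g and h split off a factor ghg. With `y` the remainder, a represents h g y,
  -- and `expansion` climbs from C_y to g ⋆ C_a using independence only in lengths up to N.
  module Dihedral (g h : Gen) (a : Word) (ne : ¬ g ≡ h) (la : length a ≡ N) (ra : Red (g ∷ a)) (dh : desc h (iv (g ∷ a)) ≡ true) where
    y : Word
    y = g ∷ h ∷ a

    private
      p = iv (g ∷ a)
      ga : act p g ≡ iv a
      ga = act-involutive (iv a) g
      dg : desc g p ≡ true
      dg = trans (desc-act g (valid-iv a)) (cong not (proj₂ (red-tail g a ra)))
      dh-a : desc h (iv a) ≡ true
      dh-a = trans (cong (desc h) (sym ga)) (desc-after g h ne dg dh)
      dg-ha : desc g (iv (h ∷ a)) ≡ true
      dg-ha = trans (cong (λ q → desc g (act q h)) (sym ga)) (desc-after₂ g h ne dg dh)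
      gy∼ha : (g ∷ y) ∼ (h ∷ a)
      gy∼ha = act-involutive (iv (h ∷ a)) g
      hgy∼a : (h ∷ g ∷ y) ∼ a
      hgy∼a = trans (cong (λ q → act q h) gy∼ha) (act-involutive (iv a) h)
      M = ℓw y
      lgy : ℓw (g ∷ y) ≡ suc M
      lgy = trans (cong ℓ gy∼ha) (ℓ-desc g (valid-iv (h ∷ a)) dg-ha)
      N≡ : N ≡ suc (suc M)
      N≡ = trans (sym la) (trans (sym (proj₁ (red-tail g a ra))) (trans (ℓ-desc h (valid-iv a) dh-a) (cong suc (ℓ-desc g (valid-iv (h ∷ a)) dg-ha))))
      M<N : M < N
      M<N = subst (M <_) (sym N≡) (s≤s (ℕP.n≤1+n M))
      l₁ l₂ : Fun
      l₁ = lowerSum h (redWord (g ∷ y))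
      l₂ = lowerSum g (redWord y)
      e₂ : g ⋆ C y ≐ C (g ∷ y) ⊞ l₂
      e₂ = step-asc g y M<N (trans (desc-act g (valid-iv (h ∷ a))) (cong not dg-ha))
      e₁ : h ⋆ C (g ∷ y) ≐ C a ⊞ l₁
      e₁ x k = trans (step-asc h (g ∷ y) (subst₂ _<_ (sym lgy) (sym N≡) ℕP.≤-refl)
          (trans (cong (desc h) gy∼ha) (trans (desc-act h (valid-iv a)) (cong not dh-a))) x k)
        (cong (λ F → F x k + l₁ x k) (C-cong {h ∷ g ∷ y} {a} hgy∼a))
      i₂ : Inv (suc M) (pred M) l₂
      i₂ = subst (λ n → Inv (suc n) (pred n) l₂) (redWord-length y) (inv-lowerSum g (redWord y))
      i₁ : Inv (suc (suc M)) M l₁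
      i₁ = subst (λ n → Inv (suc n) (pred n) l₁) (trans (redWord-length (g ∷ y)) lgy) (inv-lowerSum h (redWord (g ∷ y)))
      toN : ∀ {f L} → L ≤ suc (suc M) → Inv (suc (suc (suc M))) L f → Inv (suc N) N f
      toN l S = subst (λ n → Inv (suc n) n _) (sym N≡) (inv-mono l S)
      pM : suc (pred M) ≤ suc M
      pM = s≤s (ℕP.pred[n]≤n {M})

    expansion : g ⋆ h ⋆ g ⋆ C y ≐ (g ⋆ C a) ⊞ ((g ⋆ l₁) ⊞ (g ⋆ h ⋆ l₂))
    expansion x k = trans (⋆-cong g inner x k) (trans (⋆-⊞ g (C a ⊞ l₁) (h ⋆ l₂) x k)
      (trans (cong (λ z → z + (g ⋆ h ⋆ l₂) x k) (⋆-⊞ g (C a) l₁ x k)) (ℤP.+-assoc ((g ⋆ C a) x k) ((g ⋆ l₁) x k) ((g ⋆ h ⋆ l₂) x k))))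
      where
      inner : h ⋆ g ⋆ C y ≐ (C a ⊞ l₁) ⊞ (h ⋆ l₂)
      inner x k = trans (⋆-cong h e₂ x k) (trans (⋆-⊞ h (C (g ∷ y)) l₂ x k) (cong (λ z → z + (h ⋆ l₂) x k) (e₁ x k)))

    inv-K : Inv (suc N) N ((g ⋆ h ⋆ g ⋆ C y) ⊟ K (g ∷ a))
    inv-K = inv-ext e (inv-⊞ (inv-low g a la) (inv-⊞
        (toN (ℕP.n≤1+n (suc M)) (inv-⋆ g M<N i₁))
        (toN (s≤s pM) (inv-⋆ g (ℕP.≤-trans (s≤s pM) (ℕP.≤-reflexive (sym N≡))) (inv-⋆ h (ℕP.≤-trans pM M<N) i₂)))))
      where
      lemma : ∀ i j m → (i + j) - (i - m) ≡ m + j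
      lemma = solve-∀
      e : (g ⋆ h ⋆ g ⋆ C y) ⊟ K (g ∷ a) ≐ lowerSum g a ⊞ ((g ⋆ l₁) ⊞ (g ⋆ h ⋆ l₂))
      e x k = trans (cong₂ _-_ (expansion x k) (K≡ g a la ra x k)) (lemma ((g ⋆ C a) x k) ((g ⋆ l₁) x k + (g ⋆ h ⋆ l₂) x k) (lowerSum g a x k))

    inv-middle : Inv (suc N) N (q^ 1 (g ⋆ C y))
    inv-middle = toN ℕP.≤-refl (inv-q (inv-ext e₂ (inv-⊞
      (inv-C 0 (g ∷ y) lgy (ℕP.≤-trans (ℕP.≤-reflexive lgy) (ℕP.n≤1+n (suc M))))
      (inv-mono (ℕP.≤-trans (ℕP.pred[n]≤n {M}) (ℕP.≤-trans (ℕP.n≤1+n M) (ℕP.n≤1+n (suc M)))) i₂))))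

  -- Neither `K (g ∷ a)` nor `K (h ∷ b)` is yet known to lie in the span. But each occurs with
  -- coefficient 1 in its triple product, and `⋆-braid` compares these products, so the difference
  -- is under control.
  difference-braid : ∀ g h a b → ¬ g ≡ h → length a ≡ N → length b ≡ N → Red (g ∷ a) → Red (h ∷ b) → (g ∷ a) ∼ (h ∷ b) →
    Inv (suc N) N (K (g ∷ a) ⊟ K (h ∷ b))
  difference-braid g h a b ne la lb ra rb q = inv-ext e
      (inv-⊞ (inv-⊟ A.inv-middle B.inv-middle) (inv-⊟ B.inv-K A.inv-K))
    where
    desc-first : ∀ g a → Red (g ∷ a) → desc g (iv (g ∷ a)) ≡ true
    desc-first g a ra = trans (desc-act g (valid-iv a)) (cong not (proj₂ (red-tail g a ra)))
    module A = Dihedral g h a ne la ra (trans (cong (desc h) q) (desc-first h b rb))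
    module B = Dihedral h g b (ne ∘ sym) lb rb (trans (cong (desc g) (sym q)) (desc-first g a ra))
    a∼ : a ∼ (g ∷ h ∷ b)
    a∼ = cancel-act g {a} {h ∷ b} q
    y∼ : A.y ∼ B.y
    y∼ = trans (cong (λ p → act (act p h) g) a∼) (trans (act-braid (iv (h ∷ b)) g h ne) (cong (λ p → act (act p g) h) (act-involutive (iv b) h)))
    lemma : ∀ u v i j m n → u - m ≡ v - n → i - j ≡ (m - n) + ((v - j) - (u - i))
    lemma u v i j m n e = trans (shape u v i j m n) (trans (cong (λ z → (m - n) + ((v - j) - (u - i)) + z)
        (trans (cong (λ z → (u - m) - z) (sym e)) (ℤP.+-inverseʳ (u - m)))) (ℤP.+-identityʳ _))
      where
      shape : ∀ u v i j m n → i - j ≡ (m - n) + ((v - j) - (u - i)) + ((u - m) - (v - n))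
      shape = solve-∀
    e : K (g ∷ a) ⊟ K (h ∷ b) ≐ (q^ 1 (g ⋆ C A.y) ⊟ q^ 1 (h ⋆ C B.y)) ⊞ (((h ⋆ g ⋆ h ⋆ C B.y) ⊟ K (h ∷ b)) ⊟ ((g ⋆ h ⋆ g ⋆ C A.y) ⊟ K (g ∷ a)))
    e x k = lemma ((g ⋆ h ⋆ g ⋆ C A.y) x k) ((h ⋆ g ⋆ h ⋆ C B.y) x k) (K (g ∷ a) x k) (K (h ∷ b) x k) (q^ 1 (g ⋆ C A.y) x k) (q^ 1 (h ⋆ C B.y) x k)
      (trans (⋆-braid (C A.y) (K-invariant (redWord A.y)) g h ne x k)
        (cong (λ F → (h ⋆ g ⋆ h ⋆ F) x k - q^ 1 (h ⋆ F) x k) (C-cong {A.y} {B.y} y∼)))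

  difference : ∀ a b → length a ≡ suc N → length b ≡ suc N → Red a → Red b → a ∼ b → Inv (suc N) N (K a ⊟ K b)
  difference (g ∷ a) (h ∷ b) la lb ra rb q with g Fin.≟ h
  ... | yes refl = difference-same g a b (ℕP.suc-injective la) (ℕP.suc-injective lb) ra rb
                     (trans (cancel-act g {a} {g ∷ b} q) (act-involutive (iv b) g))
  ... | no ne = difference-braid g h a b ne (ℕP.suc-injective la) (ℕP.suc-injective lb) ra rb q

  indep-suc : Indep (suc N)
  indep-suc a l ra with length a ℕ.≤? N
  ... | yes p = IH a p ra
  ... | no np = λ x k → ℤP.i-j≡0⇒i≡j (K a x k) (K b x k) (inv-strict (difference a b la lb ra (redWord-red a) (sym b∼a)) strict x k)
    where
    b = redWord a
    la : length a ≡ suc N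
    la = ℕP.≤-antisym l (ℕP.≰⇒> np)
    b∼a : b ∼ a
    b∼a = redWord-∼ a
    lb : length b ≡ suc N
    lb = trans (redWord-length a) (trans ra la)
    na = normalized (length a) a ℕP.≤-refl ra
    strict : Strict (suc N) (K a ⊟ K b)
    strict x k h with x ∼? a
    ... | yes q = trans (cong₂ _-_ (atTop na x k q) (atTop (C-normalized a) x k (trans q (sym b∼a)))) (ℤP.+-inverseʳ (one k))
    ... | no nq = cong₂ _-_ (bounded na x k nq (subst (_≤ k ℕ.+ k ℕ.+ ℓw x) (sym la) h))
                    (bounded (C-normalized a) x k (λ q → nq (trans q b∼a)) (subst (_≤ k ℕ.+ k ℕ.+ ℓw x) (sym lb) h))

indep : ∀ N → Indep N
indep zero [] _ _ x k = cong (λ w → K w x k) (sym (empty (redWord []) (redWord-length [])))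
  where
  empty : ∀ w → length w ≡ 0 → w ≡ []
  empty [] _ = refl
indep (suc N) = IndepStep.indep-suc N (indep N)

K-unique : ∀ a f N → Red a → Normalized a f → Inv (length a) N f → K a ≐ f
K-unique a f N ra nf' S x k = ℤP.i-j≡0⇒i≡j (K a x k) (f x k)
    (inv-strict (inv-⊟ (inv-mono (ℕP.m≤n+m (length a) N) (inv-ext (indep (length a) a ℕP.≤-refl ra) (inv-C 0 a ra (ℕP.≤-reflexive ra))))
                       (inv-mono (ℕP.m≤m+n N (length a)) S)) strict x k)
  where
  na = normalized (length a) a ℕP.≤-refl ra
  strict : Strict (length a) (K a ⊟ f)
  strict x k h with x ∼? a
  ... | yes q = trans (cong₂ _-_ (atTop na x k q) (atTop nf' x k q)) (ℤP.+-inverseʳ (one k))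
  ... | no nq = cong₂ _-_ (bounded na x k nq h) (bounded nf' x k nq h)

inv-star : ∀ g {n N f} → Inv n N f → Inv (suc n) (suc N) (g ⋆ f)
inv-star g {N = N} S = Below.inv-⋆ (suc N) (indep (suc N)) g ℕP.≤-refl S

-- Coordinates relative to a generator

-- The Boolean selects one of the two cyclic orientations of the triangular Coxeter diagram.
nx : Bool → Gen → Gen
nx true  zero             = s
nx true  (suc zero)       = t
nx true  (suc (suc zero)) = r
nx false zero             = t
nx false (suc zero)       = r
nx false (suc (suc zero)) = s

ax : Bool → Gen → Axis → Gen
ax o i axis₀ = i
ax o i axis₁ = nx o i
ax o i axis₂ = nx o (nx o i)

nx³ : ∀ o i → nx o (nx o (nx o i)) ≡ i
nx³ true  zero             = refl
nx³ true  (suc zero)       = refl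
nx³ true  (suc (suc zero)) = refl
nx³ false zero             = refl
nx³ false (suc zero)       = refl
nx³ false (suc (suc zero)) = refl

mL : Lin
mL = + 0 , + 0 , + 1 , + 0

-- The coordinates (x , y) relative to i as functions of the first two entries of the window (a , b , 6 - a - b);
-- they are a cyclic shift of (a - 1 , b - 2 , c - 3), negated and reversed for the second orientation.
frame : Bool → Gen → Sub
frame o i = (proj₁ (go o i)) , (proj₂ (go o i)) , mL
  where
  u v w : Lin
  u = + 1 , + 0 , + 0 , - + 1
  v = + 0 , + 1 , + 0 , - + 2
  w = - + 1 , - + 1 , + 0 , + 3
  neg' : Lin → Lin
  neg' (a , b , c , d) = - a , - b , - c , - d
  go : Bool → Gen → Lin × Lin
  go true  zero             = w , u
  go true  (suc zero)       = u , v
  go true  (suc (suc zero)) = v , w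
  go false zero             = neg' u , neg' w
  go false (suc zero)       = neg' v , neg' u
  go false (suc (suc zero)) = neg' w , neg' v

actS : Gen → Sub
actS zero             = (- + 1 , - + 1 , + 0 , + 3) , (+ 0 , + 1 , + 0 , + 0) , mL
actS (suc zero)       = (+ 0 , + 1 , + 0 , + 0) , (+ 1 , + 0 , + 0 , + 0) , mL
actS (suc (suc zero)) = (+ 1 , + 0 , + 0 , + 0) , (- + 1 , - + 1 , + 0 , + 6) , mL

numL : Gen → Lin
numL zero             = + 2 , + 1 , + 0 , - + 3
numL (suc zero)       = - + 1 , + 1 , + 0 , + 0
numL (suc (suc zero)) = - + 1 , - + 2 , + 0 , + 6

winEnv : Win → ℤ → Env
winEnv (a , b , c) m = a , b , m

third-entry : ∀ a b c → a + b + c ≡ + 6 → c ≡ + 6 - a - b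
third-entry a b c e = trans (lemma a b c) (cong (λ z → z - a - b) e)
  where
  lemma : ∀ a b c → c ≡ a + b + c - a - b
  lemma = solve-∀

winEnv-act : ∀ p m g → Valid p → winEnv (act p g) m ≡ subEnv (actS g) (winEnv p m)
winEnv-act (a , b , c) m g v rewrite third-entry a b c (Valid.total≡6 v) = go g
  where
  go : ∀ g → winEnv (act (a , b , + 6 - a - b) g) m ≡ subEnv (actS g) (a , b , m)
  go zero = cong₂ _,_ (lemma a b m) (cong₂ _,_ (sym (form-y a b m)) (sym (form-m a b m)))
    where
    lemma : ∀ a b m → + 6 - a - b - + 3 ≡ - + 1 * a + - + 1 * b + + 0 * m + + 3
    lemma = solve-∀
  go (suc zero) = cong₂ _,_ (sym (form-y a b m)) (cong₂ _,_ (sym (form-x a b m)) (sym (form-m a b m)))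
  go (suc (suc zero)) = cong₂ _,_ (sym (form-x a b m)) (cong₂ _,_ (lemma a b m) (sym (form-m a b m)))
    where
    lemma : ∀ a b m → + 6 - a - b ≡ - + 1 * a + - + 1 * b + + 0 * m + + 6
    lemma = solve-∀

num-numL : ∀ p m g → Valid p → num g p ≡ ⟦ numL g ⟧ (winEnv p m)
num-numL (a , b , c) m g v rewrite third-entry a b c (Valid.total≡6 v) = go g
  where
  go : ∀ g → num g (a , b , + 6 - a - b) ≡ ⟦ numL g ⟧ (a , b , m)
  go zero = lemma a b m
    where
    lemma : ∀ a b m → a + + 3 - (+ 6 - a - b) ≡ + 2 * a + + 1 * b + + 0 * m + - + 3
    lemma = solve-∀
  go (suc zero) = lemma a b m
    where
    lemma : ∀ a b m → b - a ≡ - + 1 * a + + 1 * b + + 0 * m + + 0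
    lemma = solve-∀
  go (suc (suc zero)) = lemma a b m
    where
    lemma : ∀ a b m → + 6 - a - b - b ≡ - + 1 * a + - + 2 * b + + 0 * m + + 6
    lemma = solve-∀

infixl 8 _∘S_
_∘S_ : Sub → Sub → Sub
(X , Y , M) ∘S σ = X [ σ ] , Y [ σ ] , M [ σ ]

subEnv-∘ : ∀ τ σ ρ → subEnv (τ ∘S σ) ρ ≡ subEnv τ (subEnv σ ρ)
subEnv-∘ (X , Y , M) σ ρ = cong₂ _,_ (⟦[]⟧ X σ ρ) (cong₂ _,_ (⟦[]⟧ Y σ ρ) (⟦[]⟧ M σ ρ))

∀frames : {P : Bool → Gen → Axis → Set} →
  P true r axis₀ → P true r axis₁ → P true r axis₂ → P true s axis₀ → P true s axis₁ → P true s axis₂ →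
  P true t axis₀ → P true t axis₁ → P true t axis₂ → P false r axis₀ → P false r axis₁ → P false r axis₂ →
  P false s axis₀ → P false s axis₁ → P false s axis₂ → P false t axis₀ → P false t axis₁ → P false t axis₂ →
  ∀ o i j → P o i j
∀frames a b c d e f g h i j k l m n o p q u true zero axis₀ = a
∀frames a b c d e f g h i j k l m n o p q u true zero axis₁ = b
∀frames a b c d e f g h i j k l m n o p q u true zero axis₂ = c
∀frames a b c d e f g h i j k l m n o p q u true (suc zero) axis₀ = d
∀frames a b c d e f g h i j k l m n o p q u true (suc zero) axis₁ = e
∀frames a b c d e f g h i j k l m n o p q u true (suc zero) axis₂ = f
∀frames a b c d e f g h i j k l m n o p q u true (suc (suc zero)) axis₀ = g
∀frames a b c d e f g h i j k l m n o p q u true (suc (suc zero)) axis₁ = h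
∀frames a b c d e f g h i j k l m n o p q u true (suc (suc zero)) axis₂ = i
∀frames a b c d e f g h i j k l m n o p q u false zero axis₀ = j
∀frames a b c d e f g h i j k l m n o p q u false zero axis₁ = k
∀frames a b c d e f g h i j k l m n o p q u false zero axis₂ = l
∀frames a b c d e f g h i j k l m n o p q u false (suc zero) axis₀ = m
∀frames a b c d e f g h i j k l m n o p q u false (suc zero) axis₁ = n
∀frames a b c d e f g h i j k l m n o p q u false (suc zero) axis₂ = o
∀frames a b c d e f g h i j k l m n o p q u false (suc (suc zero)) axis₀ = p
∀frames a b c d e f g h i j k l m n o p q u false (suc (suc zero)) axis₁ = q
∀frames a b c d e f g h i j k l m n o p q u false (suc (suc zero)) axis₂ = u

frame-reflect : ∀ o i j → reflectS j ∘S frame o i ≡ frame o i ∘S actS (ax o i j)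
frame-reflect = ∀frames refl refl refl refl refl refl refl refl refl refl refl refl refl refl refl refl refl refl

frame-rot : ∀ o i j → rotS j ∘S frame o i ≡ frame o (ax o i j)
frame-rot = ∀frames refl refl refl refl refl refl refl refl refl refl refl refl refl refl refl refl refl refl

frame-descent : ∀ o i j → descentL j [ frame o i ] ≡ complement (numL (ax o i j))
frame-descent = ∀frames refl refl refl refl refl refl refl refl refl refl refl refl refl refl refl refl refl refl

-- The origin of `OnOrbit`: 2x + y + 1 is a simple root value, hence no multiple of 3.
frame-num₂ : ∀ o i (j : Axis) → (+ 2 , + 1 , + 0 , + 1) [ frame o i ] ≡ numL (ax o i axis₂)
frame-num₂ = ∀frames refl refl refl refl refl refl refl refl refl refl refl refl refl refl refl refl refl refl

env : Bool → Gen → Word → ℤ → Env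
env o i x m = subEnv (frame o i) (winEnv (iv x) m)

env-reflect : ∀ o i j x m → subEnv (reflectS j) (env o i x m) ≡ env o i (ax o i j ∷ x) m
env-reflect o i j x m = trans (sym (subEnv-∘ (reflectS j) (frame o i) (winEnv (iv x) m)))
  (trans (cong (λ σ → subEnv σ (winEnv (iv x) m)) (frame-reflect o i j))
  (trans (subEnv-∘ (frame o i) (actS (ax o i j)) (winEnv (iv x) m))
  (cong (subEnv (frame o i)) (sym (winEnv-act (iv x) m (ax o i j) (valid-iv x))))))

env-rot : ∀ o i j x m → subEnv (rotS j) (env o i x m) ≡ env o (ax o i j) x m
env-rot o i j x m = trans (sym (subEnv-∘ (rotS j) (frame o i) (winEnv (iv x) m)))
  (cong (λ σ → subEnv σ (winEnv (iv x) m)) (frame-rot o i j))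

third-env : ∀ o i x m → proj₂ (proj₂ (env o i x m)) ≡ m
third-env o i x m = form-m (proj₁ (iv x)) (proj₁ (proj₂ (iv x))) m

env-m : ∀ o i j x m → subEnv (mS j) (env o i x m) ≡ env o i x (m + j)
env-m o i j x m = cong₂ _,_ (trans (form-x (proj₁ ρ) (proj₁ (proj₂ ρ)) (proj₂ (proj₂ ρ))) (indep-m (proj₁ (frame o i)) (proj₁ (noM o i))))
    (cong₂ _,_ (trans (form-y (proj₁ ρ) (proj₁ (proj₂ ρ)) (proj₂ (proj₂ ρ))) (indep-m (proj₁ (proj₂ (frame o i))) (proj₂ (noM o i))))
      (trans (shifted (proj₁ ρ) (proj₁ (proj₂ ρ)) (proj₂ (proj₂ ρ)) j) (trans (cong (λ z → z + j) (third-env o i x m)) (sym (third-env o i x (m + j))))))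
  where
  ρ = env o i x m
  a = proj₁ (iv x)
  b = proj₁ (proj₂ (iv x))
  shifted : ∀ x y m j → + 0 * x + + 0 * y + + 1 * m + j ≡ m + j
  shifted = solve-∀
  indep-m : ∀ (f : Lin) → proj₁ (proj₂ (proj₂ f)) ≡ + 0 → ⟦ f ⟧ (a , b , m) ≡ ⟦ f ⟧ (a , b , m + j)
  indep-m (p , q , _ , d) refl = lemma p q d a b m j
    where
    lemma : ∀ p q d a b m j → p * a + q * b + + 0 * m + d ≡ p * a + q * b + + 0 * (m + j) + d
    lemma = solve-∀
  noM : ∀ o i → proj₁ (proj₂ (proj₂ (proj₁ (frame o i)))) ≡ + 0 × proj₁ (proj₂ (proj₂ (proj₁ (proj₂ (frame o i))))) ≡ + 0
  noM true  zero             = refl , refl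
  noM true  (suc zero)       = refl , refl
  noM true  (suc (suc zero)) = refl , refl
  noM false zero             = refl , refl
  noM false (suc zero)       = refl , refl
  noM false (suc (suc zero)) = refl , refl

holds-complement : ∀ ρ f → holds ρ (complement f) ≡ not (holds ρ f)
holds-complement ρ@(x , y , m) f@(a , b , c , d) with + 0 ℤ.≤? ⟦ f ⟧ ρ | + 0 ℤ.≤? ⟦ complement f ⟧ ρ
... | yes p | no q  = refl
... | no p  | yes q = refl
... | no p  | no q  = ⊥-elim (q (complement-sound ρ f p))
... | yes p | yes q = ⊥-elim (absurd (subst (+ 0 ℤ.≤_) (lemma a b c d x y m) (ℤP.+-mono-≤ p q)))
  where
  lemma : ∀ a b c d x y m → (a * x + b * y + c * m + d) + ((- a) * x + (- b) * y + (- c) * m + (- d - + 1)) ≡ - + 1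
  lemma = solve-∀
  absurd : ¬ + 0 ℤ.≤ - + 1
  absurd ()

holds-num : ∀ i → does (+ 0 ℤ.≤? i) ≡ not (isNeg i)
holds-num (+ zero) = refl
holds-num (+ suc n) = refl
holds-num -[1+ n ] = refl

holds-descent : ∀ o i j x m → holds (env o i x m) (descentL j) ≡ desc (ax o i j) (iv x)
holds-descent o i j x m = trans (sym (holds-sub (descentL j) (frame o i) (winEnv (iv x) m)))
  (trans (cong (holds (winEnv (iv x) m)) (frame-descent o i j))
  (trans (holds-complement (winEnv (iv x) m) (numL (ax o i j)))
  (trans (cong not (trans (cong (λ z → does (+ 0 ℤ.≤? z)) (sym (num-numL (iv x) m (ax o i j) (valid-iv x)))) (holds-num _)))
  (not-involutive _))))

residue-cases : ∀ d → NonMultiple ∣ d ∣ → ∃ λ k → d ≡ + 3 * k + + 1 ⊎ d ≡ + 3 * k + + 2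
residue-cases (+ n) p = go n p
  where
  up : ∀ k e → + 3 + (+ 3 * k + e) ≡ + 3 * (+ 1 + k) + e
  up = solve-∀
  go : ∀ n → NonMultiple n → ∃ λ k → + n ≡ + 3 * k + + 1 ⊎ + n ≡ + 3 * k + + 2
  go 1 _ = + 0 , inj₁ refl
  go 2 _ = + 0 , inj₂ refl
  go (suc (suc (suc n))) p with go n p
  ... | k , inj₁ e = + 1 + k , inj₁ (trans (cong (λ z → + 3 + z) e) (up k (+ 1)))
  ... | k , inj₂ e = + 1 + k , inj₂ (trans (cong (λ z → + 3 + z) e) (up k (+ 2)))
residue-cases -[1+ n ] p with residue-cases (+ suc n) p
... | k , inj₁ e = - k - + 1 , inj₂ (trans (cong -_ e) (lemma k))
  where
  lemma : ∀ k → - (+ 3 * k + + 1) ≡ + 3 * (- k - + 1) + + 2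
  lemma = solve-∀
... | k , inj₂ e = - k - + 1 , inj₁ (trans (cong -_ e) (lemma k))
  where
  lemma : ∀ k → - (+ 3 * k + + 2) ≡ + 3 * (- k - + 1) + + 1
  lemma = solve-∀

env-orbit : ∀ o i x m → OnOrbit (proj₁ (env o i x m)) (proj₁ (proj₂ (env o i x m)))
env-orbit o i x m = go (residue-cases (num (ax o i axis₂) (iv x)) (Valid.nonMult (valid-iv x) (ax o i axis₂)))
  where
  X = proj₁ (env o i x m)
  Y = proj₁ (proj₂ (env o i x m))
  M = proj₂ (proj₂ (env o i x m))
  eq : num (ax o i axis₂) (iv x) ≡ + 2 * X + + 1 * Y + + 0 * M + + 1
  eq = trans (num-numL (iv x) m (ax o i axis₂) (valid-iv x)) (trans (cong (λ f → ⟦ f ⟧ (winEnv (iv x) m)) (sym (frame-num₂ o i axis₀)))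
         (⟦[]⟧ (+ 2 , + 1 , + 0 , + 1) (frame o i) (winEnv (iv x) m)))
  solveY : ∀ X Y M → Y ≡ (+ 2 * X + + 1 * Y + + 0 * M + + 1) - + 2 * X - + 1
  solveY = solve-∀
  l₁ : ∀ k X → (+ 3 * k + + 1) - + 2 * X - + 1 ≡ + 3 * k - + 2 * X
  l₁ = solve-∀
  l₂ : ∀ k X → (+ 3 * k + + 2) - + 2 * X - + 1 ≡ + 3 * k - + 2 * X + + 1
  l₂ = solve-∀
  go : (∃ λ k → num (ax o i axis₂) (iv x) ≡ + 3 * k + + 1 ⊎ num (ax o i axis₂) (iv x) ≡ + 3 * k + + 2) → OnOrbit X Y
  go (k , inj₁ e) = k , inj₁ (trans (solveY X Y M) (trans (cong (λ z → z - + 2 * X - + 1) (trans (sym eq) e)) (l₁ k X)))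
  go (k , inj₂ e) = k , inj₂ (trans (solveY X Y M) (trans (cong (λ z → z - + 2 * X - + 1) (trans (sym eq) e)) (l₂ k X)))

-- The polygon identities as identities of functions on the group

FF : Coeffs → Bool → Gen → ℤ → Fun
FF c o i m x k = value (env o i x m) (c k)

value-raise : ∀ ρ (c : Coeffs) k → value ρ (raise c k) ≡ ↑ (λ k → value ρ (c k)) k
value-raise ρ c zero = refl
value-raise ρ c (suc k) = refl

value-at : ∀ σ c ρ k → value ρ (at σ c k) ≡ value (subEnv σ ρ) (c k)
value-at σ c ρ k = value-sub (c k) σ ρ

FF-star : ∀ o i j c m → ax o i j ⋆ FF c o i m ≐ λ x k → value (env o i x m) (starT j c k)
FF-star o i j c m x k = sym (trans (value-++ ρ (guard d A) (guard (complement d) B)) (go (desc (ax o i j) (iv x)) refl))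
  where
  ρ = env o i x m
  d = descentL j
  A = at (reflectS j) c k ++ raise c k
  B = raise (at (reflectS j) c) k ++ c k
  moved : ∀ k → value ρ (at (reflectS j) c k) ≡ FF c o i m (ax o i j ∷ x) k
  moved k = trans (value-at (reflectS j) c ρ k) (cong (λ ρ → value ρ (c k)) (env-reflect o i j x m))
  go : ∀ b → desc (ax o i j) (iv x) ≡ b → value ρ (guard d A) + value ρ (guard (complement d) B) ≡ (ax o i j ⋆ FF c o i m) x k
  go true e = trans (cong₂ _+_ (value-guard-true ρ d A hd) (value-guard-false ρ (complement d) B (trans (holds-complement ρ d) (cong not hd))))
      (trans (ℤP.+-identityʳ _) (trans (value-++ ρ (at (reflectS j) c k) (raise c k)) (trans (cong₂ _+_ (moved k) (value-raise ρ c k)) star)))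
    where
    hd = trans (holds-descent o i j x m) e
    star : FF c o i m (ax o i j ∷ x) k + ↑ (FF c o i m x) k ≡ (ax o i j ⋆ FF c o i m) x k
    star rewrite e = refl
  go false e = trans (cong₂ _+_ (value-guard-false ρ d A hd) (value-guard-true ρ (complement d) B (trans (holds-complement ρ d) (cong not hd))))
      (trans (ℤP.+-identityˡ _) (trans (value-++ ρ (raise (at (reflectS j) c) k) (c k)) (trans (cong (λ z → z + FF c o i m x k)
        (trans (value-raise ρ (at (reflectS j) c) k) (↑-cong moved k))) star)))
    where
    hd = trans (holds-descent o i j x m) e
    star : ↑ (FF c o i m (ax o i j ∷ x)) k + FF c o i m x k ≡ (ax o i j ⋆ FF c o i m) x k
    star rewrite e = refl

sat-m : ∀ o i x m j → j ℤ.≤ m → Sat (env o i x m) (m≥ j)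
sat-m o i x m j h = subst (+ 0 ℤ.≤_) (trans (cong (λ z → z - j) (sym (third-env o i x m))) (lemma (proj₁ ρ) (proj₁ (proj₂ ρ)) (proj₂ (proj₂ ρ)) j))
    (ℤP.i≤j⇒0≤j-i h)
  where
  ρ = env o i x m
  lemma : ∀ x y m j → m - j ≡ + 0 * x + + 0 * y + + 1 * m + - j
  lemma = solve-∀

onEnv : ∀ j ts → check (m≥ j ∷ []) ts ≡ true → ∀ o i x m → j ℤ.≤ m → value (env o i x m) ts ≡ + 0
onEnv j ts h o i x m l = check-sound (m≥ j ∷ []) ts h _ _ _ (env-orbit o i x m) (sat-m o i x m j l ∷ [])

onEnv₀ : ∀ ts → check [] ts ≡ true → ∀ o i x m → value (env o i x m) ts ≡ + 0
onEnv₀ ts h o i x m = check-sound [] ts h _ _ _ (env-orbit o i x m) []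

onEnvAt : ∀ j ts → checkAt j ts ≡ true → ∀ o i x → value (env o i x j) ts ≡ + 0
onEnvAt j ts h o i x = trans (cong (λ m → value (proj₁ ρ , proj₁ (proj₂ ρ) , m) ts) (third-env o i x j))
    (checkAt-sound j ts h _ _ (env-orbit o i x j))
  where ρ = env o i x j

⊝-elim : ∀ ρ (F G : Coeffs) k → value ρ ((F ⊝ G) k) ≡ + 0 → value ρ (F k) ≡ value ρ (G k)
⊝-elim ρ F G k e = ℤP.i-j≡0⇒i≡j (value ρ (F k)) (value ρ (G k)) (trans (cong (λ z → value ρ (F k) + z) (sym (value-minus ρ (G k)))) (trans (sym (value-++ ρ (F k) (minus (G k)))) e))

FF-rot : ∀ c o i j m x k → value (env o i x m) (at (rotS j) c k) ≡ FF c o (ax o i j) m x k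
FF-rot c o i j m x k = trans (value-at (rotS j) c (env o i x m) k) (cong (λ ρ → value ρ (c k)) (env-rot o i j x m))

FF-m : ∀ c o i e m x k → value (env o i x m) (at (mS e) c k) ≡ FF c o i (m + e) x k
FF-m c o i e m x k = trans (value-at (mS e) c (env o i x m) k) (cong (λ ρ → value ρ (c k)) (env-m o i e x m))

FF-rot-m : ∀ c o i j e m x k → value (env o i x m) (at (rotS j) (at (mS e) c) k) ≡ FF c o (ax o i j) (m + e) x k
FF-rot-m c o i j e m x k = trans (FF-rot (at (mS e) c) o i j m x k) (FF-m c o (ax o i j) e m x k)

raised : ∀ ρ (c : Coeffs) (f : Seq) → (∀ k → value ρ (c k) ≡ f k) → ∀ k → value ρ (raise c k) ≡ ↑ f k
raised ρ c f e k = trans (value-raise ρ c k) (↑-cong e k)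

1≤suc : ∀ n → + 1 ℤ.≤ + suc n
1≤suc n = +≤+ (s≤s z≤n)

suc+1 : ∀ n → + suc n + + 1 ≡ + suc (suc n)
suc+1 n = cong +_ (ℕP.+-comm (suc n) 1)

Ae Ao Be Bo : Bool → Gen → ℕ → Fun
Ae o i n = FF evenA o i (+ n)
Ao o i n = FF oddA o i (+ n)
Be o i n = FF evenB o i (+ n)
Bo o i n = FF oddB o i (+ n)

A₀ A₁ : Bool → Gen → Fun
A₀ o i = FF nilA o i (+ 1)
A₁ o i = FF oneA o i (+ 1)

-- The checks are made in the frame of j with multiplier j + 2. For j = i + 1 the multiplier is i +
-- 3 = i, the letter to be put in front.
onNext : (P : Gen → Gen → Set) (o : Bool) → (∀ i → P i (ax o i axis₂)) → ∀ i → P (nx o i) i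
onNext P o H i = subst (P (nx o i)) (nx³ o i) (H (nx o i))

step-nil : ∀ o i → i ⋆ A₀ o (nx o i) ≐ A₁ o i
step-nil o = onNext (λ j i → i ⋆ A₀ o j ≐ A₁ o i) o λ i x k →
  trans (FF-star o i axis₂ nilA (+ 1) x k) (trans (⊝-elim (env o i x (+ 1)) (starT axis₂ nilA) (at (rotS axis₂) oneA) k
    (onEnv₀ (stepA-nil k) (check-A-nil k) o i x (+ 1))) (FF-rot oneA o i axis₂ (+ 1) x k))

step-one : ∀ o i → i ⋆ A₁ o (nx o i) ≐ Ae o i 1
step-one o = onNext (λ j i → i ⋆ A₁ o j ≐ Ae o i 1) o λ i x k →
  trans (FF-star o i axis₂ oneA (+ 1) x k) (trans (⊝-elim (env o i x (+ 1)) (starT axis₂ oneA) (at (rotS axis₂) evenA) k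
    (onEnvAt (+ 1) (stepA-one k) (check-A-one k) o i x)) (FF-rot evenA o i axis₂ (+ 1) x k))

step-odd : ∀ n o i → i ⋆ Ao o (nx o i) (suc n) ≐ Ae o i (suc (suc n)) ⊞ q^ 1 (Be o i (suc n))
step-odd n o = onNext (λ j i → i ⋆ Ao o j (suc n) ≐ Ae o i (suc (suc n)) ⊞ q^ 1 (Be o i (suc n))) o λ i x k →
  let m = + suc n; ρ = env o i x m in
  trans (FF-star o i axis₂ oddA m x k) (trans (⊝-elim ρ (starT axis₂ oddA) (at (rotS axis₂) (at (mS (+ 1)) evenA) ⊕T raise (at (rotS axis₂) evenB)) k
    (onEnv (+ 1) (stepA-odd k) (check-A-odd k) o i x m (1≤suc n)))
  (trans (value-++ ρ (at (rotS axis₂) (at (mS (+ 1)) evenA) k) (raise (at (rotS axis₂) evenB) k)) (cong₂ _+_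
    (trans (FF-rot-m evenA o i axis₂ (+ 1) m x k) (cong (λ m → FF evenA o (ax o i axis₂) m x k) (suc+1 n)))
    (raised ρ (at (rotS axis₂) evenB) (Be o (ax o i axis₂) (suc n) x) (FF-rot evenB o i axis₂ m x) k))))

step-even : ∀ n o i → i ⋆ Ae o (nx o i) (suc n) ≐ Ao o i (suc n) ⊞ (q^ 1 (Bo o i n) ⊞ q^ 2 (FF oddB o i (+ suc n + -2ℤ)))
step-even n o = onNext (λ j i → i ⋆ Ae o j (suc n) ≐ Ao o i (suc n) ⊞ (q^ 1 (Bo o i n) ⊞ q^ 2 (FF oddB o i (+ suc n + -2ℤ)))) o λ i x k →
  let m = + suc n; ρ = env o i x m; i' = ax o i axis₂
      B₁ = at (rotS axis₂) (at (mS -1ℤ) oddB); B₂ = at (rotS axis₂) (at (mS -2ℤ) oddB) in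
  trans (FF-star o i axis₂ evenA m x k) (trans (⊝-elim ρ (starT axis₂ evenA) (at (rotS axis₂) oddA ⊕T raise B₁ ⊕T raise (raise B₂)) k
    (onEnv (+ 1) (stepA-even k) (check-A-even k) o i x m (1≤suc n)))
  (trans (value-++ ρ (at (rotS axis₂) oddA k) (raise B₁ k ++ raise (raise B₂) k)) (cong₂ _+_ (FF-rot oddA o i axis₂ m x k)
  (trans (value-++ ρ (raise B₁ k) (raise (raise B₂) k)) (cong₂ _+_
    (raised ρ B₁ (Bo o i' n x) (FF-rot-m oddB o i axis₂ -1ℤ m x) k)
    (raised ρ (raise B₂) (↑ (FF oddB o i' (m + -2ℤ) x)) (raised ρ B₂ (FF oddB o i' (m + -2ℤ) x) (FF-rot-m oddB o i axis₂ -2ℤ m x)) k))))))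

step-B-odd : ∀ n o i → nx o i ⋆ Ao o i (suc n) ≐ Be o i (suc (suc n)) ⊞ q^ 1 (Ae o (nx o i) (suc n))
step-B-odd n o i x k =
  trans (FF-star o i axis₁ oddA m x k) (trans (⊝-elim ρ (starT axis₁ oddA) (at (mS (+ 1)) evenB ⊕T raise (at (rotS axis₁) evenA)) k
    (onEnv (+ 1) (stepB-odd k) (check-B-odd k) o i x m (1≤suc n)))
  (trans (value-++ ρ (at (mS (+ 1)) evenB k) (raise (at (rotS axis₁) evenA) k)) (cong₂ _+_
    (trans (FF-m evenB o i (+ 1) m x k) (cong (λ m → FF evenB o i m x k) (suc+1 n)))
    (raised ρ (at (rotS axis₁) evenA) (Ae o (nx o i) (suc n) x) (FF-rot evenA o i axis₁ m x) k))))
  where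
  m = + suc n
  ρ = env o i x m

step-B-even : ∀ n o i → nx o i ⋆ Ae o i (suc (suc n)) ≐ Bo o i (suc (suc n)) ⊞ (q^ 1 (Ao o (nx o i) (suc n)) ⊞ q^ 1 (Bo o i (suc n)))
step-B-even n o i x k =
  trans (FF-star o i axis₁ evenA m x k) (trans (⊝-elim ρ (starT axis₁ evenA) (oddB ⊕T raise A ⊕T raise B) k
    (onEnv (+ 2) (stepB-even k) (check-B-even k) o i x m (+≤+ (s≤s (s≤s z≤n)))))
  (trans (value-++ ρ (oddB k) (raise A k ++ raise B k)) (cong (λ z → FF oddB o i m x k + z)
  (trans (value-++ ρ (raise A k) (raise B k)) (cong₂ _+_
    (raised ρ A (Ao o (nx o i) (suc n) x) (FF-rot-m oddA o i axis₁ -1ℤ m x) k)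
    (raised ρ B (Bo o i (suc n) x) (FF-m oddB o i -1ℤ m x) k))))))
  where
  m = + suc (suc n)
  ρ = env o i x m
  A = at (rotS axis₁) (at (mS -1ℤ) oddA)
  B = at (mS -1ℤ) oddB

step-B-two : ∀ o i → nx o i ⋆ Ae o i 1 ≐ Bo o i 1 ⊞ q^ 1 (A₁ o (nx o i))
step-B-two o i x k =
  trans (FF-star o i axis₁ evenA (+ 1) x k) (trans (⊝-elim ρ (starT axis₁ evenA) (oddB ⊕T raise (at (rotS axis₁) oneA)) k
    (onEnvAt (+ 1) (stepB-two k) (check-B-two k) o i x))
  (trans (value-++ ρ (oddB k) (raise (at (rotS axis₁) oneA) k)) (cong (λ z → FF oddB o i (+ 1) x k + z)
    (raised ρ (at (rotS axis₁) oneA) (A₁ o (nx o i) x) (FF-rot oneA o i axis₁ (+ 1) x) k))))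
  where
  ρ = env o i x (+ 1)

Bo-zero : ∀ o i → Bo o i 0 ≐ 𝟘
Bo-zero o i x k = onEnvAt (+ 0) (oddB k) (check-B-odd-empty k) o i x

Bo-neg : ∀ o i → FF oddB o i -1ℤ ≐ 𝟘
Bo-neg o i x k = onEnvAt -1ℤ (oddB k) (check-B-odd-empty' k) o i x

Be-one : ∀ o i → Be o i 1 ≐ 𝟘
Be-one o i x k = onEnvAt (+ 1) (evenB k) (check-B-even-empty k) o i x

ind-01 : ∀ ρ R → ind ρ R ≡ + 0 ⊎ ind ρ R ≡ + 1
ind-01 ρ [] = inj₂ refl
ind-01 ρ (f ∷ R) with holds ρ f
... | true  = ind-01 ρ R
... | false = inj₁ refl

ind-Sat : ∀ ρ R → ind ρ R ≡ + 1 → All (Sat ρ) R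
ind-Sat ρ [] e = []
ind-Sat ρ (f ∷ R) e with + 0 ℤ.≤? ⟦ f ⟧ ρ
... | yes p = p ∷ ind-Sat ρ R e
ind-Sat ρ (f ∷ R) () | no _

forced : ∀ cs f → refute (complement f ∷ cs) ≡ true → ∀ ρ → All (Sat ρ) cs → Sat ρ f
forced cs f h ρ ss with + 0 ℤ.≤? ⟦ f ⟧ ρ
... | yes p = p
... | no np = ⊥-elim (refute-sound ρ (complement f ∷ cs) h (complement-sound ρ f np ∷ ss))

corner : Bool → Gen → List Lin
corner o i = map (_[ frame o i ]) zeroA

a≥1 a≤1 b≥2 b≤2 : Lin
a≥1 = + 1 , + 0 , + 0 , - + 1
a≤1 = - + 1 , + 0 , + 0 , + 1
b≥2 = + 0 , + 1 , + 0 , - + 2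
b≤2 = + 0 , - + 1 , + 0 , + 2

corner-forced : ∀ o i (j : Axis) → (refute (complement a≥1 ∷ corner o i) ≡ true × refute (complement a≤1 ∷ corner o i) ≡ true)
  × (refute (complement b≥2 ∷ corner o i) ≡ true × refute (complement b≤2 ∷ corner o i) ≡ true)
corner-forced = ∀frames e e e e e e e e e e e e e e e e e e
  where
  -- Instance search finds `refl`, so each occurrence of `e` evaluates four refutations.
  e : ∀ {a b c d : Bool} {{_ : a ≡ true}} {{_ : b ≡ true}} {{_ : c ≡ true}} {{_ : d ≡ true}} → (a ≡ true × b ≡ true) × (c ≡ true × d ≡ true)
  e {{p}} {{q}} {{u}} {{v}} = (p , q) , (u , v)

-- Nonnegative x, y, z with sum 0 all vanish, and the origin is the window (1, 2, 3) in every frame.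
zeroA-identity : ∀ o i x m → ind (env o i x m) zeroA ≡ + 1 → x ∼ []
zeroA-identity o i x m h = cong₂ _,_ a≡ (cong₂ _,_ b≡ c≡)
  where
  p = iv x
  a = proj₁ p
  b = proj₁ (proj₂ p)
  c = proj₂ (proj₂ p)
  ρ = winEnv p m
  ss : All (Sat ρ) (corner o i)
  ss = sat-sub (frame o i) ρ (ind-Sat (env o i x m) zeroA h)
  F = corner-forced o i axis₀
  l₁ : ∀ a b m → + 1 * a + + 0 * b + + 0 * m + - + 1 ≡ a - + 1
  l₁ = solve-∀
  l₂ : ∀ a b m → - + 1 * a + + 0 * b + + 0 * m + + 1 ≡ + 1 - a
  l₂ = solve-∀
  l₃ : ∀ a b m → + 0 * a + + 1 * b + + 0 * m + - + 2 ≡ b - + 2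
  l₃ = solve-∀
  l₄ : ∀ a b m → + 0 * a + - + 1 * b + + 0 * m + + 2 ≡ + 2 - b
  l₄ = solve-∀
  a≡ : a ≡ + 1
  a≡ = ℤP.≤-antisym (ℤP.0≤i-j⇒j≤i (subst (+ 0 ℤ.≤_) (l₂ a b m) (forced (corner o i) a≤1 (proj₂ (proj₁ F)) ρ ss)))
                    (ℤP.0≤i-j⇒j≤i (subst (+ 0 ℤ.≤_) (l₁ a b m) (forced (corner o i) a≥1 (proj₁ (proj₁ F)) ρ ss)))
  b≡ : b ≡ + 2
  b≡ = ℤP.≤-antisym (ℤP.0≤i-j⇒j≤i (subst (+ 0 ℤ.≤_) (l₄ a b m) (forced (corner o i) b≤2 (proj₂ (proj₂ F)) ρ ss)))
                    (ℤP.0≤i-j⇒j≤i (subst (+ 0 ℤ.≤_) (l₃ a b m) (forced (corner o i) b≥2 (proj₁ (proj₂ F)) ρ ss)))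
  c≡ : c ≡ + 3
  c≡ = trans (third-entry a b c (Valid.total≡6 (valid-iv x))) (cong₂ (λ a b → + 6 - a - b) a≡ b≡)

A₀-identity : ∀ o i x → x ∼ [] → A₀ o i x 0 ≡ + 1
A₀-identity o i x e = trans (cong (λ p → value (subEnv (frame o i) (winEnv p (+ 1))) (nilA 0)) e) (go o i axis₀)
  where
  go : ∀ o i (j : Axis) → value (subEnv (frame o i) (winEnv idW (+ 1))) (nilA 0) ≡ + 1
  go = ∀frames refl refl refl refl refl refl refl refl refl refl refl refl refl refl refl refl refl refl

A₀≐K : ∀ o i → A₀ o i ≐ K []
A₀≐K o i x (suc k) with x ∼? []
... | yes e = sym (K-nil-self x (suc k) e)
... | no ne = sym (K-nil-other x (suc k) ne)
A₀≐K o i x zero with x ∼? []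
... | yes e = trans (A₀-identity o i x e) (sym (K-nil-self x 0 e))
... | no ne with ind-01 (env o i x (+ 1)) zeroA
...   | inj₂ h = ⊥-elim (ne (zeroA-identity o i x (+ 1) h))
...   | inj₁ h = trans (cong (λ z → + 1 * z + + 0) h) (sym (K-nil-other x 0 ne))

-- Cyclic words

cyc : Bool → Gen → ℕ → Word
cyc o i zero    = []
cyc o i (suc n) = i ∷ cyc o (nx o i) n

cyc-length : ∀ o i n → length (cyc o i n) ≡ n
cyc-length o i zero = refl
cyc-length o i (suc n) = cong suc (cyc-length o (nx o i) n)

dbl : ℕ → ℕ
dbl zero    = zero
dbl (suc n) = suc (suc (dbl n))

-- Independence now holds in all lengths, so the bound on the words in the span may be left
-- existential.
InvE : ℕ → Fun → Set
InvE n f = ∃ λ N → Inv n N f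

invE-⊟ : ∀ {n f f'} → InvE n f → InvE n f' → InvE n (f ⊟ f')
invE-⊟ (N , S) (N' , S') = N ℕ.+ N' , inv-⊟ (inv-mono (ℕP.m≤m+n N N') S) (inv-mono (ℕP.m≤n+m N' N) S')

invE-⊞ : ∀ {n f f'} → InvE n f → InvE n f' → InvE n (f ⊞ f')
invE-⊞ (N , S) (N' , S') = N ℕ.+ N' , inv-⊞ (inv-mono (ℕP.m≤m+n N N') S) (inv-mono (ℕP.m≤n+m N' N) S')

invE-ext : ∀ {n f f'} → f' ≐ f → InvE n f → InvE n f'
invE-ext e (N , S) = N , inv-ext e S

invE-q : ∀ {n f} → InvE n f → InvE (suc (suc n)) (q^ 1 f)
invE-q (N , S) = N , inv-q S

invE-star : ∀ g {n f} → InvE n f → InvE (suc n) (g ⋆ f)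
invE-star g (N , S) = suc N , inv-star g S

invE-𝟘 : ∀ {n f} → f ≐ 𝟘 → InvE n f
invE-𝟘 e = 0 , inv-𝟘 e

solve-first : ∀ {f f' f''} → f ≐ f' ⊞ f'' → f' ≐ f ⊟ f''
solve-first {f} {f'} {f''} e x k = trans (lemma (f' x k) (f'' x k)) (cong (λ z → z - f'' x k) (sym (e x k)))
  where
  lemma : ∀ a b → a ≡ (a + b) - b
  lemma = solve-∀

q-zero : ∀ i {f} → f ≐ 𝟘 → q^ i f ≐ 𝟘
q-zero i e x k = ↑^-zero i (e x) k

inv-A₁ : ∀ o i → InvE 1 (A₁ o i)
inv-A₁ o i = invE-ext (≐-sym (step-nil o i)) (invE-star i (invE-ext (A₀≐K o (nx o i))
  (0 , inv-ext (indep 0 [] z≤n refl) (inv-C 0 [] refl z≤n))))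

-- Each step identity is solved for its leading polygon. The families A and B are corrections of
-- each other, hence the simultaneous induction; none of these functions has been identified with a
-- Kazhdan-Lusztig element yet.
inv-Ae : ∀ n o i → InvE (2 ℕ.+ dbl n) (Ae o i (suc n))
inv-Ao : ∀ n o i → InvE (3 ℕ.+ dbl n) (Ao o i (suc n))
inv-Bo : ∀ n o i → InvE (3 ℕ.+ dbl n) (Bo o i (suc n))
inv-Be : ∀ n o i → InvE (4 ℕ.+ dbl n) (Be o i (suc (suc n)))

inv-Ae zero o i = invE-ext (≐-sym (step-one o i)) (invE-star i (inv-A₁ o (nx o i)))
inv-Ae (suc zero) o i = invE-ext (solve-first (step-odd 0 o i)) (invE-⊟ (invE-star i (inv-Ao 0 o (nx o i))) (invE-𝟘 (q-zero 1 (Be-one o i))))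
inv-Ae (suc (suc n)) o i = invE-ext (solve-first (step-odd (suc n) o i)) (invE-⊟ (invE-star i (inv-Ao (suc n) o (nx o i))) (invE-q (inv-Be n o i)))

inv-Ao zero o i = invE-ext (solve-first (step-even 0 o i)) (invE-⊟ (invE-star i (inv-Ae 0 o (nx o i)))
  (invE-⊞ (invE-𝟘 (q-zero 1 (Bo-zero o i))) (invE-𝟘 (q-zero 2 (Bo-neg o i)))))
inv-Ao (suc zero) o i = invE-ext (solve-first (step-even 1 o i)) (invE-⊟ (invE-star i (inv-Ae 1 o (nx o i)))
  (invE-⊞ (invE-q (inv-Bo 0 o i)) (invE-𝟘 (q-zero 2 (Bo-zero o i)))))
inv-Ao (suc (suc n)) o i = invE-ext (solve-first (step-even (suc (suc n)) o i)) (invE-⊟ (invE-star i (inv-Ae (suc (suc n)) o (nx o i)))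
  (invE-⊞ (invE-q (inv-Bo (suc n) o i)) (invE-q (invE-q (inv-Bo n o i)))))

inv-Bo zero o i = invE-ext (solve-first (step-B-two o i)) (invE-⊟ (invE-star (nx o i) (inv-Ae 0 o i)) (invE-q (inv-A₁ o (nx o i))))
inv-Bo (suc n) o i = invE-ext (solve-first (step-B-even n o i)) (invE-⊟ (invE-star (nx o i) (inv-Ae (suc n) o i))
  (invE-⊞ (invE-q (inv-Ao n o (nx o i))) (invE-q (inv-Bo n o i))))

inv-Be n o i = invE-ext (solve-first (step-B-odd n o i)) (invE-⊟ (invE-star (nx o i) (inv-Ao n o i)) (invE-q (inv-Ae n o (nx o i))))

-- Regions and the Bruhat order

In : Region → Bool → Gen → ℤ → Word → Set
In R o i m x = ind (env o i x m) R ≡ + 1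

ind-++ : ∀ ρ R R' → ind ρ (R ++ R') ≡ ind ρ R * ind ρ R'
ind-++ ρ [] R' = sym (ℤP.*-identityˡ _)
ind-++ ρ (f ∷ R) R' with holds ρ f
... | true  = ind-++ ρ R R'
... | false = refl

cover-elim : ∀ ρ R R₁ R₂ → value ρ (cover R R₁ R₂) ≡ + 0 → ind ρ R ≡ + 1 → ind ρ R₁ ≡ + 1 ⊎ ind ρ R₂ ≡ + 1
cover-elim ρ R R₁ R₂ e h rewrite ind-++ ρ R R₁ | ind-++ ρ R R₂ | ind-++ ρ R (R₁ ++ R₂) | ind-++ ρ R₁ R₂ | h
  with ind-01 ρ R₁ | ind-01 ρ R₂
... | inj₂ p | _ = inj₁ p
... | inj₁ _ | inj₂ q = inj₂ q
... | inj₁ p | inj₁ q rewrite p | q with () ← e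

subset-elim : ∀ ρ R R₁ → value ρ (subset R R₁) ≡ + 0 → ind ρ R ≡ + 1 → ind ρ R₁ ≡ + 1
subset-elim ρ R R₁ e h rewrite ind-++ ρ R R₁ | h with ind-01 ρ R₁
... | inj₂ p = p
... | inj₁ p rewrite p with () ← e

in-⟨⟩ : ∀ R σ ρ ρ' → subEnv σ ρ ≡ ρ' → ind ρ (R ⟨ σ ⟩) ≡ ind ρ' R
in-⟨⟩ R σ ρ ρ' refl = ind-sub R σ ρ

descend : ∀ o i m x R R' → value (env o (nx o i) x m) (cover R' R (R ⟨ reflectS axis₂ ⟩)) ≡ + 0 →
  ind (env o (nx o i) x m) R' ≡ + 1 → In R o (nx o i) m x ⊎ In R o (nx o i) m (i ∷ x)
descend o i m x R R' e h with cover-elim (env o (nx o i) x m) R' R (R ⟨ reflectS axis₂ ⟩) e h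
... | inj₁ p = inj₁ p
... | inj₂ p = inj₂ (trans (sym (in-⟨⟩ R (reflectS axis₂) (env o (nx o i) x m) (env o (nx o i) (i ∷ x) m) (trans (env-reflect o (nx o i) axis₂ x m) (cong (λ g → env o (nx o i) (g ∷ x) m) (nx³ o i))))) p)

to-next : ∀ R o i m x → ind (env o (nx o i) x m) (R ⟨ rotS axis₂ ⟩) ≡ ind (env o i x m) R
to-next R o i m x = in-⟨⟩ R (rotS axis₂) (env o (nx o i) x m) (env o i x m) (trans (env-rot o (nx o i) axis₂ x m) (cong (λ g → env o g x m) (nx³ o i)))

below-one : ∀ o i x → In unitA o i (+ 1) x → InD (cyc o i 1) x
below-one o i x h = Sum.map (zeroA-identity o (nx o i) x (+ 1)) (zeroA-identity o (nx o i) (i ∷ x) (+ 1))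
  (descend o i (+ 1) x zeroA (unitA ⟨ rotS axis₂ ⟩) (onEnv₀ coverOne check-cover-one o (nx o i) x (+ 1)) (trans (to-next unitA o i (+ 1) x) h))

-- The region of A lies in D ∪ iD, where D is the region of its tail; these are the two alternatives
-- in `InD`.
below-even : ∀ n o i x → In evenA₀ o i (+ suc n) x → InD (cyc o i (2 ℕ.+ dbl n)) x
below-odd : ∀ n o i x → In oddA₀ o i (+ suc n) x → InD (cyc o i (3 ℕ.+ dbl n)) x

below-even zero o i x h = Sum.map (below-one o (nx o i) x) (below-one o (nx o i) (i ∷ x))
  (descend o i (+ 1) x unitA (evenA₀ ⟨ rotS axis₂ ⟩) (onEnvAt (+ 1) coverTwo check-cover-two o (nx o i) x) (trans (to-next evenA₀ o i (+ 1) x) h))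
below-even (suc n) o i x h = Sum.map (below-odd n o (nx o i) x) (below-odd n o (nx o i) (i ∷ x))
  (descend o i (+ suc n) x oddA₀ (evenA₀ ⟨ mS (+ 1) ⟩ ⟨ rotS axis₂ ⟩) (onEnv (+ 1) coverEven check-cover-even o (nx o i) x (+ suc n) (1≤suc n))
    (trans (to-next (evenA₀ ⟨ mS (+ 1) ⟩) o i (+ suc n) x) (trans (in-⟨⟩ evenA₀ (mS (+ 1)) (env o i x (+ suc n)) (env o i x (+ suc (suc n))) (trans (env-m o i (+ 1) x (+ suc n)) (cong (env o i x) (suc+1 n)))) h)))

below-odd n o i x h = Sum.map (below-even n o (nx o i) x) (below-even n o (nx o i) (i ∷ x))
  (descend o i (+ suc n) x evenA₀ (oddA₀ ⟨ rotS axis₂ ⟩) (onEnv (+ 1) coverOdd check-cover-odd o (nx o i) x (+ suc n) (1≤suc n)) (trans (to-next oddA₀ o i (+ suc n) x) h))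

below-B : ∀ n o i x → In oddB₀ o i (+ suc n) x → InD (nx o i ∷ cyc o i (2 ℕ.+ dbl n)) x
below-B n o i x h = Sum.map (below-even n o i x)
  (λ p → below-even n o i (nx o i ∷ x) (trans (sym (in-⟨⟩ evenA₀ (reflectS axis₁) (env o i x (+ suc n)) (env o i (nx o i ∷ x) (+ suc n)) (env-reflect o i axis₁ x (+ suc n)))) p))
  (cover-elim (env o i x (+ suc n)) oddB₀ evenA₀ (evenA₀ ⟨ reflectS axis₁ ⟩)
    (onEnv (+ 1) (cover oddB₀ evenA₀ (evenA₀ ⟨ reflectS axis₁ ⟩)) check-cover-B o i x (+ suc n) (1≤suc n)) h)

ascend : ∀ R o i m y → ind (env o (nx o i) y m) (R ⟨ rotS axis₂ ⟩ ⟨ reflectS axis₂ ⟩) ≡ ind (env o i (i ∷ y) m) R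
ascend R o i m y = trans (in-⟨⟩ (R ⟨ rotS axis₂ ⟩) (reflectS axis₂) (env o (nx o i) y m) (env o (nx o i) (i ∷ y) m) (trans (env-reflect o (nx o i) axis₂ y m) (cong (λ g → env o (nx o i) (g ∷ y) m) (nx³ o i))))
  (to-next R o i m (i ∷ y))

0≢1 : ¬ + 0 ≡ + 1
0≢1 ()

top-nil : ∀ o i → In zeroA o i (+ 1) []
top-nil o i = lemma (ind-01 (env o i [] (+ 1)) zeroA)
  where
  lemma : ind (env o i [] (+ 1)) zeroA ≡ + 0 ⊎ ind (env o i [] (+ 1)) zeroA ≡ + 1 → ind (env o i [] (+ 1)) zeroA ≡ + 1
  lemma (inj₂ p) = p
  lemma (inj₁ p) = ⊥-elim (0≢1 (trans (sym (cong (λ z → + 1 * z + + 0) p)) (A₀-identity o i [] refl)))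

top-one : ∀ o i → In unitA o i (+ 1) (cyc o i 1)
top-one o i = trans (sym (ascend unitA o i (+ 1) [])) (subset-elim (env o (nx o i) [] (+ 1)) zeroA (unitA ⟨ rotS axis₂ ⟩ ⟨ reflectS axis₂ ⟩)
  (onEnv₀ (subset zeroA (unitA ⟨ rotS axis₂ ⟩ ⟨ reflectS axis₂ ⟩)) check-top-one o (nx o i) [] (+ 1)) (top-nil o (nx o i)))

-- Multiplication by i carries the region of the tail into the region of A, so membership of the
-- word itself propagates from the identity.
top-even : ∀ n o i → In evenA₀ o i (+ suc n) (cyc o i (2 ℕ.+ dbl n))
top-odd : ∀ n o i → In oddA₀ o i (+ suc n) (cyc o i (3 ℕ.+ dbl n))

top-even zero o i = trans (sym (ascend evenA₀ o i (+ 1) y)) (subset-elim (env o (nx o i) y (+ 1)) unitA (evenA₀ ⟨ rotS axis₂ ⟩ ⟨ reflectS axis₂ ⟩)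
    (onEnvAt (+ 1) (subset unitA (evenA₀ ⟨ rotS axis₂ ⟩ ⟨ reflectS axis₂ ⟩)) check-top-two o (nx o i) y) (top-one o (nx o i)))
  where y = cyc o (nx o i) 1
top-even (suc n) o i = trans (sym (trans (ascend (evenA₀ ⟨ mS (+ 1) ⟩) o i (+ suc n) y) (in-⟨⟩ evenA₀ (mS (+ 1)) (env o i (i ∷ y) (+ suc n)) (env o i (i ∷ y) (+ suc (suc n))) (trans (env-m o i (+ 1) (i ∷ y) (+ suc n)) (cong (env o i (i ∷ y)) (suc+1 n))))))
    (subset-elim (env o (nx o i) y (+ suc n)) oddA₀ (evenA₀ ⟨ mS (+ 1) ⟩ ⟨ rotS axis₂ ⟩ ⟨ reflectS axis₂ ⟩)
      (onEnv (+ 1) (subset oddA₀ (evenA₀ ⟨ mS (+ 1) ⟩ ⟨ rotS axis₂ ⟩ ⟨ reflectS axis₂ ⟩)) check-top-even o (nx o i) y (+ suc n) (1≤suc n)) (top-odd n o (nx o i)))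
  where y = cyc o (nx o i) (3 ℕ.+ dbl n)

top-odd n o i = trans (sym (ascend oddA₀ o i (+ suc n) y)) (subset-elim (env o (nx o i) y (+ suc n)) evenA₀ (oddA₀ ⟨ rotS axis₂ ⟩ ⟨ reflectS axis₂ ⟩)
    (onEnv (+ 1) (subset evenA₀ (oddA₀ ⟨ rotS axis₂ ⟩ ⟨ reflectS axis₂ ⟩)) check-top-odd o (nx o i) y (+ suc n) (1≤suc n)) (top-even n o (nx o i)))
  where y = cyc o (nx o i) (2 ℕ.+ dbl n)

ind-value : ∀ ρ R → value ρ ((+ 1 , R) ∷ []) ≡ ind ρ R
ind-value ρ R = trans (ℤP.+-identityʳ _) (ℤP.*-identityˡ _)

-- The elements at which the coefficient of q is nonzero lie below one of these words, which are shorter by three.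
data Edge (o : Bool) (i : Gen) : ℕ → Word → Set where
  edgeA : ∀ {m x} → InD (cyc o i (suc m)) x → Edge o i (4 ℕ.+ m) x
  edgeB : ∀ {m x} j → InD (nx o j ∷ cyc o j (2 ℕ.+ m)) x → Edge o i (6 ℕ.+ m) x

edge-length : ∀ {o i n x} → Edge o i n x → 3 ℕ.+ ℓw x ≤ n
edge-length {o} {i} {x = x} (edgeA {m} p) = s≤s (s≤s (s≤s (subst (ℓw x ≤_) (cyc-length o i (suc m)) (InD-length (cyc o i (suc m)) x p))))
edge-length {o} {i} {x = x} (edgeB {m} j p) = s≤s (s≤s (s≤s (subst (ℓw x ≤_) (cong suc (cyc-length o j (2 ℕ.+ m))) (InD-length (nx o j ∷ cyc o j (2 ℕ.+ m)) x p))))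

edge-even : ∀ n o i x → In evenA₁ o i (+ suc n) x → Edge o i (2 ℕ.+ dbl n) x
edge-even zero o i x h = ⊥-elim (0≢1 (trans (sym (onEnvAt (+ 1) ((+ 1 , evenA₁) ∷ []) check-edge-two o i x)) (trans (ind-value (env o i x (+ 1)) evenA₁) h)))
edge-even (suc zero) o i x h = edgeA (below-one o i x (trans (sym (in-⟨⟩ unitA (mS -1ℤ) (env o i x (+ 2)) (env o i x (+ 1)) (env-m o i -1ℤ x (+ 2)))) (subset-elim (env o i x (+ 2)) evenA₁ (unitA ⟨ mS -1ℤ ⟩) (onEnvAt (+ 2) (subset evenA₁ (unitA ⟨ mS -1ℤ ⟩)) check-edge-four o i x) h)))
edge-even (suc (suc n)) o i x h = Sum.[ caseA , caseB ] (cover-elim (env o i x m) evenA₁ (oddA₀ ⟨ mS -2ℤ ⟩) (oddB₀ ⟨ mS -2ℤ ⟩ ⟨ rotS axis₂ ⟩)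
    (onEnv (+ 3) (cover evenA₁ (oddA₀ ⟨ mS -2ℤ ⟩) (oddB₀ ⟨ mS -2ℤ ⟩ ⟨ rotS axis₂ ⟩)) check-edge-even o i x m (+≤+ (s≤s (s≤s (s≤s z≤n))))) h)
  where
  j = ax o i axis₂
  m = + suc (suc (suc n))
  caseA : ind (env o i x m) (oddA₀ ⟨ mS -2ℤ ⟩) ≡ + 1 → Edge o i (6 ℕ.+ dbl n) x
  caseA p = edgeA (below-odd n o i x (trans (sym (in-⟨⟩ oddA₀ (mS -2ℤ) (env o i x m) (env o i x (+ suc n)) (env-m o i -2ℤ x m))) p))
  caseB : ind (env o i x m) (oddB₀ ⟨ mS -2ℤ ⟩ ⟨ rotS axis₂ ⟩) ≡ + 1 → Edge o i (6 ℕ.+ dbl n) x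
  caseB p = edgeB j (below-B n o j x (trans (sym (trans (in-⟨⟩ (oddB₀ ⟨ mS -2ℤ ⟩) (rotS axis₂) (env o i x m) (env o j x m) (env-rot o i axis₂ x m))
                 (in-⟨⟩ oddB₀ (mS -2ℤ) (env o j x m) (env o j x (+ suc n)) (env-m o j -2ℤ x m)))) p))

edge-odd : ∀ n o i x → In oddA₁ o i (+ suc n) x → Edge o i (3 ℕ.+ dbl n) x
edge-odd zero o i x h = ⊥-elim (0≢1 (trans (sym (onEnvAt (+ 1) ((+ 1 , oddA₁) ∷ []) check-edge-three o i x)) (trans (ind-value (env o i x (+ 1)) oddA₁) h)))
edge-odd (suc n) o i x h = edgeA (below-even n o i x (trans (sym (in-⟨⟩ evenA₀ (mS -1ℤ) (env o i x (+ suc (suc n))) (env o i x (+ suc n)) (env-m o i -1ℤ x (+ suc (suc n)))))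
  (subset-elim (env o i x (+ suc (suc n))) oddA₁ (evenA₀ ⟨ mS -1ℤ ⟩) (onEnv (+ 2) (subset oddA₁ (evenA₀ ⟨ mS -1ℤ ⟩)) check-edge-odd o i x (+ suc (suc n)) (+≤+ (s≤s (s≤s z≤n)))) h)))

-- Coefficients at cyclic words

module _ (o : Bool) (i : Gen) (n : ℕ) (m : ℤ) (R₀ R₁ : Region)
         (below : ∀ x → In R₀ o i m x → InD (cyc o i n) x) (top : In R₀ o i m (cyc o i n))
         (edge : ∀ x → In R₁ o i m x → Edge o i n x) (red : Red (cyc o i n)) where
  private
    a = cyc o i n
    F = FF (R₀ +q R₁) o i m
    len-a : length a ≡ n
    len-a = cyc-length o i n

  coefficient₁ : ∀ x → F x 1 ≡ + 0 ⊎ Edge o i n x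
  coefficient₁ x with ind-01 (env o i x m) R₁
  ... | inj₁ p = inj₁ (trans (ind-value (env o i x m) R₁) p)
  ... | inj₂ p = inj₂ (edge x p)

  -- An element with nonzero coefficient of q is at least three shorter than the word, which is the
  -- strict degree bound for k = 1.
  short : ∀ x → n ≤ 2 ℕ.+ ℓw x → F x 1 ≡ + 0
  short x l with coefficient₁ x
  ... | inj₁ p = p
  ... | inj₂ p = ⊥-elim (ℕP.<-irrefl refl (ℕP.≤-trans (edge-length p) l))

  explicit-normalized : Normalized a F
  explicit-normalized .atTop x zero q = trans (ind-value (env o i x m) R₀) (trans (cong (λ p → ind (subEnv (frame o i) (winEnv p m)) R₀) q) top)
  explicit-normalized .atTop x (suc zero) q = short x (ℕP.≤-trans (ℕP.≤-reflexive (sym (trans (cong ℓ q) (trans red len-a)))) (ℕP.m≤n+m (ℓw x) 2))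
  explicit-normalized .atTop x (suc (suc k)) q = refl
  explicit-normalized .bounded x zero ne l with ind-01 (env o i x m) R₀
  ... | inj₁ p = trans (ind-value (env o i x m) R₀) p
  ... | inj₂ p = ⊥-elim (ne (InD-top a x (below x p) l))
  explicit-normalized .bounded x (suc zero) ne l = short x (subst (_≤ 2 ℕ.+ ℓw x) len-a l)
  explicit-normalized .bounded x (suc (suc k)) ne l = refl

  explicit : InvE n F → K a ≐ F
  explicit (N , S) = K-unique a F N red explicit-normalized (subst (λ n → Inv n N F) (sym len-a) S)

  explicit-coefficients : InvE n F → (∀ x k → K a x (2 ℕ.+ k) ≡ + 0) × (∀ x → K a x 1 ≡ + 0 ⊎ Edge o i n x)
  explicit-coefficients S = (λ x k → explicit S x (2 ℕ.+ k)) , λ x → go x (coefficient₁ x)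
    where
    go : ∀ x → F x 1 ≡ + 0 ⊎ Edge o i n x → K a x 1 ≡ + 0 ⊎ Edge o i n x
    go x (inj₁ p) = inj₁ (trans (explicit S x 1) p)
    go x (inj₂ p) = inj₂ p

data Parity : ℕ → Set where
  isNil : Parity 0
  isOne   : Parity 1
  isEven  : ∀ n → Parity (2 ℕ.+ dbl n)
  isOdd   : ∀ n → Parity (3 ℕ.+ dbl n)

parity : ∀ n → Parity n
parity 0 = isNil
parity 1 = isOne
parity (suc (suc n)) with parity n
... | isNil = isEven 0
... | isOne = isOdd 0
... | isEven m = isEven (suc m)
... | isOdd m = isOdd (suc m)

cyc-coefficients : ∀ o i n → Red (cyc o i n) → (∀ x k → K (cyc o i n) x (2 ℕ.+ k) ≡ + 0) × (∀ x → K (cyc o i n) x 1 ≡ + 0 ⊎ Edge o i n x)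
cyc-coefficients o i n red with parity n
... | isNil = (λ x k → nil x (suc k)) , λ x → inj₁ (nil x 0)
  where
  nil : ∀ x k → K [] x (suc k) ≡ + 0
  nil x k = sym (A₀≐K o i x (suc k))
... | isOne = (λ x k → e x (2 ℕ.+ k)) , λ x → inj₁ (e x 1)
  where
  nothing-below : Region
  -- The inequality -1 ≥ 0 defines the empty region, which brings the one-letter word into the shape
  -- required by `explicit`.
  nothing-below = (+ 0 , + 0 , + 0 , - + 1) ∷ []
  F = FF (unitA +q nothing-below) o i (+ 1)
  never : ∀ x → In nothing-below o i (+ 1) x → Edge o i 1 x
  never x h with () ← subst (+ 0 ℤ.≤_) refl (All.head (ind-Sat (env o i x (+ 1)) nothing-below h))
  F≐ : F ≐ A₁ o i
  F≐ x zero = refl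
  F≐ x (suc zero) = refl
  F≐ x (suc (suc k)) = refl
  e = λ x k → trans (explicit o i 1 (+ 1) unitA nothing-below (below-one o i) (top-one o i) never red (invE-ext F≐ (inv-A₁ o i)) x k) (F≐ x k)
... | isEven m = explicit-coefficients o i (2 ℕ.+ dbl m) (+ suc m) evenA₀ evenA₁ (below-even m o i) (top-even m o i) (edge-even m o i) red (inv-Ae m o i)
... | isOdd m = explicit-coefficients o i (3 ℕ.+ dbl m) (+ suc m) oddA₀ oddA₁ (below-odd m o i) (top-odd m o i) (edge-odd m o i) red (inv-Ao m o i)

-- Elements with a unique reduced expression

∼-++ : ∀ x y w → x ∼ y → (x ++ w) ∼ (y ++ w)
∼-++ x y w e = eval≡⇒iv≡ {x ++ w} {y ++ w} (trans (ListP.foldl-++ act idW x w)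
  (trans (cong (λ p → foldl act p w) (iv≡⇒eval≡ {x} {y} e)) (sym (ListP.foldl-++ act idW y w))))

++-⇒ : ∀ p {w w'} → w ⇒ w' → (p ++ w) ∼ (p ++ w')
++-⇒ p {w} {w'} m = eval≡⇒iv≡ {p ++ w} {p ++ w'} (trans (ListP.foldl-++ act idW p w)
  (trans (foldl-⇒ (eval p) m) (sym (ListP.foldl-++ act idW p w'))))

ℓ≤-of : ∀ x w → x ∼ w → ℓw x ≤ length w
ℓ≤-of x w e = subst (_≤ length w) (cong ℓ (sym e)) (ℓ≤length w)

Unique : Word → Set
Unique a = ∀ b → Red b → b ∼ a → b ≡ a

∼-cons : ∀ g x y → x ∼ y → (g ∷ x) ∼ (g ∷ y)
∼-cons g x y = cong (λ p → act p g)

red-of : ∀ a b → Red a → b ∼ a → length b ≡ length a → Red b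
red-of a b ra e l = trans (cong ℓ e) (trans ra (sym l))

red-length : ∀ a b → Red a → Red b → b ∼ a → length b ≡ length a
red-length a b ra rb e = trans (sym rb) (trans (cong ℓ e) ra)

unique-tail : ∀ g a → Red (g ∷ a) → Unique (g ∷ a) → Unique a
unique-tail g a ra u b rb e = ListP.∷-injectiveʳ (u (g ∷ b) (red-of (g ∷ a) (g ∷ b) ra (∼-cons g b a e) (cong suc (red-length a b (proj₁ (red-tail g a ra)) rb e))) (∼-cons g b a e))

length-snoc : ∀ (p : Word) g → length (p ++ g ∷ []) ≡ suc (length p)
length-snoc p g = trans (ListP.length-++ p) (ℕP.+-comm (length p) 1)

red-init : ∀ p g → Red (p ++ g ∷ []) → Red p
red-init p g r = ℕP.≤-antisym (ℓ≤length p) (ℕ.s≤s⁻¹ (begin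
  suc (length p)                    ≡⟨ length-snoc p g ⟨
  length (p ++ g ∷ [])              ≡⟨ r ⟨
  ℓw (p ++ g ∷ [])                  ≤⟨ ℓ≤-of (p ++ g ∷ []) (nf (iv p) ++ g ∷ []) (∼-++ p (nf (iv p)) (g ∷ []) (sym (nf-∼ p))) ⟩
  length (nf (iv p) ++ g ∷ [])      ≡⟨ length-snoc (nf (iv p)) g ⟩
  suc (length (nf (iv p)))          ≡⟨ cong suc (length-nf (iv p)) ⟩
  suc (ℓw p)                        ∎))
  where open ℕP.≤-Reasoning

unique-init : ∀ p g → Red (p ++ g ∷ []) → Unique (p ++ g ∷ []) → Unique p
unique-init p g r u b rb e = ListP.∷ʳ-injectiveˡ b p (u (b ++ g ∷ [])
  (red-of (p ++ g ∷ []) (b ++ g ∷ []) r (∼-++ b p (g ∷ []) e) (trans (length-snoc b g) (trans (cong suc (red-length p b (red-init p g r) rb e)) (sym (length-snoc p g)))))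
  (∼-++ b p (g ∷ []) e))

it : Bool → ℕ → Gen → Gen
it o zero    i = i
it o (suc m) i = it o m (nx o i)

it-suc : ∀ o m i → it o (suc m) i ≡ nx o (it o m i)
it-suc o zero i = refl
it-suc o (suc m) i = it-suc o m (nx o i)

cyc-++ : ∀ o i m n → cyc o i (m ℕ.+ n) ≡ cyc o i m ++ cyc o (it o m i) n
cyc-++ o i zero n = refl
cyc-++ o i (suc m) n = cong (i ∷_) (cyc-++ o (nx o i) m n)

cyc-snoc : ∀ o i n → cyc o i (suc n) ≡ cyc o i n ++ it o n i ∷ []
cyc-snoc o i n = trans (cong (cyc o i) (ℕP.+-comm 1 n)) (cyc-++ o i n 1)

nx≢ : ∀ o i → ¬ i ≡ nx o i
nx≢ true  = from-yes (all? λ i → ¬? (i Fin.≟ nx true i))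
nx≢ false = from-yes (all? λ i → ¬? (i Fin.≟ nx false i))

orient : ∀ g h → ¬ g ≡ h → ∃ λ o → nx o g ≡ h
orient g h ne with from-yes (all? λ g → all? λ h → (g Fin.≟ h) ⊎-dec ((nx true g Fin.≟ h) ⊎-dec (nx false g Fin.≟ h))) g h
... | inj₁ e        = ⊥-elim (ne e)
... | inj₂ (inj₁ e) = true , e
... | inj₂ (inj₂ e) = false , e

third-gen : ∀ o g h → ¬ g ≡ h → ¬ g ≡ nx o h → nx o g ≡ h
third-gen o g h ne ne' with cases o g h
  where
  cases : ∀ o g h → g ≡ h ⊎ (g ≡ nx o h ⊎ nx o g ≡ h)
  cases true  = from-yes (all? λ g → all? λ h → (g Fin.≟ h) ⊎-dec ((g Fin.≟ nx true h) ⊎-dec (nx true g Fin.≟ h)))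
  cases false = from-yes (all? λ g → all? λ h → (g Fin.≟ h) ⊎-dec ((g Fin.≟ nx false h) ⊎-dec (nx false g Fin.≟ h)))
... | inj₁ e        = ⊥-elim (ne e)
... | inj₂ (inj₁ e) = ⊥-elim (ne' e)
... | inj₂ (inj₂ e) = e

red-distinct : ∀ g h a → Red (g ∷ h ∷ a) → ¬ g ≡ h
red-distinct g .g a r refl with () ← trans (sym (proj₂ (red-tail g (g ∷ a) r)))
  (trans (desc-act g (valid-iv a)) (cong not (proj₂ (red-tail g a (proj₁ (red-tail g (g ∷ a) r))))))

-- Adjacent letters differ because the word is reduced, and letters at distance two differ because a
-- factor ghg would admit a braid move. With three generators this forces a constant sense of
-- rotation.
unique-cyclic : ∀ a → Red a → Unique a → ∃ λ o → ∃ λ i → a ≡ cyc o i (length a)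
unique-cyclic [] r u = true , Defs.r , refl
unique-cyclic (g ∷ []) r u = true , g , refl
unique-cyclic (g ∷ h ∷ []) r u with orient g h (red-distinct g h [] r)
... | o , e = o , g , cong (λ k → g ∷ k ∷ []) (sym e)
unique-cyclic (g ∷ h ∷ k ∷ a) r u with unique-cyclic (h ∷ k ∷ a) (proj₁ (red-tail g (h ∷ k ∷ a) r)) (unique-tail g (h ∷ k ∷ a) r u)
... | o , i , e = o , g , cong (g ∷_) (trans e (cong (λ j → cyc o j (2 ℕ.+ length a)) (sym nxg)))
  where
  h≡ : h ≡ i
  h≡ = ListP.∷-injectiveˡ e
  k≡ : k ≡ nx o i
  k≡ = ListP.∷-injectiveˡ (ListP.∷-injectiveʳ e)
  g≢h : ¬ g ≡ h
  g≢h = red-distinct g h (k ∷ a) r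
  g≢k : ¬ g ≡ k
  g≢k refl = g≢h (sym (ListP.∷-injectiveˡ (u (h ∷ g ∷ h ∷ a) (red-of (g ∷ h ∷ g ∷ a) (h ∷ g ∷ h ∷ a) r e' refl) e')))
    where
    e' : (h ∷ g ∷ h ∷ a) ∼ (g ∷ h ∷ g ∷ a)
    e' = act-braid (iv a) h g (g≢h ∘ sym)
  nxg : nx o g ≡ i
  nxg = third-gen o g i (λ q → g≢h (trans q (sym h≡))) (λ q → g≢k (trans q (sym k≡)))

-- As x is only one shorter, everything after the first omitted letter must be used in full, by
-- `InD-top`. A letter that is used is a left descent of x; otherwise i x would be too long for the
-- tail.
deletion : ∀ o n i x → InD (cyc o i n) x → suc (ℓw x) ≡ n →
  ∃ λ m → ∃ λ k → n ≡ m ℕ.+ suc k × x ∼ (cyc o i m ++ cyc o (nx o (it o m i)) k)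
deletion o (suc n) i x (inj₁ p) e = 0 , n , refl ,
  InD-top (cyc o (nx o i) n) x p (ℕP.≤-reflexive (trans (cyc-length o (nx o i) n) (sym (ℕP.suc-injective e))))
deletion o (suc n) i x (inj₂ p) e with desc i (iv x) in d
... | false = ⊥-elim (ℕP.<-irrefl refl (ℕP.≤-trans (ℕP.≤-reflexive (sym (ℓ-asc i (valid-iv x) d)))
                (ℕP.≤-trans (InD-length (cyc o (nx o i) n) (i ∷ x) p) (ℕP.≤-reflexive (trans (cyc-length o (nx o i) n) (sym (ℕP.suc-injective e)))))))
... | true with deletion o n (nx o i) (i ∷ x) p (trans (sym (ℓ-desc i (valid-iv x) d)) (ℕP.suc-injective e))
...   | m , k , n≡ , q = suc m , k , cong suc n≡ , cancel-act i {x} {cyc o (nx o i) m ++ cyc o (nx o (it o m (nx o i))) k} q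

InL-of : ∀ u g w → (g ∷ u) ∼ w → suc (length w) ≤ ℓw u → InL u g
InL-of u g w e l = subst₂ _<_ (sym (len≡ℓ (g ∷ u))) (sym (len≡ℓ u)) (ℕP.≤-trans (s≤s (ℓ≤-of (g ∷ u) w e)) l)

InR-of : ∀ u g w → (u ++ g ∷ []) ∼ w → suc (length w) ≤ ℓw u → InR u g
InR-of u g w e l = subst₂ _<_ (sym (len≡ℓ (u ++ g ∷ []))) (sym (len≡ℓ u)) (ℕP.≤-trans (s≤s (ℓ≤-of (u ++ g ∷ []) w e)) l)

two-left : ∀ u x y w → ¬ x ≡ y → u ∼ (x ∷ y ∷ x ∷ w) → ℓw u ≡ 3 ℕ.+ length w → ¬ ExactlyOne (InL u)
two-left u x y w ne e l (σ , _ , only) = ne (trans (only x inx) (sym (only y iny)))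
  where
  inx : InL u x
  inx = InL-of u x (y ∷ x ∷ w) (trans (∼-cons x u (x ∷ y ∷ x ∷ w) e) (act-involutive (iv (y ∷ x ∷ w)) x)) (ℕP.≤-reflexive (sym l))
  iny : InL u y
  iny = InL-of u y (x ∷ y ∷ w) (trans (∼-cons y u (y ∷ x ∷ y ∷ w) (trans e (act-braid (iv w) x y ne))) (act-involutive (iv (x ∷ y ∷ w)) y)) (ℕP.≤-reflexive (sym l))

xyxy⇒yx : ∀ {x y w} → ¬ x ≡ y → x ∷ y ∷ x ∷ y ∷ w ⇒ y ∷ x ∷ w
xyxy⇒yx ne = ⇒-trans (move (braid ne)) (⇒-cons (⇒-cons delete))

two-right : ∀ u p x y → ¬ x ≡ y → u ∼ (p ++ x ∷ y ∷ x ∷ []) → ℓw u ≡ length p ℕ.+ 3 → ¬ ExactlyOne (InR u)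
two-right u p x y ne e l (σ , _ , only) = ne (trans (only x inx) (sym (only y iny)))
  where
  snoc : ∀ g → (u ++ g ∷ []) ∼ (p ++ x ∷ y ∷ x ∷ g ∷ [])
  snoc g = trans (∼-++ u (p ++ x ∷ y ∷ x ∷ []) (g ∷ []) e) (cong iv (ListP.++-assoc p (x ∷ y ∷ x ∷ []) (g ∷ [])))
  bound : ∀ g h → suc (length (p ++ g ∷ h ∷ [])) ≤ ℓw u
  bound g h = ℕP.≤-reflexive (trans (cong suc (ListP.length-++ p)) (trans (sym (ℕP.+-suc (length p) 2)) (sym l)))
  inx : InR u x
  inx = InR-of u x (p ++ x ∷ y ∷ []) (trans (snoc x) (++-⇒ p (⇒-cons (⇒-cons delete)))) (bound x y)
  iny : InR u y
  iny = InR-of u y (p ++ y ∷ x ∷ []) (trans (snoc y) (++-⇒ p (xyxy⇒yx ne))) (bound y x)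

red-two : ∀ x y → ¬ x ≡ y → Red (x ∷ y ∷ [])
red-two x y ne = find (all-pairs x y)
  where
  all-pairs : ∀ x y → x ≡ y ⊎ Red (x ∷ y ∷ [])
  all-pairs = from-yes (all? λ x → all? λ y → (x Fin.≟ y) ⊎-dec (ℓw (x ∷ y ∷ []) ℕ.≟ 2))
  find : x ≡ y ⊎ Red (x ∷ y ∷ []) → Red (x ∷ y ∷ [])
  find (inj₁ q) = ⊥-elim (ne q)
  find (inj₂ q) = q

unique-two : ∀ x y → ¬ x ≡ y → Unique (x ∷ y ∷ [])
unique-two x y ne b rb e = go b (red-length (x ∷ y ∷ []) b (red-two x y ne) rb e) e
  where
  Same : Gen → Gen → Gen → Gen → Set
  Same x y x' y' = x ≡ y ⊎ (¬ (x' ∷ y' ∷ []) ∼ (x ∷ y ∷ []) ⊎ (x' ∷ y' ∷ []) ≡ (x ∷ y ∷ []))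
  all-pairs : ∀ x y x' y' → Same x y x' y'
  all-pairs = from-yes (all? λ x → all? λ y → all? λ x' → all? λ y' →
    (x Fin.≟ y) ⊎-dec (¬? ((x' ∷ y' ∷ []) ∼? (x ∷ y ∷ [])) ⊎-dec ListP.≡-dec Fin._≟_ (x' ∷ y' ∷ []) (x ∷ y ∷ [])))
  find : ∀ x' y' → Same x y x' y' → (x' ∷ y' ∷ []) ∼ (x ∷ y ∷ []) → (x' ∷ y' ∷ []) ≡ (x ∷ y ∷ [])
  find x' y' (inj₁ q) _ = ⊥-elim (ne q)
  find x' y' (inj₂ (inj₁ q)) e = ⊥-elim (q e)
  find x' y' (inj₂ (inj₂ q)) _ = q
  go : ∀ b → length b ≡ 2 → b ∼ (x ∷ y ∷ []) → b ≡ x ∷ y ∷ []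
  go (x' ∷ y' ∷ []) _ = find x' y' (all-pairs x y x' y')

InC1-of : ∀ u v → ¬ IsE u → u ∼ v → Unique v → InC1 u
InC1-of u v ne e uv = ne , λ a b ra rb ea eb → trans (determined a ra ea) (sym (determined b rb eb))
  where
  determined : ∀ a → Reduced a → eval a ≡ eval u → a ≡ v
  determined a ra ea = uv a (trans (sym (len≡ℓ a)) ra) (trans (eval≡⇒iv≡ {a} {u} ea) e)

InC1-unique : ∀ w → InC1 w → Unique (redWord w)
InC1-unique w (_ , uw) b rb e = uw b (redWord w) (trans (len≡ℓ b) rb) (trans (len≡ℓ (redWord w)) (redWord-red w))
  (iv≡⇒eval≡ {b} {w} (trans e (redWord-∼ w))) (iv≡⇒eval≡ {redWord w} {w} (redWord-∼ w))

-- Elements of c₀ that are one or three letters shorter than a cyclic word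

module _ (u : Word) (u∈c₀ : InC0 u) (L₁ : ExactlyOne (InL u)) (R₁ : ExactlyOne (InR u)) where

  not-unique : ∀ v → u ∼ v → Unique v → ⊥
  not-unique v e uv = proj₂ u∈c₀ (InC1-of u v (proj₁ u∈c₀) e uv)

  module _ (o : Bool) where

    unique-prefix : ∀ i n → Red (cyc o i (suc n)) → Unique (cyc o i (suc n)) → Red (cyc o i n) × Unique (cyc o i n)
    unique-prefix i n r uc = red-init (cyc o i n) g r' , unique-init (cyc o i n) g r' (subst Unique (cyc-snoc o i n) uc)
      where
      g = it o n i
      r' = subst Red (cyc-snoc o i n) r

    -- The letters have period three, so omitting the one after x y leaves x y x y .... This
    -- shortens if two letters follow the gap; otherwise the gap is so close to an end that a cyclic
    -- word or a terminal braid remains.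
    no-deletion : ∀ i n → Red (cyc o i n) → Unique (cyc o i n) → suc (ℓw u) ≡ n → ¬ InD (cyc o i n) u
    no-deletion i n rc uc e p with deletion o n i u p e
    ... | m , k , n≡ , q = go m k n≡ q
      where
      go : ∀ m k → n ≡ m ℕ.+ suc k → u ∼ (cyc o i m ++ cyc o (nx o (it o m i)) k) → ⊥
      go zero k refl q = not-unique (cyc o (nx o i) k) q (unique-tail i (cyc o (nx o i) k) rc uc)
      go m zero n≡ q = not-unique (cyc o i m) (trans q (cong iv (ListP.++-identityʳ (cyc o i m))))
          (proj₂ (unique-prefix i m (subst (Red ∘ cyc o i) n≡' rc) (subst (Unique ∘ cyc o i) n≡' uc)))
        where n≡' = trans n≡ (ℕP.+-comm m 1)
      -- The two remaining letters i, i + 2 are cyclic for the opposite orientation.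
      go (suc zero) (suc zero) n≡ q = not-unique _ q (unique-two i (nx o (nx o i)) λ z → nx≢ o (nx o (nx o i)) (trans (sym z) (sym (nx³ o i))))
      -- Without its second letter the word begins with i, i + 2, i.
      go (suc zero) (suc (suc k)) n≡ q = two-left u i (nx o (nx o i)) (cyc o (nx o i) k) (λ z → nx≢ o (nx o (nx o i)) (trans (sym z) (sym (nx³ o i))))
        (trans q (cong (λ j → iv (i ∷ nx o (nx o i) ∷ j ∷ cyc o (nx o j) k)) (nx³ o i)))
        (trans (ℕP.suc-injective (trans e n≡)) (cong (3 ℕ.+_) (sym (cyc-length o (nx o i) k)))) L₁
      go (suc (suc m)) (suc k) n≡ q = last k n≡ (trans q (cong iv (trans (cong₂ _++_ split (cong (λ j → cyc o j (suc k)) back)) (ListP.++-assoc (cyc o i m) (x ∷ y ∷ []) (x ∷ cyc o y k)))))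
        where
        x = it o m i
        y = nx o x
        split : cyc o i (suc (suc m)) ≡ cyc o i m ++ x ∷ y ∷ []
        split = trans (cong (cyc o i) (ℕP.+-comm 2 m)) (cyc-++ o i m 2)
        back : nx o (it o (suc (suc m)) i) ≡ x
        back = trans (cong (nx o) (trans (it-suc o (suc m) i) (cong (nx o) (it-suc o m i)))) (nx³ o x)
        last : ∀ k → n ≡ suc (suc m) ℕ.+ suc (suc k) → u ∼ (cyc o i m ++ x ∷ y ∷ x ∷ cyc o y k) → ⊥
        last zero n≡ q = two-right u (cyc o i m) x y (nx≢ o x) q
          (trans (ℕP.suc-injective (trans e n≡)) (trans (sym (ℕP.+-suc m 2)) (cong (ℕ._+ 3) (sym (cyc-length o i m))))) R₁
        -- Here xyxy = yx makes u two letters shorter than its length allows.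
        last (suc k) n≡ q = ℕP.<-irrefl refl (begin-strict
            ℓw u                                                   ≤⟨ ℓ≤-of u (cyc o i m ++ y ∷ x ∷ cyc o (nx o y) k) (trans q (++-⇒ (cyc o i m) (xyxy⇒yx (nx≢ o x)))) ⟩
            length (cyc o i m ++ y ∷ x ∷ cyc o (nx o y) k)         ≡⟨ ListP.length-++ (cyc o i m) ⟩
            length (cyc o i m) ℕ.+ (2 ℕ.+ length (cyc o (nx o y) k)) ≡⟨ cong₂ (λ a b → a ℕ.+ (2 ℕ.+ b)) (cyc-length o i m) (cyc-length o (nx o y) k) ⟩
            m ℕ.+ (2 ℕ.+ k)                                        <⟨ ℕP.+-monoʳ-< m (ℕP.n<1+n (2 ℕ.+ k)) ⟩
            m ℕ.+ (3 ℕ.+ k)                                        <⟨ ℕP.n<1+n _ ⟩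
            suc (m ℕ.+ (3 ℕ.+ k))                                  ≡⟨ ℕP.suc-injective (trans e n≡) ⟨
            ℓw u                                                   ∎)
          where open ℕP.≤-Reasoning

    -- By its length u must equal the bounding word. That is either a prefix of A, hence again with
    -- a unique reduced expression, or a word B, whose initial braid gives two left descents.
    no-edge : ∀ i n → Red (cyc o i n) → Unique (cyc o i n) → 3 ℕ.+ ℓw u ≡ n → ¬ Edge o i n u
    no-edge i n rc uc e (edgeA {m} p) = not-unique (cyc o i (suc m))
        (InD-top (cyc o i (suc m)) u p (ℕP.≤-reflexive (trans (cyc-length o i (suc m)) (sym (ℕP.suc-injective (ℕP.suc-injective (ℕP.suc-injective e)))))))
        (proj₂ (drop (suc m) (drop (2 ℕ.+ m) (drop (3 ℕ.+ m) (rc , uc)))))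
      where
      drop : ∀ n → Red (cyc o i (suc n)) × Unique (cyc o i (suc n)) → Red (cyc o i n) × Unique (cyc o i n)
      drop n (r , uq) = unique-prefix i n r uq
    no-edge i n rc uc e (edgeB {m} j p) = two-left u (nx o j) j (cyc o (nx o (nx o j)) m) (nx≢ o j ∘ sym)
        (InD-top (nx o j ∷ cyc o j (2 ℕ.+ m)) u p (ℕP.≤-reflexive (trans (cong suc (cyc-length o j (2 ℕ.+ m))) (sym ℓu))))
        (trans ℓu (cong (3 ℕ.+_) (sym (cyc-length o (nx o (nx o j)) m)))) L₁
      where
      ℓu : ℓw u ≡ 3 ℕ.+ m
      ℓu = ℕP.suc-injective (ℕP.suc-injective (ℕP.suc-injective e))

    -- The length differences 1 and 3 are excluded by the two preceding lemmas; from 5 on the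
    -- relevant power of q exceeds the degree of the polynomial.
    coefficient-zero : ∀ i n k → Red (cyc o i n) → Unique (cyc o i n) → suc (k ℕ.+ k) ℕ.+ ℓw u ≡ n → K (cyc o i n) u k ≡ + 0
    coefficient-zero i n zero rc uc e = support n (cyc o i n) u 0 (ℕP.≤-reflexive (cyc-length o i n)) (no-deletion i n rc uc e)
    coefficient-zero i n (suc zero) rc uc e with proj₂ (cyc-coefficients o i n rc) u
    ... | inj₁ p = p
    ... | inj₂ p = ⊥-elim (no-edge i n rc uc e p)
    coefficient-zero i n (suc (suc k)) rc uc e = proj₁ (cyc-coefficients o i n rc) u k

odd-split : ∀ d → d % 2 ≡ 1 → d ≡ suc ((d ∸ 1) / 2 ℕ.+ (d ∸ 1) / 2)
odd-split d e = trans d≡ (cong (λ k → suc (k ℕ.+ k)) (sym (trans (cong (λ d → (d ∸ 1) / 2) d≡) (double-half (d / 2)))))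
  where
  lemma : ∀ h → 1 ℕ.+ h ℕ.* 2 ≡ suc (h ℕ.+ h)
  lemma = solveℕ-∀
  d≡ : d ≡ suc (d / 2 ℕ.+ d / 2)
  d≡ = trans (DM.m≡m%n+[m/n]*n d 2) (trans (cong (λ r → r ℕ.+ d / 2 ℕ.* 2) e) (lemma (d / 2)))

muOf-zero : ∀ p l n → (∀ k → suc (k ℕ.+ k) ℕ.+ l ≡ n → coeff p k ≡ + 0) → muOf p l n ≡ + 0
muOf-zero p l n H with (n ∸ l) % 2 in odd
... | 0 = refl
... | suc (suc _) = refl
... | 1 = H ((n ∸ l ∸ 1) / 2) (trans (cong (ℕ._+ l) (sym d≡)) (ℕP.m∸n+n≡m {n} {l} (ℕP.<⇒≤ (ℕP.m∸n≢0⇒n<m {n} {l} λ z → ℕP.0≢1+n (trans (sym z) d≡)))))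
  where d≡ = odd-split (n ∸ l) odd

theorem6p10 : (u w : Word) → u <B w → InC0 u → InC1 w →
    ExactlyOne (InL u) → ExactlyOne (InR u) → μ u w ≡ + 0
theorem6p10 u w _ cu cw L₁ R₁ = muOf-zero (KL u w) (len u) (len w) λ k e → vanish k (trans (cong (suc (k ℕ.+ k) ℕ.+_) (sym (len≡ℓ u)))
    (trans e (trans (len≡ℓ w) (sym (redWord-length w)))))
  where
  -- By definition `KL u w` has the coefficients `K a u`.
  a = redWord w
  vanish : ∀ k → suc (k ℕ.+ k) ℕ.+ ℓw u ≡ length a → K a u k ≡ + 0
  vanish k size with unique-cyclic a (redWord-red w) (InC1-unique w cw)
  ... | o , i , a≡ = trans (cong (λ b → K b u k) a≡)
        (coefficient-zero u cu L₁ R₁ o i (length a) k (subst Red a≡ (redWord-red w)) (subst Unique a≡ (InC1-unique w cw)) size)
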